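{- Let $k,\ell$ be integers with $0\le\ell<k$ and let $L=\{\ell\}$. Then for all sufficiently large $n$, \[\vartheta(G(n,k,L))=1+\frac{\binom{k}{k-\ell}\binom{n-k}{k-\ell}}{\sum_{j=0}^{k-\ell}(-1)^{j+1}\binom{\ell+1}{j}\binom{k-\ell-1}{k-\ell-j}\binom{n-k-\ell-1}{k-\ell-j}},\] and this quantity equals $\frac{\binom{k}{k-\ell}}{(k-\ell)(\ell+1)}n+O(1)$ as $n\to\infty$. Similarly, if $L'=[0,k-1]\setminus\{\ell\}$, then as $n\to\infty$, \[\vartheta(G(n,k,L'))=\frac{\binom{n}{k}}{\vartheta(G(n,k,L))}=\frac{(\ell+1)(k-\ell)}{k!\binom{k}{k-\ell}}n^{k-1}+O(n^{k-2}).\]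
   Context: $[a,b]=\{a,\ldots,b\}$; $\binom{[n]}{k}$ is the family of $k$-subsets of $\{1,\ldots,n\}$. For $L\subset[0,k-1]$, the generalized Johnson graph $G(n,k,L)$ has vertex set $\binom{[n]}{k}$, with $A,B$ adjacent iff $|A\cap B|\notin L$. For a graph $G$ on $N$ vertices, the Lovász number is $\vartheta(G)=\max\sum_{i,j}b_{ij}$ over all $N\times N$ positive semidefinite matrices $B=(b_{ij})$ with trace $1$ and $b_{ij}=0$ whenever $ij$ is an edge. Here $k,\ell$ are fixed and $n\to\infty$. -}

module Defs where

open import Algebra.Bundles.Raw using (RawMonoid)
open import Data.Fin.Base as Fin using (Fin; toℕ)
open import Data.Fin.Properties using (+↔⊎)
open import Data.Fin.Subset as Subset using (Subset; ∣_∣; _∩_; inside; outside)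
open import Data.Fin.Subset.Properties using (∩-comm)
open import Data.Integer.Base as ℤ using (ℤ; +_; -[1+_])
open import Data.Nat.Base as ℕ using (ℕ; zero; suc; _!)
open import Data.Nat.Combinatorics using (_C_; nCk≡n!/k![n-k]!; k![n∸k]!∣n!)
open import Data.Nat.Divisibility using (∣⇒≤)
open import Data.Nat.DivMod using (m≥n⇒m/n>0)
import Data.Nat.Properties as ℕP
open import Data.Product.Base using (Σ; Σ-syntax; ∃; _×_; _,_; proj₁; proj₂)
open import Data.Rational.Base as ℚ using (ℚ; 0ℚ; 1ℚ; ½)
import Data.Rational.Properties as ℚP
open import Data.Rational.Solver using (module +-*-Solver)
open import Data.Sum.Base using (inj₁; inj₂; [_,_]′)
open import Data.Sum.Function.Propositional using (_⊎-↔_)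
open import Data.Vec.Base using ([]; _∷_)
open import Function.Bundles using (_↔_; Inverse; mk↔ₛ′)
open import Function.Construct.Composition using (_↔-∘_)
open import Level using (0ℓ)
open import Relation.Binary.PropositionalEquality
open import Relation.Nullary.Negation using (¬_)
import Algebra.Definitions.RawMonoid as RawMonoidDefs

Eventually : (ℕ → Set) → Set
Eventually P = Σ[ n₀ ∈ ℕ ] (∀ n → n₀ ℕ.≤ n → P n)

-- Real numbers: Cauchy sequences of rationals carrying a modulus of
-- convergence, compared by the setoid equality _≈_ below.

IsCauchy : (ℕ → ℚ) → Set
IsCauchy x = ∀ ε → 0ℚ ℚ.< ε →
  Σ[ N ∈ ℕ ] (∀ m n → N ℕ.≤ m → N ℕ.≤ n → ℚ.∣ x m ℚ.- x n ∣ ℚ.≤ ε)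

record ℝ : Set where
  constructor mkℝ
  field
    seq    : ℕ → ℚ
    cauchy : IsCauchy seq

open ℝ public

infix 4 _≈_ _≤_ _#_

_≈_ : ℝ → ℝ → Set
x ≈ y = ∀ ε → 0ℚ ℚ.< ε → Eventually λ n → ℚ.∣ seq x n ℚ.- seq y n ∣ ℚ.≤ ε

_≤_ : ℝ → ℝ → Set
x ≤ y = ∀ ε → 0ℚ ℚ.< ε → Eventually λ n → seq x n ℚ.≤ seq y n ℚ.+ ε

-- Apartness, the constructive form of x ≠ y.
_#_ : ℝ → ℝ → Set
x # y = Σ[ ε ∈ ℚ ] (0ℚ ℚ.< ε × Eventually λ n → ε ℚ.≤ ℚ.∣ seq x n ℚ.- seq y n ∣)

private
  0<½ε : ∀ {ε} → 0ℚ ℚ.< ε → 0ℚ ℚ.< ½ ℚ.* ε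
  0<½ε {ε} 0<ε = subst (ℚ._< ½ ℚ.* ε) (ℚP.*-zeroʳ ½) (ℚP.*-monoʳ-<-pos ½ 0<ε)

  ½+½ : ∀ ε → ½ ℚ.* ε ℚ.+ ½ ℚ.* ε ≡ ε
  ½+½ ε = trans (sym (ℚP.*-distribʳ-+ ε ½ ½)) (ℚP.*-identityˡ ε)

  const-cauchy : ∀ q → IsCauchy (λ _ → q)
  const-cauchy q ε 0<ε = 0 , λ _ _ _ _ →
    subst (ℚ._≤ ε) (cong ℚ.∣_∣ (sym (ℚP.+-inverseʳ q))) (ℚP.<⇒≤ 0<ε)

  +-cauchy : ∀ x y → IsCauchy x → IsCauchy y → IsCauchy (λ n → x n ℚ.+ y n)
  +-cauchy x y cx cy ε 0<ε with cx (½ ℚ.* ε) (0<½ε 0<ε) | cy (½ ℚ.* ε) (0<½ε 0<ε)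
  ... | M , p | N , q = M ℕ.⊔ N , λ m n a b → begin
      ℚ.∣ (x m ℚ.+ y m) ℚ.- (x n ℚ.+ y n) ∣
        ≡⟨ cong ℚ.∣_∣ (regroup (x m) (y m) (x n) (y n)) ⟩
      ℚ.∣ (x m ℚ.- x n) ℚ.+ (y m ℚ.- y n) ∣
        ≤⟨ ℚP.∣p+q∣≤∣p∣+∣q∣ (x m ℚ.- x n) (y m ℚ.- y n) ⟩
      ℚ.∣ x m ℚ.- x n ∣ ℚ.+ ℚ.∣ y m ℚ.- y n ∣
        ≤⟨ ℚP.+-mono-≤ (p m n (l a) (l b)) (q m n (r a) (r b)) ⟩
      ½ ℚ.* ε ℚ.+ ½ ℚ.* ε
        ≡⟨ ½+½ ε ⟩
      ε ∎
    where
    open ℚP.≤-Reasoning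
    l : ∀ {k} → M ℕ.⊔ N ℕ.≤ k → M ℕ.≤ k
    l = ℕP.≤-trans (ℕP.m≤m⊔n M N)
    r : ∀ {k} → M ℕ.⊔ N ℕ.≤ k → N ℕ.≤ k
    r = ℕP.≤-trans (ℕP.m≤n⊔m M N)
    regroup : ∀ a b c d → (a ℚ.+ b) ℚ.- (c ℚ.+ d) ≡ (a ℚ.- c) ℚ.+ (b ℚ.- d)
    regroup = solve 4 (λ a b c d → (a :+ b) :- (c :+ d) := (a :- c) :+ (b :- d)) refl
      where open +-*-Solver

  neg-cauchy : ∀ x → IsCauchy x → IsCauchy (λ n → ℚ.- x n)
  neg-cauchy x cx ε 0<ε with cx ε 0<ε
  ... | N , p = N , λ m n a b → subst (ℚ._≤ ε)
      (trans (sym (ℚP.∣-p∣≡∣p∣ (x m ℚ.- x n))) (cong ℚ.∣_∣ (regroup (x m) (x n)))) (p m n a b)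
    where
    regroup : ∀ a b → ℚ.- (a ℚ.- b) ≡ ℚ.- a ℚ.- ℚ.- b
    regroup = solve 2 (λ a b → :- (a :- b) := :- a :- :- b) refl
      where open +-*-Solver

  ∣a∣≤∣a-b∣+∣b∣ : ∀ a b → ℚ.∣ a ∣ ℚ.≤ ℚ.∣ a ℚ.- b ∣ ℚ.+ ℚ.∣ b ∣
  ∣a∣≤∣a-b∣+∣b∣ a b = subst (λ c → ℚ.∣ c ∣ ℚ.≤ ℚ.∣ a ℚ.- b ∣ ℚ.+ ℚ.∣ b ∣)
      (regroup a b) (ℚP.∣p+q∣≤∣p∣+∣q∣ (a ℚ.- b) b)
    where
    regroup : ∀ a b → (a ℚ.- b) ℚ.+ b ≡ a
    regroup = solve 2 (λ a b → (a :- b) :+ b := a) refl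
      where open +-*-Solver

  ∣a∣-∣b∣≤∣a-b∣ : ∀ a b → ℚ.∣ a ∣ ℚ.- ℚ.∣ b ∣ ℚ.≤ ℚ.∣ a ℚ.- b ∣
  ∣a∣-∣b∣≤∣a-b∣ a b = subst (ℚ.∣ a ∣ ℚ.- ℚ.∣ b ∣ ℚ.≤_)
      (regroup ℚ.∣ a ℚ.- b ∣ ℚ.∣ b ∣) (ℚP.+-monoˡ-≤ (ℚ.- ℚ.∣ b ∣) (∣a∣≤∣a-b∣+∣b∣ a b))
    where
    regroup : ∀ a b → (a ℚ.+ b) ℚ.- b ≡ a
    regroup = solve 2 (λ a b → (a :+ b) :- b := a) refl
      where open +-*-Solver

  -[a-b]≡b-a : ∀ a b → ℚ.- (a ℚ.- b) ≡ b ℚ.- a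
  -[a-b]≡b-a = solve 2 (λ a b → :- (a :- b) := b :- a) refl
    where open +-*-Solver

  ∣a-b∣≡∣b-a∣ : ∀ a b → ℚ.∣ a ℚ.- b ∣ ≡ ℚ.∣ b ℚ.- a ∣
  ∣a-b∣≡∣b-a∣ a b = trans (sym (ℚP.∣-p∣≡∣p∣ (a ℚ.- b))) (cong ℚ.∣_∣ (-[a-b]≡b-a a b))

  ∣∣a∣-∣b∣∣≤∣a-b∣ : ∀ a b → ℚ.∣ ℚ.∣ a ∣ ℚ.- ℚ.∣ b ∣ ∣ ℚ.≤ ℚ.∣ a ℚ.- b ∣
  ∣∣a∣-∣b∣∣≤∣a-b∣ a b with ℚP.∣p∣≡p∨∣p∣≡-p (ℚ.∣ a ∣ ℚ.- ℚ.∣ b ∣)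
  ... | inj₁ e = ℚP.≤-trans (ℚP.≤-reflexive e) (∣a∣-∣b∣≤∣a-b∣ a b)
  ... | inj₂ e =
    ℚP.≤-trans (ℚP.≤-reflexive (trans e (-[a-b]≡b-a ℚ.∣ a ∣ ℚ.∣ b ∣)))
      (ℚP.≤-trans (∣a∣-∣b∣≤∣a-b∣ b a) (ℚP.≤-reflexive (∣a-b∣≡∣b-a∣ b a)))

  abs-cauchy : ∀ x → IsCauchy x → IsCauchy (λ n → ℚ.∣ x n ∣)
  abs-cauchy x cx ε 0<ε with cx ε 0<ε
  ... | N , p = N , λ m n a b → ℚP.≤-trans (∣∣a∣-∣b∣∣≤∣a-b∣ (x m) (x n)) (p m n a b)

  0<1 : 0ℚ ℚ.< 1ℚ
  0<1 = ℚP.positive⁻¹ 1ℚ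

  bounded : ∀ x → IsCauchy x →
            Σ[ K ∈ ℚ ] (0ℚ ℚ.< K × Eventually λ n → ℚ.∣ x n ∣ ℚ.≤ K)
  bounded x cx with cx 1ℚ 0<1
  ... | N , p = 1ℚ ℚ.+ ℚ.∣ x N ∣
      , ℚP.+-mono-<-≤ 0<1 (ℚP.0≤∣p∣ (x N))
      , N , λ n N≤n → ℚP.≤-trans (∣a∣≤∣a-b∣+∣b∣ (x n) (x N))
                        (ℚP.+-monoˡ-≤ ℚ.∣ x N ∣ (p n N N≤n ℕP.≤-refl))

  divide : ∀ {B ε} → 0ℚ ℚ.< B → 0ℚ ℚ.< ε → Σ[ δ ∈ ℚ ] (0ℚ ℚ.< δ × B ℚ.* δ ≡ ε)
  divide {B} {ε} 0<B 0<ε = B⁻¹ ℚ.* ε , 0<δ ,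
    trans (sym (ℚP.*-assoc B B⁻¹ ε))
      (trans (cong (ℚ._* ε) (ℚP.*-inverseʳ B {{B≢0}})) (ℚP.*-identityˡ ε))
    where
    B≢0 : ℚ.NonZero B
    B≢0 = ℚP.pos⇒nonZero B {{ℚ.positive 0<B}}
    B⁻¹ : ℚ
    B⁻¹ = (ℚ.1/ B) {{B≢0}}
    0<δ : 0ℚ ℚ.< B⁻¹ ℚ.* ε
    0<δ = subst (ℚ._< B⁻¹ ℚ.* ε) (ℚP.*-zeroʳ B⁻¹)
      (ℚP.*-monoʳ-<-pos B⁻¹ {{ℚP.1/pos⇒pos B {{ℚ.positive 0<B}}}} 0<ε)

  product-bound : ∀ a d {B δ ε} → 0ℚ ℚ.< B → B ℚ.* δ ≡ ε →
                  ℚ.∣ a ∣ ℚ.≤ B → ℚ.∣ d ∣ ℚ.≤ δ → ℚ.∣ a ℚ.* d ∣ ℚ.≤ ε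
  product-bound a d {B} 0<B Bδ≡ε a≤B d≤δ =
    ℚP.≤-trans (ℚP.≤-reflexive (ℚP.∣p*q∣≡∣p∣*∣q∣ a d))
      (ℚP.≤-trans (ℚP.*-monoʳ-≤-nonNeg ℚ.∣ d ∣ {{ℚ.nonNegative (ℚP.0≤∣p∣ d)}} a≤B)
        (ℚP.≤-trans (ℚP.*-monoˡ-≤-nonNeg B {{ℚ.nonNegative (ℚP.<⇒≤ 0<B)}} d≤δ)
          (ℚP.≤-reflexive Bδ≡ε)))

  product-difference : ∀ a b c d →
    a ℚ.* b ℚ.- c ℚ.* d ≡ a ℚ.* (b ℚ.- d) ℚ.+ d ℚ.* (a ℚ.- c)
  product-difference =
    solve 4 (λ a b c d → a :* b :- c :* d := a :* (b :- d) :+ d :* (a :- c)) refl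
    where open +-*-Solver

  product-close : ∀ {B C δ η ε} a b c d →
    0ℚ ℚ.< B → B ℚ.* δ ≡ ½ ℚ.* ε → 0ℚ ℚ.< C → C ℚ.* η ≡ ½ ℚ.* ε →
    ℚ.∣ a ∣ ℚ.≤ B → ℚ.∣ b ℚ.- d ∣ ℚ.≤ δ → ℚ.∣ d ∣ ℚ.≤ C → ℚ.∣ a ℚ.- c ∣ ℚ.≤ η →
    ℚ.∣ a ℚ.* b ℚ.- c ℚ.* d ∣ ℚ.≤ ε
  product-close {ε = ε} a b c d 0<B Bδ 0<C Cη a≤B b-d≤δ d≤C a-c≤η =
    ℚP.≤-trans (ℚP.≤-reflexive (cong ℚ.∣_∣ (product-difference a b c d)))
      (ℚP.≤-trans (ℚP.∣p+q∣≤∣p∣+∣q∣ (a ℚ.* (b ℚ.- d)) (d ℚ.* (a ℚ.- c)))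
        (ℚP.≤-trans
          (ℚP.+-mono-≤ {ℚ.∣ a ℚ.* (b ℚ.- d) ∣} {½ ℚ.* ε} {ℚ.∣ d ℚ.* (a ℚ.- c) ∣} {½ ℚ.* ε}
            (product-bound a (b ℚ.- d) 0<B Bδ a≤B b-d≤δ)
            (product-bound d (a ℚ.- c) 0<C Cη d≤C a-c≤η))
          (ℚP.≤-reflexive (½+½ ε))))

  common : ∀ N₁ N₂ N₃ N₄ → Σ[ N ∈ ℕ ] (∀ k → N ℕ.≤ k →
           N₁ ℕ.≤ k × N₂ ℕ.≤ k × N₃ ℕ.≤ k × N₄ ℕ.≤ k)
  common N₁ N₂ N₃ N₄ = (N₁ ℕ.⊔ N₂) ℕ.⊔ (N₃ ℕ.⊔ N₄) , λ k p →
    let p₁₂ = ℕP.m⊔n≤o⇒m≤o (N₁ ℕ.⊔ N₂) (N₃ ℕ.⊔ N₄) p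
        p₃₄ = ℕP.m⊔n≤o⇒n≤o (N₁ ℕ.⊔ N₂) (N₃ ℕ.⊔ N₄) p
    in ℕP.m⊔n≤o⇒m≤o N₁ N₂ p₁₂ , ℕP.m⊔n≤o⇒n≤o N₁ N₂ p₁₂ ,
       ℕP.m⊔n≤o⇒m≤o N₃ N₄ p₃₄ , ℕP.m⊔n≤o⇒n≤o N₃ N₄ p₃₄

  *-cauchy : ∀ x y → IsCauchy x → IsCauchy y → IsCauchy (λ n → x n ℚ.* y n)
  *-cauchy x y cx cy ε 0<ε = step₁ (bounded x cx) (bounded y cy)
    where
    Bound : (ℕ → ℚ) → ℚ → ℕ → Set
    Bound z B N = ∀ n → N ℕ.≤ n → ℚ.∣ z n ∣ ℚ.≤ B
    Close : (ℕ → ℚ) → ℚ → ℕ → Set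
    Close z δ N = ∀ m n → N ℕ.≤ m → N ℕ.≤ n → ℚ.∣ z m ℚ.- z n ∣ ℚ.≤ δ
    Goal : Set
    Goal = Σ[ N ∈ ℕ ] Close (λ n → x n ℚ.* y n) ε N

    step₃ : ∀ {B C δ η} → 0ℚ ℚ.< B → B ℚ.* δ ≡ ½ ℚ.* ε → 0ℚ ℚ.< C → C ℚ.* η ≡ ½ ℚ.* ε →
            ∃ (Bound x B) → ∃ (Bound y C) → ∃ (Close x η) → ∃ (Close y δ) → Goal
    step₃ 0<B Bδ 0<C Cη (N₁ , bx) (N₂ , by) (N₃ , px) (N₄ , py) =
      proj₁ N , λ m n p q →
        let m₁ , _  , m₃ , m₄ = proj₂ N m p
            _  , n₂ , n₃ , n₄ = proj₂ N n q
        in product-close (x m) (y m) (x n) (y n) 0<B Bδ 0<C Cη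
             (bx m m₁) (py m n m₄ n₄) (by n n₂) (px m n m₃ n₃)
      where N = common N₁ N₂ N₃ N₄

    step₂ : ∀ {B C} → 0ℚ ℚ.< B → 0ℚ ℚ.< C → ∃ (Bound x B) → ∃ (Bound y C) →
            Σ[ δ ∈ ℚ ] (0ℚ ℚ.< δ × B ℚ.* δ ≡ ½ ℚ.* ε) →
            Σ[ η ∈ ℚ ] (0ℚ ℚ.< η × C ℚ.* η ≡ ½ ℚ.* ε) → Goal
    step₂ 0<B 0<C bx by (δ , 0<δ , Bδ) (η , 0<η , Cη) =
      step₃ 0<B Bδ 0<C Cη bx by (cx η 0<η) (cy δ 0<δ)

    step₁ : Σ[ B ∈ ℚ ] (0ℚ ℚ.< B × ∃ (Bound x B)) →
            Σ[ C ∈ ℚ ] (0ℚ ℚ.< C × ∃ (Bound y C)) → Goal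
    step₁ (B , 0<B , bx) (C , 0<C , by) =
      step₂ 0<B 0<C bx by (divide 0<B (0<½ε 0<ε)) (divide 0<C (0<½ε 0<ε))

infixl 6 _+_ _-_
infixl 7 _*_

fromℚ : ℚ → ℝ
fromℚ q = mkℝ (λ _ → q) (const-cauchy q)

_+_ : ℝ → ℝ → ℝ
x + y = mkℝ (λ n → seq x n ℚ.+ seq y n) (+-cauchy (seq x) (seq y) (cauchy x) (cauchy y))

-_ : ℝ → ℝ
- x = mkℝ (λ n → ℚ.- seq x n) (neg-cauchy (seq x) (cauchy x))

_-_ : ℝ → ℝ → ℝ
x - y = x + (- y)

_*_ : ℝ → ℝ → ℝ
x * y = mkℝ (λ n → seq x n ℚ.* seq y n) (*-cauchy (seq x) (seq y) (cauchy x) (cauchy y))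

abs : ℝ → ℝ
abs x = mkℝ (λ n → ℚ.∣ seq x n ∣) (abs-cauchy (seq x) (cauchy x))

0ℝ 1ℝ : ℝ
0ℝ = fromℚ 0ℚ
1ℝ = fromℚ 1ℚ

fromℕ : ℕ → ℚ
fromℕ n = + n ℚ./ 1

-- q ≈ x ÷ y says that y is invertible and q is the quotient of x by y.
infix 4 _≈_÷_

_≈_÷_ : ℝ → ℝ → ℝ → Set
q ≈ x ÷ y = y # 0ℝ × q * y ≈ x

infix 4 _=O_

_=O_ : (ℕ → ℝ) → (ℕ → ℝ) → Set
f =O g = Σ[ c ∈ ℝ ] Eventually λ n → abs (f n) ≤ c * abs (g n)

infixr 8 _^ᶻ_

-- Integer powers of a natural number; the value 0 at negative powers of
-- zero is a convention that asymptotic statements never see.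
_^ᶻ_ : ℕ → ℤ → ℚ
n     ^ᶻ (+ m)    = fromℕ (n ℕ.^ m)
zero  ^ᶻ -[1+ m ] = 0ℚ
suc n ^ᶻ -[1+ m ] = (+ 1 ℚ./ (suc n ℕ.^ suc m)) {{ℕP.m^n≢0 (suc n) (suc m)}}

record Graph : Set₁ where
  field
    Vertex      : Set
    order       : ℕ
    enumeration : Fin order ↔ Vertex
    Adj         : Vertex → Vertex → Set
    Adj-sym     : ∀ {u v} → Adj u v → Adj v u
    Adj-irrefl  : ∀ {v} → ¬ Adj v v

ℝ-+-rawMonoid : RawMonoid 0ℓ 0ℓ
ℝ-+-rawMonoid = record { Carrier = ℝ ; _≈_ = _≈_ ; _∙_ = _+_ ; ε = 0ℝ }

module _ (G : Graph) where
  open Graph G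

  ∑ᵥ : (Vertex → ℝ) → ℝ
  ∑ᵥ f = RawMonoidDefs.sum ℝ-+-rawMonoid (λ i → f (Inverse.to enumeration i))

  Matrix : Set
  Matrix = Vertex → Vertex → ℝ

  trace : Matrix → ℝ
  trace B = ∑ᵥ λ u → B u u

  entrySum : Matrix → ℝ
  entrySum B = ∑ᵥ λ u → ∑ᵥ λ v → B u v

  PositiveSemidefinite : Matrix → Set
  PositiveSemidefinite B =
    (∀ u v → B u v ≈ B v u) ×
    (∀ (x : Vertex → ℝ) → 0ℝ ≤ ∑ᵥ λ u → ∑ᵥ λ v → x u * B u v * x v)

  Feasible : Matrix → Set
  Feasible B =
    PositiveSemidefinite B ×
    trace B ≈ 1ℝ ×
    (∀ u v → Adj u v → B u v ≈ 0ℝ)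

  -- t is the maximum (attained) of the entry sum over feasible matrices;
  -- this determines t up to _≈_.
  IsLovászNumber : ℝ → Set
  IsLovászNumber t =
    (Σ[ B ∈ Matrix ] (Feasible B × entrySum B ≈ t)) ×
    (∀ B → Feasible B → entrySum B ≤ t)

KSubset : ℕ → ℕ → Set
KSubset n k = Σ[ A ∈ Subset n ] ∣ A ∣ ≡ k

#KSubset : ℕ → ℕ → ℕ
#KSubset zero    zero    = 1
#KSubset zero    (suc k) = 0
#KSubset (suc n) zero    = #KSubset n zero
#KSubset (suc n) (suc k) = #KSubset n (suc k) ℕ.+ #KSubset n k

KSubset-enumeration : ∀ n k → Fin (#KSubset n k) ↔ KSubset n k
KSubset-enumeration zero zero = mk↔ₛ′ (λ _ → [] , refl) (λ _ → Fin.zero)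
  (λ { ([] , refl) → refl }) (λ { Fin.zero → refl ; (Fin.suc ()) })
KSubset-enumeration zero (suc k) = mk↔ₛ′ (λ ()) (λ { ([] , ()) }) (λ { ([] , ()) }) (λ ())
KSubset-enumeration (suc n) zero = mk↔ₛ′
  (λ { (A , p) → outside ∷ A , p })
  (λ { (outside ∷ A , p) → A , p ; (inside ∷ A , ()) })
  (λ { (outside ∷ A , p) → refl ; (inside ∷ A , ()) })
  (λ { (A , p) → refl })
  ↔-∘ KSubset-enumeration n zero
KSubset-enumeration (suc n) (suc k) = mk↔ₛ′
  [ (λ { (A , p) → outside ∷ A , p }) , (λ { (A , p) → inside ∷ A , cong suc p }) ]′
  (λ { (outside ∷ A , p) → inj₁ (A , p) ; (inside ∷ A , p) → inj₂ (A , ℕP.suc-injective p) })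
  (λ { (outside ∷ A , p) → refl
     ; (inside ∷ A , p) → cong (inside ∷ A ,_) (ℕP.≡-irrelevant _ p) })
  (λ { (inj₁ (A , p)) → refl
     ; (inj₂ (A , p)) → cong (λ q → inj₂ (A , q)) (ℕP.≡-irrelevant _ p) })
  ↔-∘ ((KSubset-enumeration n (suc k) ⊎-↔ KSubset-enumeration n k) ↔-∘ +↔⊎)

-- L ⊂ [0,k-1] is a subset of Fin k.
_∈ᴸ_ : ∀ {k} → ℕ → Subset k → Set
_∈ᴸ_ {k} m L = Σ[ i ∈ Fin k ] (i Subset.∈ L × toℕ i ≡ m)

-- The condition A ≠ B is needed because ∣A ∩ A∣ = k never lies in L, so
-- that the intersection condition alone would put a loop at every vertex.
GeneralizedJohnson : (n k : ℕ) → Subset k → Graph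
GeneralizedJohnson n k L = record
  { Vertex      = KSubset n k
  ; order       = #KSubset n k
  ; enumeration = KSubset-enumeration n k
  ; Adj         = λ A B → proj₁ A ≢ proj₁ B × ¬ (∣ proj₁ A ∩ proj₁ B ∣ ∈ᴸ L)
  ; Adj-sym     = λ { {A , _} {B , _} (A≢B , ∉L) →
                    (λ e → A≢B (sym e)) ,
                    (λ ∈L → ∉L (subst (λ S → ∣ S ∣ ∈ᴸ L) (∩-comm B A) ∈L)) }
  ; Adj-irrefl  = λ { (A≢A , _) → A≢A refl }
  }

formulaNumerator : (n k ℓ : ℕ) → ℕ
formulaNumerator n k ℓ = (k C (k ℕ.∸ ℓ)) ℕ.* ((n ℕ.∸ k) C (k ℕ.∸ ℓ))

formulaDenominator : (n k ℓ : ℕ) → ℤ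
formulaDenominator n k ℓ =
  RawMonoidDefs.sum ℤ.+-0-rawMonoid {suc (k ℕ.∸ ℓ)} λ i → let j = toℕ i in
    (ℤ.-1ℤ ℤ.^ suc j) ℤ.*
    + ((suc ℓ C j)
       ℕ.* ((k ℕ.∸ ℓ ℕ.∸ 1) C (k ℕ.∸ ℓ ℕ.∸ j))
       ℕ.* ((n ℕ.∸ k ℕ.∸ ℓ ℕ.∸ 1) C (k ℕ.∸ ℓ ℕ.∸ j)))

nCk≢0 : ∀ {n k} → k ℕ.≤ n → ℕ.NonZero (n C k)
nCk≢0 {n} {k} k≤n = subst ℕ.NonZero (sym (nCk≡n!/k![n-k]! k≤n))
  (ℕ.>-nonZero (m≥n⇒m/n>0 (∣⇒≤ (k![n∸k]!∣n! k≤n))))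
  where instance
    _ = k ℕP.!* (n ℕ.∸ k) !≢0
    _ = n ℕP.!≢0

leadingCoefficient : (k ℓ : ℕ) → ℓ ℕ.< k → ℚ
leadingCoefficient k ℓ ℓ<k = + (k C (k ℕ.∸ ℓ)) ℚ./ ((k ℕ.∸ ℓ) ℕ.* suc ℓ)
  where instance
    k∸ℓ≢0 = ℕ.>-nonZero (ℕP.m<n⇒0<n∸m ℓ<k)
    prod≢0 = ℕP.m*n≢0 (k ℕ.∸ ℓ) (suc ℓ)

leadingCoefficient′ : (k ℓ : ℕ) → ℚ
leadingCoefficient′ k ℓ = + (suc ℓ ℕ.* (k ℕ.∸ ℓ)) ℚ./ (k ! ℕ.* (k C (k ℕ.∸ ℓ)))
  where instance
    k!≢0 = k ℕP.!≢0
    C≢0 = nCk≢0 (ℕP.m∸n≤m k ℓ)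
    prod≢0 = ℕP.m*n≢0 (k !) (k C (k ℕ.∸ ℓ))

{-# OPTIONS --safe #-}

-- A symmetric matrix whose (A , B) entry depends on ∣ A ∩ B ∣ only is a
-- combination of the primitive idempotents E 0 , … , E k of the Johnson
-- scheme.  They are obtained by triangular elimination from the functions
-- m ↦ m C s, on which the swap operator T acts bidiagonally with distinct
-- eigenvalues; hence they are orthogonal, they sum to the identity, and each
-- is the Gram matrix of itself.  If λ j are the eigenvalues of the matrix
-- M indicating ∣ A ∩ B ∣ = ℓ, then for large n the least one is λ (ℓ+1), so
-- that I − M / λ (ℓ+1) is positive semidefinite with row sum
-- 1 − λ 0 / λ (ℓ+1), while a multiple of E (ℓ+1) is the matching dual
-- certificate.  For the complementary graph the two certificates exchange
-- their roles.

module Submission where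

open import Defs using
  ( ℝ; seq; fromℚ; fromℕ; Eventually; Graph; PositiveSemidefinite; Feasible; ∑ᵥ; entrySum; trace
  ; KSubset; #KSubset; KSubset-enumeration; GeneralizedJohnson; IsLovászNumber; _∈ᴸ_
  ; formulaNumerator; formulaDenominator; leadingCoefficient; leadingCoefficient′; nCk≢0; _^ᶻ_)
import Algebra.Definitions.RawMonoid as RawMonoidDefs
open import Algebra.Bundles using (CommutativeRing)
open import Data.Empty using (⊥-elim)
open import Data.Fin.Base as Fin using (Fin; toℕ; fromℕ<; splitAt)
import Data.Fin.Properties as FinP
open import Data.Fin.Properties using (toℕ<n; toℕ-fromℕ<; toℕ-injective)
open import Data.Fin.Subset.Properties using
    (∩-comm; ∩-idem; ∣∁p∣≡n∸∣p∣; ∣p∩q∣≤∣p∣; _∈?_; x∈⁅x⁆; x∈⁅y⁆⇒x≡y; x∈∁p⇒x∉p; x∉p⇒x∈∁p)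
open import Data.Integer.Base as ℤ using (ℤ; -[1+_])
import Data.Integer.Properties as ℤP
open import Data.Maybe.Base using (Maybe; just; nothing)
open import Data.Nat.Base as ℕ using (ℕ; zero; suc; z≤n; s≤s; _∸_)
import Data.Nat.Coprimality as Coprime
import Data.Nat.Properties as ℕP
open import Data.Product.Base using (Σ-syntax; _×_; _,_; proj₁; proj₂)
open import Data.Rational.Base as ℚ using (ℚ; 0ℚ; 1ℚ)
import Data.Rational.Properties as ℚP
import Data.Rational.Unnormalised.Base as ℚᵘ
import Data.Rational.Unnormalised.Properties as ℚᵘP
open import Data.Sum.Base as Sum using (_⊎_; inj₁; inj₂)
open import Data.Vec.Base using ([]; _∷_)
open import Function.Base using (_∘_)
open import Function.Bundles using (Inverse)
open import Level using (0ℓ)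
open import Relation.Binary.Definitions using (tri<; tri≈; tri>)
open import Relation.Binary.PropositionalEquality
open import Relation.Nullary using (Dec; yes; no; ¬_)
open import Relation.Nullary.Decidable using (_×-dec_)
open import Tactic.RingSolver using (solve-∀)
open import Tactic.RingSolver.Core.AlmostCommutativeRing using (AlmostCommutativeRing; fromCommutativeRing)

-- The overview names the least eigenvalue; its position comes from growth rates. In the sum
-- defining `spectrum n k ℓ j` the term of index `s` has order at most n^(k - s) and vanishes for
-- `s < ℓ` and for `s < j`. So for `j ≤ ℓ` the eigenvalue is positive of order n^(k - ℓ), for
-- `j = ℓ + 1` it is negative of order n^(k - ℓ - 1), and for larger `j` its order is smaller still.
-- Multiplicities and Hahn polynomials never appear. That the dual certificate is tight follows from
-- comparing the diagonal of `E j` with its entry at `ℓ`, through a matrix product evaluated in two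
-- ways. The certificate divides by the diagonal entry of `E (suc ℓ)`; idempotence makes that entry
-- nonnegative only, and strict positivity needs a separate growth argument. Both certificates are
-- rational, but the competing feasible matrices are real. They enter through rational
-- approximations whose quadratic forms are nonnegative only up to a vanishing error, so weak
-- duality is an exact identity with error terms that tend to 0.

-- Rational arithmetic, Kronecker deltas and finite sums.

module Rational where
  open import Algebra.Properties.Semiring.Sum (CommutativeRing.semiring ℚP.+-*-commutativeRing) public
    using (sum; sum-cong-≗; ∑-distrib-+; ∑-comm; *-distribˡ-sum; *-distribʳ-sum; sum-replicate-zero)
  open import Data.Rational.Base using (mkℚ; _+_; _*_; _-_; -_; _≤_; _<_; 1/_)

  ℚ-ring : AlmostCommutativeRing 0ℓ 0ℓ
  ℚ-ring = fromCommutativeRing ℚP.+-*-commutativeRing isZero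
    where
    isZero : ∀ p → Maybe (0ℚ ≡ p)
    isZero p with p ℚP.≟ 0ℚ
    ... | yes e = just (sym e)
    ... | no _ = nothing

  i/1≡mkℚ : ∀ i → i ℚ./ 1 ≡ mkℚ i 0 (Coprime.sym (Coprime.1-coprimeTo ℤ.∣ i ∣))
  i/1≡mkℚ (ℤ.+ n) = ℚP.normalize-coprime (Coprime.sym (Coprime.1-coprimeTo n))
  i/1≡mkℚ -[1+ n ] = cong (-_) (ℚP.normalize-coprime (Coprime.sym (Coprime.1-coprimeTo (suc n))))

  /1-homo-+ : ∀ i j → (i ℤ.+ j) ℚ./ 1 ≡ i ℚ./ 1 + j ℚ./ 1
  /1-homo-+ i j rewrite i/1≡mkℚ i | i/1≡mkℚ j =
    cong (ℚ._/ 1) (sym (cong₂ ℤ._+_ (ℤP.*-identityʳ i) (ℤP.*-identityʳ j)))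

  /1-homo-* : ∀ i j → (i ℤ.* j) ℚ./ 1 ≡ (i ℚ./ 1) * (j ℚ./ 1)
  /1-homo-* i j rewrite i/1≡mkℚ i | i/1≡mkℚ j = refl

  fromℕ-+ : ∀ m n → fromℕ (m ℕ.+ n) ≡ fromℕ m + fromℕ n
  fromℕ-+ m n = /1-homo-+ (ℤ.+ m) (ℤ.+ n)

  fromℕ-* : ∀ m n → fromℕ (m ℕ.* n) ≡ fromℕ m * fromℕ n
  fromℕ-* m n = trans (cong (ℚ._/ 1) (ℤP.pos-* m n)) (/1-homo-* (ℤ.+ m) (ℤ.+ n))

  fromℕ-suc : ∀ n → fromℕ (suc n) ≡ 1ℚ + fromℕ n
  fromℕ-suc = fromℕ-+ 1

  fromℕ-∸ : ∀ {m n} → n ℕ.≤ m → fromℕ (m ℕ.∸ n) ≡ fromℕ m - fromℕ n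
  fromℕ-∸ {m} {n} n≤m = trans (add-sub (fromℕ (m ℕ.∸ n)) (fromℕ n))
    (cong (_- fromℕ n) (trans (sym (fromℕ-+ (m ℕ.∸ n) n)) (cong fromℕ (ℕP.m∸n+n≡m n≤m))))
    where
    add-sub : ∀ a b → a ≡ a + b - b
    add-sub = solve-∀ ℚ-ring

  fromℕ-nonNeg : ∀ n → 0ℚ ≤ fromℕ n
  fromℕ-nonNeg n = ℚP.nonNegative⁻¹ (fromℕ n) {{ℚP.normalize-nonNeg n 1}}

  fromℕ-mono : ∀ {m n} → m ℕ.≤ n → fromℕ m ≤ fromℕ n
  fromℕ-mono {m} {n} m≤n rewrite sym (ℕP.m∸n+n≡m m≤n) | fromℕ-+ (n ℕ.∸ m) m =
    ℚP.≤-trans (ℚP.≤-reflexive (sym (ℚP.+-identityˡ _))) (ℚP.+-monoˡ-≤ (fromℕ m) (fromℕ-nonNeg (n ℕ.∸ m)))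

  0<1 : 0ℚ < 1ℚ
  0<1 = ℚP.positive⁻¹ 1ℚ

  fromℕ-pos : ∀ {n} → 0 ℕ.< n → 0ℚ < fromℕ n
  fromℕ-pos 0<n = ℚP.<-≤-trans 0<1 (fromℕ-mono 0<n)

  pos⇒≢0 : ∀ {q} → 0ℚ < q → q ≢ 0ℚ
  pos⇒≢0 0<q q≡0 = ℚP.<⇒≢ 0<q (sym q≡0)

  fromℕ≢0 : ∀ {n} → 0 ℕ.< n → fromℕ n ≢ 0ℚ
  fromℕ≢0 0<n = pos⇒≢0 (fromℕ-pos 0<n)

  *-nonNeg : ∀ {p q} → 0ℚ ≤ p → 0ℚ ≤ q → 0ℚ ≤ p * q
  *-nonNeg {p} {q} 0≤p 0≤q = subst (_≤ p * q) (ℚP.*-zeroʳ p)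
      (ℚP.*-monoˡ-≤-nonNeg p {{ℚ.nonNegative 0≤p}} 0≤q)

  *-pos : ∀ {p q} → 0ℚ < p → 0ℚ < q → 0ℚ < p * q
  *-pos {p} {q} 0<p 0<q = subst (_< p * q) (ℚP.*-zeroʳ p) (ℚP.*-monoʳ-<-pos p {{ℚ.positive 0<p}} 0<q)

  +-nonNeg : ∀ {p q} → 0ℚ ≤ p → 0ℚ ≤ q → 0ℚ ≤ p + q
  +-nonNeg = ℚP.+-mono-≤

  square-nonNeg : ∀ q → 0ℚ ≤ q * q
  square-nonNeg q with ℚP.≤-total 0ℚ q
  ... | inj₁ 0≤q = *-nonNeg 0≤q 0≤q
  ... | inj₂ q≤0 = subst (0ℚ ≤_) (lemma q) (*-nonNeg (ℚP.neg-antimono-≤ q≤0) (ℚP.neg-antimono-≤ q≤0))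
    where
    lemma : ∀ q → - q * - q ≡ q * q
    lemma = solve-∀ ℚ-ring

  opaque
    -- Total, with value 0 at 0, so that quotients can be written down before their denominators are
    -- known to be nonzero.
    inv : ℚ → ℚ
    inv q with q ℚP.≟ 0ℚ
    ... | yes _  = 0ℚ
    ... | no q≢0 = (1/ q) {{ℚ.≢-nonZero q≢0}}

    *-inv : ∀ {q} → q ≢ 0ℚ → q * inv q ≡ 1ℚ
    *-inv {q} q≢0 with q ℚP.≟ 0ℚ
    ... | yes q≡0 = ⊥-elim (q≢0 q≡0)
    ... | no q≢0′ = ℚP.*-inverseʳ q {{ℚ.≢-nonZero q≢0′}}

    inv-pos : ∀ {q} → 0ℚ < q → 0ℚ < inv q
    inv-pos {q} 0<q with q ℚP.≟ 0ℚ
    ... | yes q≡0 = ⊥-elim (pos⇒≢0 0<q q≡0)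
    ... | no q≢0 = ℚP.positive⁻¹ _ {{ℚP.1/pos⇒pos q {{ℚ.positive 0<q}}}}

    inv-zero : inv 0ℚ ≡ 0ℚ
    inv-zero = refl

  inv-*-cancel : ∀ {q} p → q ≢ 0ℚ → q * (inv q * p) ≡ p
  inv-*-cancel {q} p q≢0 = trans (sym (ℚP.*-assoc q (inv q) p))
    (trans (cong (_* p) (*-inv q≢0)) (ℚP.*-identityˡ p))

  *-cancelˡ : ∀ q {a b} → q ≢ 0ℚ → q * a ≡ q * b → a ≡ b
  *-cancelˡ q {a} {b} q≢0 e = trans (sym (cancel a)) (trans (cong (inv q *_) e) (cancel b))
    where
    cancel : ∀ c → inv q * (q * c) ≡ c
    cancel c = trans (sym (ℚP.*-assoc (inv q) q c))
      (trans (cong (_* c) (trans (ℚP.*-comm (inv q) q) (*-inv q≢0))) (ℚP.*-identityˡ c))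

  *-monoˡ : ∀ {r p q} → 0ℚ ≤ r → p ≤ q → r * p ≤ r * q
  *-monoˡ {r} 0≤r = ℚP.*-monoˡ-≤-nonNeg r {{ℚ.nonNegative 0≤r}}

  *-monoʳ : ∀ {r p q} → 0ℚ ≤ r → p ≤ q → p * r ≤ q * r
  *-monoʳ {r} 0≤r = ℚP.*-monoʳ-≤-nonNeg r {{ℚ.nonNegative 0≤r}}

  ≤⇒0≤- : ∀ {p q} → p ≤ q → 0ℚ ≤ q - p
  ≤⇒0≤- {p} {q} p≤q = subst (_≤ q - p) (ℚP.+-inverseʳ p) (ℚP.+-monoˡ-≤ (- p) p≤q)

  0≤-⇒≤ : ∀ {p q} → 0ℚ ≤ q - p → p ≤ q
  0≤-⇒≤ {p} {q} h = subst₂ _≤_ (ℚP.+-identityˡ p) (sub-add q p) (ℚP.+-monoˡ-≤ p h)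
    where
    sub-add : ∀ q p → q - p + p ≡ q
    sub-add = solve-∀ ℚ-ring

  -- The Kronecker delta, defined by recursion so that equal successors cancel by computation; the
  -- inductions over the coordinates of a subset rely on this.
  𝟙 : ℕ → ℕ → ℚ
  𝟙 zero    zero    = 1ℚ
  𝟙 zero    (suc _) = 0ℚ
  𝟙 (suc _) zero    = 0ℚ
  𝟙 (suc m) (suc n) = 𝟙 m n

  𝟙-refl : ∀ n → 𝟙 n n ≡ 1ℚ
  𝟙-refl zero    = refl
  𝟙-refl (suc n) = 𝟙-refl n

  𝟙-≢ : ∀ {m n} → m ≢ n → 𝟙 m n ≡ 0ℚ
  𝟙-≢ {zero}  {zero}  m≢n = ⊥-elim (m≢n refl)
  𝟙-≢ {zero}  {suc n} m≢n = refl
  𝟙-≢ {suc m} {zero}  m≢n = refl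
  𝟙-≢ {suc m} {suc n} m≢n = 𝟙-≢ (m≢n ∘ cong suc)

  𝟙-nonNeg : ∀ m n → 0ℚ ≤ 𝟙 m n
  𝟙-nonNeg zero    zero    = ℚP.<⇒≤ 0<1
  𝟙-nonNeg zero    (suc n) = ℚP.≤-refl
  𝟙-nonNeg (suc m) zero    = ℚP.≤-refl
  𝟙-nonNeg (suc m) (suc n) = 𝟙-nonNeg m n

  𝟙-subst : ∀ m n (f : ℕ → ℚ) → 𝟙 m n * f m ≡ 𝟙 m n * f n
  𝟙-subst zero    zero    f = refl
  𝟙-subst zero    (suc n) f = trans (ℚP.*-zeroˡ (f 0)) (sym (ℚP.*-zeroˡ (f (suc n))))
  𝟙-subst (suc m) zero    f = trans (ℚP.*-zeroˡ (f (suc m))) (sym (ℚP.*-zeroˡ (f 0)))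
  𝟙-subst (suc m) (suc n) f = 𝟙-subst m n (f ∘ suc)

  𝟙-cancelˡ : ∀ m a b → 𝟙 (m ℕ.+ a) (m ℕ.+ b) ≡ 𝟙 a b
  𝟙-cancelˡ zero    a b = refl
  𝟙-cancelˡ (suc m) a b = 𝟙-cancelˡ m a b

  sum-zero : ∀ {n} (f : Fin n → ℚ) → (∀ i → f i ≡ 0ℚ) → sum f ≡ 0ℚ
  sum-zero {n} f e = trans (sum-cong-≗ e) (sum-replicate-zero n)

  sum-nonNeg : ∀ {n} (f : Fin n → ℚ) → (∀ i → 0ℚ ≤ f i) → 0ℚ ≤ sum f
  sum-nonNeg {zero}  f h = ℚP.≤-refl
  sum-nonNeg {suc n} f h = +-nonNeg (h Fin.zero) (sum-nonNeg (f ∘ Fin.suc) (h ∘ Fin.suc))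

  ∑< : ℕ → (ℕ → ℚ) → ℚ
  ∑< n f = sum {n} (f ∘ toℕ)

  syntax ∑< n (λ i → e) = ∑[ i < n ] e

  ∑<-cong : ∀ n {f g} → (∀ i → i ℕ.< n → f i ≡ g i) → ∑< n f ≡ ∑< n g
  ∑<-cong n e = sum-cong-≗ {n} (λ i → e (toℕ i) (toℕ<n i))

  ∑<-zero : ∀ n {f} → (∀ i → i ℕ.< n → f i ≡ 0ℚ) → ∑< n f ≡ 0ℚ
  ∑<-zero n {f} e = sum-zero {n} (f ∘ toℕ) (λ i → e (toℕ i) (toℕ<n i))

  ∑<-distribˡ : ∀ n c f → c * ∑< n f ≡ ∑[ i < n ] (c * f i)
  ∑<-distribˡ n c f = *-distribˡ-sum {n} c (f ∘ toℕ)

  ∑<-distribʳ : ∀ n f c → ∑< n f * c ≡ ∑[ i < n ] (f i * c)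
  ∑<-distribʳ n f c = *-distribʳ-sum {n} c (f ∘ toℕ)

  ∑<-+ : ∀ n f g → ∑[ i < n ] (f i + g i) ≡ ∑< n f + ∑< n g
  ∑<-+ n f g = ∑-distrib-+ {n} (f ∘ toℕ) (g ∘ toℕ)

  ∑<-snoc : ∀ n f → ∑< (suc n) f ≡ ∑< n f + f n
  ∑<-snoc zero    f = ℚP.+-comm (f 0) 0ℚ
  ∑<-snoc (suc n) f = trans (cong (f 0 +_) (∑<-snoc n (f ∘ suc))) (sym (ℚP.+-assoc (f 0) _ _))

  ∑<-split : ∀ m n f → ∑< (m ℕ.+ n) f ≡ ∑< m f + ∑[ i < n ] f (m ℕ.+ i)
  ∑<-split zero    n f = sym (ℚP.+-identityˡ _)
  ∑<-split (suc m) n f = trans (cong (f 0 +_) (∑<-split m n (f ∘ suc))) (sym (ℚP.+-assoc (f 0) _ _))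

  ∑<-nonNeg : ∀ n {f} → (∀ i → i ℕ.< n → 0ℚ ≤ f i) → 0ℚ ≤ ∑< n f
  ∑<-nonNeg n {f} h = sum-nonNeg {n} (f ∘ toℕ) (λ i → h (toℕ i) (toℕ<n i))

  ∑<-mono : ∀ n {f g} → (∀ i → i ℕ.< n → f i ≤ g i) → ∑< n f ≤ ∑< n g
  ∑<-mono zero    h = ℚP.≤-refl
  ∑<-mono (suc n) h = ℚP.+-mono-≤ (h 0 (s≤s z≤n)) (∑<-mono n (λ i i<n → h (suc i) (s≤s i<n)))

  ∑<-𝟙 : ∀ n {ℓ} (f : ℕ → ℚ) → ℓ ℕ.< n → ∑[ i < n ] (𝟙 i ℓ * f i) ≡ f ℓ
  ∑<-𝟙 (suc n) {zero}  f _ = trans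
    (cong₂ _+_ (ℚP.*-identityˡ (f 0)) (∑<-zero n (λ i _ → ℚP.*-zeroˡ (f (suc i)))))
    (ℚP.+-identityʳ (f 0))
  ∑<-𝟙 (suc n) {suc ℓ} f (s≤s ℓ<n) = trans
    (cong₂ _+_ (ℚP.*-zeroˡ (f 0)) (∑<-𝟙 n (f ∘ suc) ℓ<n)) (ℚP.+-identityˡ (f (suc ℓ)))

-- Binomial coefficients with rational values.

module Binomial where
  open Rational
  open import Data.Rational.Base using (_+_; _*_; _-_; -_; _≤_; _<_)
  open import Data.Nat.Combinatorics
    using (_C_; nCk+nC[k+1]≡[n+1]C[k+1]; nCk≡nC[n∸k]; nCn≡1; k>n⇒nCk≡0)

  opaque
    binom : ℕ → ℕ → ℚ
    binom n k = fromℕ (n C k)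

    binom≡fromℕ : ∀ n k → binom n k ≡ fromℕ (n C k)
    binom≡fromℕ n k = refl

    binom-pascal : ∀ n k → binom (suc n) (suc k) ≡ binom n k + binom n (suc k)
    binom-pascal n k = trans (cong fromℕ (sym (nCk+nC[k+1]≡[n+1]C[k+1] n k))) (fromℕ-+ (n C k) (n C suc k))

    binom-zero : ∀ n → binom n 0 ≡ 1ℚ
    binom-zero n = cong fromℕ {n C 0} {1} (trans (nCk≡nC[n∸k] {0} {n} z≤n) (nCn≡1 n))

    binom-self : ∀ n → binom n n ≡ 1ℚ
    binom-self n = cong fromℕ {n C n} {1} (nCn≡1 n)

    binom-> : ∀ {n k} → n ℕ.< k → binom n k ≡ 0ℚ
    binom-> {n} {k} n<k = cong fromℕ {n C k} {0} (k>n⇒nCk≡0 n<k)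

    binom-sym : ∀ m n → binom (m ℕ.+ n) m ≡ binom (m ℕ.+ n) n
    binom-sym m n = cong fromℕ (trans (nCk≡nC[n∸k] (ℕP.m≤m+n m n)) (cong ((m ℕ.+ n) C_) (ℕP.m+n∸m≡n m n)))

    binom-sym-∸ : ∀ {n k} → k ℕ.≤ n → binom n k ≡ binom n (n ∸ k)
    binom-sym-∸ k≤n = cong fromℕ (nCk≡nC[n∸k] k≤n)

    binom-nonNeg : ∀ n k → 0ℚ ≤ binom n k
    binom-nonNeg n k = fromℕ-nonNeg (n C k)

  binom-pos : ∀ m n → 0ℚ < binom (m ℕ.+ n) m
  binom-pos zero    n = subst (0ℚ <_) (sym (binom-zero n)) 0<1
  binom-pos (suc m) n = subst (0ℚ <_) (sym (binom-pascal (m ℕ.+ n) m))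
    (ℚP.+-mono-<-≤ (binom-pos m n) (binom-nonNeg (m ℕ.+ n) (suc m)))

  binom-pos′ : ∀ {n k} → k ℕ.≤ n → 0ℚ < binom n k
  binom-pos′ {n} {k} k≤n = subst (λ m → 0ℚ < binom m k) (ℕP.m+[n∸m]≡n k≤n) (binom-pos k (n ∸ k))

  binom-absorb : ∀ n k → fromℕ (suc k) * binom (suc n) (suc k) ≡ fromℕ (suc n) * binom n k
  binom-absorb zero zero = trans (cong (1ℚ *_) (binom-self 1)) (sym (cong (1ℚ *_) (binom-self 0)))
  binom-absorb zero (suc k) = trans (cong (fromℕ (suc (suc k)) *_) (binom-> (s≤s (s≤s z≤n))))
    (trans (ℚP.*-zeroʳ (fromℕ (suc (suc k))))
        (sym (trans (cong (1ℚ *_) (binom-> {0} {suc k} (s≤s z≤n))) (ℚP.*-zeroʳ 1ℚ))))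
  binom-absorb (suc n) zero = begin
    1ℚ * binom (suc (suc n)) 1             ≡⟨ cong (1ℚ *_) (binom-pascal (suc n) 0) ⟩
    1ℚ * (b + binom (suc n) 1)             ≡⟨ ℚP.*-distribˡ-+ 1ℚ b (binom (suc n) 1) ⟩
    1ℚ * b + 1ℚ * binom (suc n) 1          ≡⟨ cong (1ℚ * b +_) (binom-absorb n 0) ⟩
    1ℚ * b + fromℕ (suc n) * binom n 0
      ≡⟨ cong (λ c → 1ℚ * b + fromℕ (suc n) * c) (trans (binom-zero n) (sym (binom-zero (suc n)))) ⟩
    1ℚ * b + fromℕ (suc n) * b             ≡⟨ sym (ℚP.*-distribʳ-+ b 1ℚ (fromℕ (suc n))) ⟩
    (1ℚ + fromℕ (suc n)) * b               ≡⟨ cong (_* b) (sym (fromℕ-suc (suc n))) ⟩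
    fromℕ (suc (suc n)) * b                ∎
    where
    open ≡-Reasoning
    b = binom (suc n) 0
  binom-absorb (suc n) (suc k) = begin
    fromℕ (suc (suc k)) * binom (suc (suc n)) (suc (suc k))
      ≡⟨ cong₂ _*_ (fromℕ-suc (suc k)) (binom-pascal (suc n) (suc k)) ⟩
    (1ℚ + s) * (b + c)
      ≡⟨ expand s b c ⟩
    b + s * b + (1ℚ + s) * c
      ≡⟨ cong₂ (λ x y → b + x + y) (binom-absorb n k)
           (trans (cong (_* c) (sym (fromℕ-suc (suc k)))) (binom-absorb n (suc k))) ⟩
    b + m * d + m * e
      ≡⟨ collect b m d e ⟩
    b + m * (d + e)
      ≡⟨ cong (λ x → b + m * x) (sym (binom-pascal n k)) ⟩
    b + m * b
      ≡⟨ trans (collect₁ b m) (cong (_* b) (sym (fromℕ-suc (suc n)))) ⟩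
    fromℕ (suc (suc n)) * b ∎
    where
    open ≡-Reasoning
    s = fromℕ (suc k)
    m = fromℕ (suc n)
    b = binom (suc n) (suc k)
    c = binom (suc n) (suc (suc k))
    d = binom n k
    e = binom n (suc k)
    expand : ∀ s b c → (1ℚ + s) * (b + c) ≡ b + s * b + (1ℚ + s) * c
    expand = solve-∀ ℚ-ring
    collect : ∀ b m d e → b + m * d + m * e ≡ b + m * (d + e)
    collect = solve-∀ ℚ-ring
    collect₁ : ∀ b m → b + m * b ≡ (1ℚ + m) * b
    collect₁ = solve-∀ ℚ-ring

  -- The difference is taken in `ℚ`: for `k > n` it is negative, but it multiplies `binom n k ≡ 0ℚ`.
  binom-next : ∀ n k → fromℕ (suc k) * binom n (suc k) ≡ (fromℕ n - fromℕ k) * binom n k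
  binom-next n k = begin
    fromℕ (suc k) * c                                ≡⟨ insert (fromℕ (suc k)) b c ⟩
    fromℕ (suc k) * (b + c) - fromℕ (suc k) * b
      ≡⟨ cong (_- fromℕ (suc k) * b) (trans (cong (fromℕ (suc k) *_) (sym (binom-pascal n k)))
          (binom-absorb n k)) ⟩
    fromℕ (suc n) * b - fromℕ (suc k) * b
      ≡⟨ cong₂ (λ x y → x * b - y * b) (fromℕ-suc n) (fromℕ-suc k) ⟩
    (1ℚ + fromℕ n) * b - (1ℚ + fromℕ k) * b          ≡⟨ cancel (fromℕ n) (fromℕ k) b ⟩
    (fromℕ n - fromℕ k) * b                          ∎
    where
    open ≡-Reasoning
    b = binom n k
    c = binom n (suc k)
    insert : ∀ s b c → s * c ≡ s * (b + c) - s * b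
    insert = solve-∀ ℚ-ring
    cancel : ∀ m k b → (1ℚ + m) * b - (1ℚ + k) * b ≡ (m - k) * b
    cancel = solve-∀ ℚ-ring

  binom-pred : ∀ n k → fromℕ n * binom (n ∸ 1) k ≡ (fromℕ n - fromℕ k) * binom n k
  binom-pred zero zero = refl
  binom-pred zero (suc k) = trans (cong (fromℕ 0 *_) z)
    (trans (ℚP.*-zeroʳ (fromℕ 0)) (sym (trans (cong (c *_) z) (ℚP.*-zeroʳ c))))
    where
    z = binom-> {0} {suc k} (s≤s z≤n)
    c = fromℕ 0 - fromℕ (suc k)
  binom-pred (suc n) k = trans (sym (binom-absorb n k)) (binom-next (suc n) k)

  -- n C (k − a), read as 0 when a > k.
  binom⊖ : ℕ → ℕ → ℕ → ℚ
  binom⊖ n k       zero    = binom n k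
  binom⊖ n zero    (suc a) = 0ℚ
  binom⊖ n (suc k) (suc a) = binom⊖ n k a

  binom⊖-pascal : ∀ n k a → binom⊖ (suc n) k a ≡ binom⊖ n k a + binom⊖ n k (suc a)
  binom⊖-pascal n zero    zero    = trans (binom-zero (suc n))
      (sym (trans (ℚP.+-identityʳ (binom n 0)) (binom-zero n)))
  binom⊖-pascal n (suc k) zero    = trans (binom-pascal n k) (ℚP.+-comm (binom n k) _)
  binom⊖-pascal n zero    (suc a) = refl
  binom⊖-pascal n (suc k) (suc a) = binom⊖-pascal n k a

  binom⊖-+ : ∀ n a k → binom⊖ n (a ℕ.+ k) a ≡ binom n k
  binom⊖-+ n zero    k = refl
  binom⊖-+ n (suc a) k = binom⊖-+ n a k

  binom⊖-< : ∀ n {k a} → k ℕ.< a → binom⊖ n k a ≡ 0ℚ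
  binom⊖-< n {zero}  {suc a} _         = refl
  binom⊖-< n {suc k} {suc a} (s≤s k<a) = binom⊖-< n k<a

  binom⊖-zero : ∀ k a → binom⊖ 0 k a ≡ 𝟙 a k
  binom⊖-zero zero    zero    = binom-zero 0
  binom⊖-zero (suc k) zero    = binom-> {0} {suc k} (s≤s z≤n)
  binom⊖-zero zero    (suc a) = refl
  binom⊖-zero (suc k) (suc a) = binom⊖-zero k a

  binom⊖-nonNeg : ∀ n k a → 0ℚ ≤ binom⊖ n k a
  binom⊖-nonNeg n k       zero    = binom-nonNeg n k
  binom⊖-nonNeg n zero    (suc a) = ℚP.≤-refl
  binom⊖-nonNeg n (suc k) (suc a) = binom⊖-nonNeg n k a

  -- Symmetry of the row `suc ℓ`. It produces the factor with upper entry `suc ℓ` in the denominator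
  -- of the closed formula, and is the source of the index shift there.
  binom⊖-suc : ∀ ℓ a → binom⊖ (suc ℓ) ℓ a ≡ binom (suc ℓ) (suc a)
  binom⊖-suc ℓ a with ℕP.≤-<-connex a ℓ
  ... | inj₂ ℓ<a = trans (binom⊖-< (suc ℓ) ℓ<a) (sym (binom-> (s≤s ℓ<a)))
  ... | inj₁ a≤ℓ with ℕP.m≤n⇒∃[o]m+o≡n a≤ℓ
  ... | d , refl = trans (binom⊖-+ (suc (a ℕ.+ d)) a d) (sym (binom-sym (suc a) d))

  -- Alternating binomial sums by umbral calculus.

  sgn : ℕ → ℚ
  sgn zero    = 1ℚ
  sgn (suc n) = - sgn n

  sgn-+ : ∀ m n → sgn (m ℕ.+ n) ≡ sgn m * sgn n
  sgn-+ zero    n = sym (ℚP.*-identityˡ (sgn n))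
  sgn-+ (suc m) n = trans (cong -_ (sgn-+ m n)) (ℚP.neg-distribˡ-* (sgn m) (sgn n))

  sgn-square : ∀ m → sgn m * sgn m ≡ 1ℚ
  sgn-square zero    = refl
  sgn-square (suc m) = trans (square (sgn m)) (sgn-square m)
    where
    square : ∀ q → - q * - q ≡ q * q
    square = solve-∀ ℚ-ring

  -- The umbral power (y − x)^p, where xⁱ stands for f i and yⁱ for h i.
  D : ℕ → (ℕ → ℚ) → (ℕ → ℚ) → ℚ
  D zero    f h = f 0 * h 0
  D (suc p) f h = D p f (h ∘ suc) - D p (f ∘ suc) h

  D-cong : ∀ p {f f′ h h′} → (∀ i → f i ≡ f′ i) → (∀ i → h i ≡ h′ i) → D p f h ≡ D p f′ h′
  D-cong zero    e e′ = cong₂ _*_ (e 0) (e′ 0)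
  D-cong (suc p) e e′ = cong₂ _-_ (D-cong p e (e′ ∘ suc)) (D-cong p (e ∘ suc) e′)

  D-+ʳ : ∀ p f h h′ → D p f (λ i → h i + h′ i) ≡ D p f h + D p f h′
  D-+ʳ zero    f h h′ = ℚP.*-distribˡ-+ (f 0) (h 0) (h′ 0)
  D-+ʳ (suc p) f h h′ = trans (cong₂ _-_ (D-+ʳ p f (h ∘ suc) (h′ ∘ suc)) (D-+ʳ p (f ∘ suc) h h′))
    (regroup (D p f (h ∘ suc)) _ _ _)
    where
    regroup : ∀ a b c d → a + b - (c + d) ≡ a - c + (b - d)
    regroup = solve-∀ ℚ-ring

  D-+ˡ : ∀ p f f′ h → D p (λ i → f i + f′ i) h ≡ D p f h + D p f′ h
  D-+ˡ zero    f f′ h = ℚP.*-distribʳ-+ (h 0) (f 0) (f′ 0)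
  D-+ˡ (suc p) f f′ h = trans (cong₂ _-_ (D-+ˡ p f f′ (h ∘ suc)) (D-+ˡ p (f ∘ suc) (f′ ∘ suc) h))
    (regroup (D p f (h ∘ suc)) _ _ _)
    where
    regroup : ∀ a b c d → a + b - (c + d) ≡ a - c + (b - d)
    regroup = solve-∀ ℚ-ring

  -- (y − x)^p is unchanged when both umbrae are shifted, x = x′ + 1 and
  -- y = y′ + 1; here F a i and H b j stand for x′ᵃxⁱ and y′ᵇyʲ.
  D-shift : ∀ p (F H : ℕ → ℕ → ℚ) →
    (∀ a i → F a (suc i) ≡ F a i + F (suc a) i) →
    (∀ b j → H b (suc j) ≡ H b j + H (suc b) j) →
    D p (F 0) (H 0) ≡ D p (λ a → F a 0) (λ b → H b 0)
  D-shift zero    F H F-step H-step = refl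
  D-shift (suc p) F H F-step H-step = begin
    D p (F 0) (H 0 ∘ suc) - D p (F 0 ∘ suc) (H 0)
      ≡⟨ cong₂ _-_ (D-shift p F (λ b → H b ∘ suc) F-step (λ b → H-step b ∘ suc))
                   (D-shift p (λ a → F a ∘ suc) H (λ a → F-step a ∘ suc) H-step) ⟩
    D p f (λ b → H b 1) - D p (λ a → F a 1) h
      ≡⟨ cong₂ _-_ (trans (D-cong p (λ _ → refl) (λ b → H-step b 0)) (D-+ʳ p f h (h ∘ suc)))
                   (trans (D-cong p (λ a → F-step a 0) (λ _ → refl)) (D-+ˡ p f (f ∘ suc) h)) ⟩
    D p f h + D p f (h ∘ suc) - (D p f h + D p (f ∘ suc) h)
      ≡⟨ cancel (D p f h) _ _ ⟩
    D p f (h ∘ suc) - D p (f ∘ suc) h ∎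
    where
    open ≡-Reasoning
    f h : ℕ → ℚ
    f a = F a 0
    h b = H b 0
    cancel : ∀ a b c → a + b - (a + c) ≡ b - c
    cancel = solve-∀ ℚ-ring

  -- The binomial theorem for the umbral power. The range may exceed `p`, since further terms carry
  -- a zero binomial; this allows one common range for all `p ≤ K`.
  D-sum : ∀ p {K} f h → p ℕ.≤ K →
    ∑[ i < suc K ] (sgn i * binom p i * f i * h (p ∸ i)) ≡ D p f h
  D-sum zero {K} f h _ = begin
    1ℚ * binom 0 0 * f 0 * h 0 + ∑[ i < K ] (sgn (suc i) * binom 0 (suc i) * f (suc i) * h 0)
      ≡⟨ cong₂ _+_ (trans (cong (λ c → 1ℚ * c * f 0 * h 0) (binom-zero 0)) (unit (f 0) (h 0)))
          (∑<-zero K λ i _ →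
           trans (cong (λ c → sgn (suc i) * c * f (suc i) * h 0) (binom-> {0} {suc i} (s≤s z≤n)))
                 (vanish (sgn (suc i)) (f (suc i)) (h 0))) ⟩
    f 0 * h 0 + 0ℚ ≡⟨ ℚP.+-identityʳ _ ⟩
    f 0 * h 0 ∎
    where
    open ≡-Reasoning
    unit : ∀ a b → 1ℚ * 1ℚ * a * b ≡ a * b
    unit = solve-∀ ℚ-ring
    vanish : ∀ s a b → s * 0ℚ * a * b ≡ 0ℚ
    vanish = solve-∀ ℚ-ring
  D-sum (suc p) {suc K} f h (s≤s p≤K) = begin
    1ℚ * binom (suc p) 0 * f 0 * h (suc p)
      + ∑[ i < suc K ] (- sgn i * binom (suc p) (suc i) * f (suc i) * h (p ∸ i))
      ≡⟨ cong₂ _+_ (cong (λ c → 1ℚ * c * f 0 * h (suc p)) (trans (binom-zero (suc p)) (sym (binom-zero p))))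
           (trans (∑<-cong (suc K) (λ i _ → pascal i)) (∑<-+ (suc K) U V)) ⟩
    u + (∑< (suc K) U + ∑< (suc K) V)
      ≡⟨ sym (ℚP.+-assoc u _ _) ⟩
    (u + ∑< (suc K) U) + ∑< (suc K) V
      ≡⟨ cong₂ _+_ (cong (u +_) (∑<-cong (suc K) (λ i _ → lower i)))
          (∑<-cong (suc K) (λ i _ → negate (sgn i) (binom p i) (f (suc i)) (h (p ∸ i)))) ⟩
    ∑[ i < suc (suc K) ] (sgn i * binom p i * f i * h (suc (p ∸ i)))
      + ∑[ i < suc K ] (- 1ℚ * (sgn i * binom p i * f (suc i) * h (p ∸ i)))
      ≡⟨ cong₂ _+_ (D-sum p {suc K} f (h ∘ suc) (ℕP.m≤n⇒m≤1+n p≤K))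
           (trans (sym (∑<-distribˡ (suc K) (- 1ℚ) (λ i → sgn i * binom p i * f (suc i) * h (p ∸ i))))
               (cong (- 1ℚ *_) (D-sum p {K} (f ∘ suc) h p≤K))) ⟩
    D p f (h ∘ suc) + - 1ℚ * D p (f ∘ suc) h
      ≡⟨ minus (D p f (h ∘ suc)) (D p (f ∘ suc) h) ⟩
    D p f (h ∘ suc) - D p (f ∘ suc) h ∎
    where
    open ≡-Reasoning
    U V : ℕ → ℚ
    U i = sgn (suc i) * binom p (suc i) * f (suc i) * h (p ∸ i)
    V i = sgn (suc i) * binom p i * f (suc i) * h (p ∸ i)
    u = 1ℚ * binom p 0 * f 0 * h (suc p)
    minus : ∀ a b → a + - 1ℚ * b ≡ a - b
    minus = solve-∀ ℚ-ring
    negate : ∀ s a b c → - s * a * b * c ≡ - 1ℚ * (s * a * b * c)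
    negate = solve-∀ ℚ-ring
    pascal : ∀ i → - sgn i * binom (suc p) (suc i) * f (suc i) * h (p ∸ i) ≡ U i + V i
    pascal i = trans (cong (λ c → - sgn i * c * f (suc i) * h (p ∸ i)) (binom-pascal p i))
      (expand (- sgn i) (binom p i) (binom p (suc i)) (f (suc i)) (h (p ∸ i)))
      where
      expand : ∀ s a b c d → s * (a + b) * c * d ≡ s * b * c * d + s * a * c * d
      expand = solve-∀ ℚ-ring
    -- For `i < p` the two arguments of `h` agree; for `i ≥ p` truncated subtraction makes them
    -- differ, but the factor `binom p (suc i)` is zero.
    lower : ∀ i → U i ≡ sgn (suc i) * binom p (suc i) * f (suc i) * h (suc (p ∸ suc i))
    lower i with ℕP.≤-<-connex p i
    ... | inj₂ i<p = cong (λ x → sgn (suc i) * binom p (suc i) * f (suc i) * h x) (ℕP.+-∸-assoc 1 i<p)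
    ... | inj₁ p≤i rewrite binom-> {p} {suc i} (s≤s p≤i) = trans
        (vanish (sgn (suc i)) (f (suc i)) (h (p ∸ i)))
        (sym (vanish (sgn (suc i)) (f (suc i)) (h (suc (p ∸ suc i)))))
      where
      vanish : ∀ s a b → s * 0ℚ * a * b ≡ 0ℚ
      vanish = solve-∀ ℚ-ring

  -- Here the umbra y is 0, so (y - x)^p becomes (-x)^p.
  D-const : ∀ p f → D p f (λ b → 𝟙 b 0) ≡ sgn p * f p
  D-const zero    f = trans (ℚP.*-identityʳ (f 0)) (sym (ℚP.*-identityˡ (f 0)))
  D-const (suc p) f = trans (cong₂ _-_ (D-zeroʳ p f) (D-const p (f ∘ suc))) (negate (sgn p) (f (suc p)))
    where
    D-zeroʳ : ∀ p f → D p f (λ _ → 0ℚ) ≡ 0ℚ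
    D-zeroʳ zero    f = ℚP.*-zeroʳ (f 0)
    D-zeroʳ (suc p) f = cong₂ _-_ (D-zeroʳ p f) (D-zeroʳ p (f ∘ suc))
    negate : ∀ s a → 0ℚ - s * a ≡ - s * a
    negate = solve-∀ ℚ-ring

  -- With xˢ read as `binom s ℓ` and y = 1, the sum is (y - x)^m. Shifting both umbrae by 1 makes y
  -- zero and turns x into the umbra whose powers are `binom⊖ 0 ℓ a`, nonzero only at `a = ℓ`.
  binomial-inversion : ∀ {m K} ℓ → m ℕ.≤ K →
    ∑[ s < suc K ] (sgn s * binom m s * binom s ℓ) ≡ sgn m * 𝟙 m ℓ
  binomial-inversion {m} {K} ℓ m≤K = begin
    ∑[ s < suc K ] (sgn s * binom m s * binom s ℓ)
      ≡⟨ ∑<-cong (suc K) (λ s _ → sym (ℚP.*-identityʳ (sgn s * binom m s * binom s ℓ))) ⟩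
    ∑[ s < suc K ] (sgn s * binom m s * binom s ℓ * 1ℚ)
      ≡⟨ D-sum m (λ s → binom s ℓ) (λ _ → 1ℚ) m≤K ⟩
    D m (λ s → binom s ℓ) (λ _ → 1ℚ)
      ≡⟨ D-shift m (λ a i → binom⊖ i ℓ a) (λ b _ → 𝟙 b 0) (λ a i → binom⊖-pascal i ℓ a)
           (λ b _ → sym (ℚP.+-identityʳ (𝟙 b 0))) ⟩
    D m (binom⊖ 0 ℓ) (λ b → 𝟙 b 0)
      ≡⟨ D-const m (binom⊖ 0 ℓ) ⟩
    sgn m * binom⊖ 0 ℓ m
      ≡⟨ cong (sgn m *_) (binom⊖-zero ℓ m) ⟩
    sgn m * 𝟙 m ℓ ∎
    where open ≡-Reasoning

  -- One shift applies the Vandermonde convolution to both families at once: the moving upper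
  -- entries `j + i` and `M + x` become the fixed `j` and `M`. This is what brings the eigenvalues
  -- into closed form.
  D-vandermonde : ∀ p j ℓ M →
    D p (λ i → binom (j ℕ.+ i) ℓ) (λ x → binom (M ℕ.+ x) x) ≡ D p (binom⊖ j ℓ) (binom M)
  D-vandermonde p j ℓ M = begin
    D p (F 0) (H 0) ≡⟨ D-shift p F H F-step H-step ⟩
    D p (λ a → F a 0) (λ b → H b 0)
      ≡⟨ D-cong p (λ a → cong (λ m → binom⊖ m ℓ a) (ℕP.+-identityʳ j))
                  (λ b → cong₂ binom (ℕP.+-identityʳ M) (ℕP.+-identityʳ b)) ⟩
    D p (binom⊖ j ℓ) (binom M) ∎
    where
    open ≡-Reasoning
    F H : ℕ → ℕ → ℚ
    F a i = binom⊖ (j ℕ.+ i) ℓ a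
    H b x = binom (M ℕ.+ x) (b ℕ.+ x)
    F-step : ∀ a i → F a (suc i) ≡ F a i + F (suc a) i
    F-step a i rewrite ℕP.+-suc j i = binom⊖-pascal (j ℕ.+ i) ℓ a
    H-step : ∀ b x → H b (suc x) ≡ H b x + H (suc b) x
    H-step b x rewrite ℕP.+-suc M x | ℕP.+-suc b x = binom-pascal (M ℕ.+ x) (b ℕ.+ x)

  -- The inclusion matrix (A , B) ↦ ∣ A ∩ B ∣ C s on k-subsets of an n-set has
  -- the eigenvalue weight n k s j on the j-th eigenspace of the Johnson scheme.
  weight : (n k s j : ℕ) → ℚ
  weight n k s j = binom⊖ (k ∸ j) s j * binom (n ∸ j ∸ s) (k ∸ s)

  -- Likewise for the matrix indicating ∣ A ∩ B ∣ = ℓ.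
  spectrum : (n k ℓ j : ℕ) → ℚ
  spectrum n k ℓ j = ∑[ s < suc k ] (sgn (ℓ ℕ.+ s) * binom s ℓ * weight n k s j)

-- Sums over subsets obtained by exchanging elements.

module SwapSum where
  open Rational
  open Binomial
  open import Data.Rational.Base using (_+_; _*_)
  open import Data.Fin.Subset using (Subset; inside; outside; _∩_; ∁; ∣_∣)

  -- Summing over the whole power set, one coordinate at a time, gives the inductions below a free
  -- hypothesis; the restriction to a given size is put into the summand.
  ∑² : ∀ n → (Subset n → ℚ) → ℚ
  ∑² zero    f = f []
  ∑² (suc n) f = ∑² n (f ∘ (outside ∷_)) + ∑² n (f ∘ (inside ∷_))

  ∑²-cong : ∀ n {f g} → (∀ A → f A ≡ g A) → ∑² n f ≡ ∑² n g
  ∑²-cong zero    e = e []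
  ∑²-cong (suc n) e = cong₂ _+_ (∑²-cong n (e ∘ (outside ∷_))) (∑²-cong n (e ∘ (inside ∷_)))

  ∑²-zero : ∀ n {f} → (∀ A → f A ≡ 0ℚ) → ∑² n f ≡ 0ℚ
  ∑²-zero zero    e = e []
  ∑²-zero (suc n) e = cong₂ _+_ (∑²-zero n (e ∘ (outside ∷_))) (∑²-zero n (e ∘ (inside ∷_)))

  enum : ∀ {n k} → Fin (#KSubset n k) → KSubset n k
  enum {n} {k} = Inverse.to (KSubset-enumeration n k)

  ∑ₖ : ∀ n k → (KSubset n k → ℚ) → ℚ
  ∑ₖ n k f = sum (f ∘ enum)

  sum-⊎ : ∀ m {n} (f : Fin m ⊎ Fin n → ℚ) →
    sum (f ∘ splitAt m) ≡ sum (f ∘ inj₁) + sum (f ∘ inj₂)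
  sum-⊎ zero    f = sym (ℚP.+-identityˡ _)
  sum-⊎ (suc m) f = trans (cong (f (inj₁ Fin.zero) +_) (sum-⊎ m (f ∘ Sum.map₁ Fin.suc)))
    (sym (ℚP.+-assoc (f (inj₁ Fin.zero)) _ _))

  ∑ₖ≡∑² : ∀ n k (f : Subset n → ℚ) → ∑ₖ n k (f ∘ proj₁) ≡ ∑² n (λ A → 𝟙 ∣ A ∣ k * f A)
  ∑ₖ≡∑² zero zero f = trans (ℚP.+-identityʳ (f [])) (sym (ℚP.*-identityˡ (f [])))
  ∑ₖ≡∑² zero (suc k) f = sym (ℚP.*-zeroˡ (f []))
  ∑ₖ≡∑² (suc n) zero f = trans (∑ₖ≡∑² n zero (f ∘ (outside ∷_)))
    (sym (trans (cong (∑² n (λ A → 𝟙 ∣ A ∣ 0 * f (outside ∷ A)) +_)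
                  (∑²-zero n (λ A → ℚP.*-zeroˡ (f (inside ∷ A)))))
      (ℚP.+-identityʳ _)))
  ∑ₖ≡∑² (suc n) (suc k) f = trans
    (trans (sum-cong-≗ (λ i → cong f (enum-glue (splitAt (#KSubset n (suc k)) i))))
      (sum-⊎ (#KSubset n (suc k)) (f ∘ proj₁ ∘ glue)))
    (cong₂ _+_ (∑ₖ≡∑² n (suc k) (f ∘ (outside ∷_))) (∑ₖ≡∑² n k (f ∘ (inside ∷_))))
    where
    glue : Fin (#KSubset n (suc k)) ⊎ Fin (#KSubset n k) → KSubset (suc n) (suc k)
    glue (inj₁ i) = let A , p = enum i in outside ∷ A , p
    glue (inj₂ i) = let A , p = enum i in inside ∷ A , cong suc p
    enum-glue : ∀ x → proj₁ {B = λ A → ∣ A ∣ ≡ suc k}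
        (Sum.[ (λ (A , p) → outside ∷ A , p) , (λ (A , p) → inside ∷ A , cong suc p) ]
      (Sum.map (enum {n} {suc k}) (enum {n} {k}) x)) ≡ proj₁ (glue x)
    enum-glue (inj₁ i) = refl
    enum-glue (inj₂ i) = refl

  #KSubset≡binom : ∀ n k → fromℕ (#KSubset n k) ≡ binom n k
  #KSubset≡binom zero    zero    = sym (binom-zero 0)
  #KSubset≡binom zero    (suc k) = sym (binom-> {0} {suc k} (s≤s z≤n))
  #KSubset≡binom (suc n) zero    = trans (#KSubset≡binom n zero)
      (trans (binom-zero n) (sym (binom-zero (suc n))))
  #KSubset≡binom (suc n) (suc k) = trans (fromℕ-+ (#KSubset n (suc k)) (#KSubset n k))
    (trans (cong₂ _+_ (#KSubset≡binom n (suc k)) (#KSubset≡binom n k))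
      (trans (ℚP.+-comm (binom n (suc k)) (binom n k)) (sym (binom-pascal n k))))

  ∣∩∣+∣∩∁∣ : ∀ {n} (A B : Subset n) → ∣ A ∩ B ∣ ℕ.+ ∣ A ∩ ∁ B ∣ ≡ ∣ A ∣
  ∣∩∣+∣∩∁∣ []            []            = refl
  ∣∩∣+∣∩∁∣ (inside  ∷ A) (inside  ∷ B) = cong suc (∣∩∣+∣∩∁∣ A B)
  ∣∩∣+∣∩∁∣ (inside  ∷ A) (outside ∷ B) = trans (ℕP.+-suc ∣ A ∩ B ∣ ∣ A ∩ ∁ B ∣) (cong suc (∣∩∣+∣∩∁∣ A B))
  ∣∩∣+∣∩∁∣ (outside ∷ A) (inside  ∷ B) = ∣∩∣+∣∩∁∣ A B
  ∣∩∣+∣∩∁∣ (outside ∷ A) (outside ∷ B) = ∣∩∣+∣∩∁∣ A B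

  -- Indicates that `B` arises from `A` by deleting `α` elements and inserting `β` others.
  -- `swap 1 1` is the adjacency matrix of the Johnson graph and `swap 0 0` the identity matrix;
  -- unequal indices arise when a coordinate is split off.
  swap : ∀ {n} → ℕ → ℕ → Subset n → Subset n → ℚ
  swap α β A B = 𝟙 (∣ A ∩ ∁ B ∣) α * 𝟙 (∣ B ∩ ∁ A ∣) β

  swap-sym : ∀ {n} α (A B : Subset n) → swap α α A B ≡ swap α α B A
  swap-sym α A B = ℚP.*-comm (𝟙 (∣ A ∩ ∁ B ∣) α) (𝟙 (∣ B ∩ ∁ A ∣) α)

  swapSum : ∀ {n} → ℕ → ℕ → Subset n → Subset n → (ℕ → ℚ) → ℚ
  swapSum {n} α β A C g = ∑² n (λ B → swap α β A B * g ∣ B ∩ C ∣)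

  private
    0*x*y : ∀ x y → 0ℚ * x * y ≡ 0ℚ
    0*x*y = solve-∀ ℚ-ring
    x*0*y : ∀ x y → x * 0ℚ * y ≡ 0ℚ
    x*0*y = solve-∀ ℚ-ring
    0+x≡ : ∀ {x y} z → x ≡ 0ℚ → y ≡ z → x + y ≡ z
    0+x≡ z e f = trans (cong₂ _+_ e f) (ℚP.+-identityˡ z)
    x+0≡ : ∀ {x y} z → x ≡ z → y ≡ 0ℚ → x + y ≡ z
    x+0≡ z e f = trans (cong₂ _+_ e f) (ℚP.+-identityʳ z)
    via : ∀ {l} (f : ℚ → ℚ) n → l ≡ f (1ℚ + fromℕ n) → l ≡ f (fromℕ (suc n))
    via f n e = trans e (cong f (sym (fromℕ-suc n)))

  swapSum₀₀ : ∀ {n} (A C : Subset n) g → swapSum 0 0 A C g ≡ g ∣ A ∩ C ∣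
  swapSum₀₀ [] [] g = ℚP.*-identityˡ (g 0)
  swapSum₀₀ {suc n} (outside ∷ A) (c ∷ C) g = x+0≡ _ (swapSum₀₀ A C g)
    (∑²-zero n (λ B → x*0*y (𝟙 (∣ A ∩ ∁ B ∣) 0) (g ∣ (inside ∷ B) ∩ (c ∷ C) ∣)))
  swapSum₀₀ {suc n} (inside ∷ A) (inside ∷ C) g = 0+x≡ _
    (∑²-zero n (λ B → 0*x*y (𝟙 (∣ B ∩ ∁ A ∣) 0) (g ∣ B ∩ C ∣))) (swapSum₀₀ A C (g ∘ suc))
  swapSum₀₀ {suc n} (inside ∷ A) (outside ∷ C) g = 0+x≡ _
    (∑²-zero n (λ B → 0*x*y (𝟙 (∣ B ∩ ∁ A ∣) 0) (g ∣ B ∩ C ∣))) (swapSum₀₀ A C g)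

  -- The subscripts record membership in `A` and then in `C`: these are the sizes of the four cells
  -- cut out by the two sets.
  c₁₁ c₁₀ c₀₁ c₀₀ : ∀ {n} → Subset n → Subset n → ℚ
  c₁₁ A C = fromℕ ∣ A ∩ C ∣
  c₁₀ A C = fromℕ ∣ A ∩ ∁ C ∣
  c₀₁ A C = fromℕ ∣ C ∩ ∁ A ∣
  c₀₀ A C = fromℕ ∣ ∁ A ∩ ∁ C ∣

  swapSum₀₁ : ∀ {n} (A C : Subset n) g → let m = ∣ A ∩ C ∣ in
    swapSum 0 1 A C g ≡ c₀₁ A C * g (suc m) + c₀₀ A C * g m
  swapSum₀₁ [] [] g = base (g 0) (g 1)
    where
    base : ∀ x y → 1ℚ * 0ℚ * x ≡ 0ℚ * y + 0ℚ * x
    base = solve-∀ ℚ-ring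
  swapSum₀₁ {suc n} (outside ∷ A) (outside ∷ C) g = via (λ t → c₀₁ A C * g (suc m) + t * g m)
    (∣ ∁ A ∩ ∁ C ∣) (trans (cong₂ _+_ (swapSum₀₁ A C g) (swapSum₀₀ A C g))
        (collect (c₀₁ A C) (c₀₀ A C) (g (suc m)) (g m)))
    where
    m = ∣ A ∩ C ∣
    collect : ∀ a b x y → a * x + b * y + y ≡ a * x + (1ℚ + b) * y
    collect = solve-∀ ℚ-ring
  swapSum₀₁ {suc n} (outside ∷ A) (inside ∷ C) g = via (λ t → t * g (suc m) + c₀₀ A C * g m)
    (∣ C ∩ ∁ A ∣) (trans (cong₂ _+_ (swapSum₀₁ A C g) (swapSum₀₀ A C (g ∘ suc)))
        (collect (c₀₁ A C) (c₀₀ A C) (g (suc m)) (g m)))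
    where
    m = ∣ A ∩ C ∣
    collect : ∀ a b x y → a * x + b * y + x ≡ (1ℚ + a) * x + b * y
    collect = solve-∀ ℚ-ring
  swapSum₀₁ {suc n} (inside ∷ A) (inside ∷ C) g = 0+x≡ _
    (∑²-zero n (λ B → 0*x*y (𝟙 (∣ B ∩ ∁ A ∣) 1) (g ∣ B ∩ C ∣))) (swapSum₀₁ A C (g ∘ suc))
  swapSum₀₁ {suc n} (inside ∷ A) (outside ∷ C) g = 0+x≡ _
    (∑²-zero n (λ B → 0*x*y (𝟙 (∣ B ∩ ∁ A ∣) 1) (g ∣ B ∩ C ∣))) (swapSum₀₁ A C g)

  -- When m = 0 the junk value g (m ∸ 1) has coefficient 0.
  scaled-pred : ∀ m (g : ℕ → ℚ) → fromℕ m * g (suc (m ∸ 1)) ≡ fromℕ m * g m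
  scaled-pred zero    g = trans (ℚP.*-zeroˡ (g 1)) (sym (ℚP.*-zeroˡ (g 0)))
  scaled-pred (suc m) g = refl

  swapSum₁₀ : ∀ {n} (A C : Subset n) g → let m = ∣ A ∩ C ∣ in
    swapSum 1 0 A C g ≡ c₁₁ A C * g (m ∸ 1) + c₁₀ A C * g m
  swapSum₁₀ [] [] g = base (g 0)
    where
    base : ∀ x → 0ℚ * 1ℚ * x ≡ 0ℚ * x + 0ℚ * x
    base = solve-∀ ℚ-ring
  swapSum₁₀ {suc n} (outside ∷ A) (inside ∷ C) g = x+0≡ _ (swapSum₁₀ A C g)
    (∑²-zero n (λ B → x*0*y (𝟙 (∣ A ∩ ∁ B ∣) 1) (g (suc ∣ B ∩ C ∣))))
  swapSum₁₀ {suc n} (outside ∷ A) (outside ∷ C) g = x+0≡ _ (swapSum₁₀ A C g)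
    (∑²-zero n (λ B → x*0*y (𝟙 (∣ A ∩ ∁ B ∣) 1) (g ∣ B ∩ C ∣)))
  swapSum₁₀ {suc n} (inside ∷ A) (inside ∷ C) g = via (λ t → t * g m + c₁₀ A C * g (suc m))
    (∣ A ∩ C ∣) (trans
      (cong₂ _+_ (swapSum₀₀ A C g)
        (trans (swapSum₁₀ A C (g ∘ suc)) (cong (_+ c₁₀ A C * g (suc m)) (scaled-pred m g))))
      (collect (c₁₁ A C) (c₁₀ A C) (g m) (g (suc m))))
    where
    m = ∣ A ∩ C ∣
    collect : ∀ a b x y → x + (a * x + b * y) ≡ (1ℚ + a) * x + b * y
    collect = solve-∀ ℚ-ring
  swapSum₁₀ {suc n} (inside ∷ A) (outside ∷ C) g = via (λ t → c₁₁ A C * g (m ∸ 1) + t * g m)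
    (∣ A ∩ ∁ C ∣) (trans
      (cong₂ _+_ (swapSum₀₀ A C g) (swapSum₁₀ A C g))
      (collect (c₁₁ A C) (c₁₀ A C) (g (m ∸ 1)) (g m)))
    where
    m = ∣ A ∩ C ∣
    collect : ∀ a b x y → y + (a * x + b * y) ≡ a * x + (1ℚ + b) * y
    collect = solve-∀ ℚ-ring

  -- The deleted element lies in `C` or not, and so does the inserted one; the four combinations
  -- change the intersection by +1, -1 and twice 0. In the induction, a first coordinate that is
  -- itself deleted leaves a pure insertion `swapSum 0 1`, and one that is inserted leaves a pure
  -- deletion `swapSum 1 0`.
  swapSum₁₁ : ∀ {n} (A C : Subset n) g → let m = ∣ A ∩ C ∣ in
    swapSum 1 1 A C g ≡ c₁₀ A C * c₀₁ A C * g (suc m) + c₀₀ A C * (c₁₁ A C * g (m ∸ 1))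
                         + (c₁₁ A C * c₀₁ A C + c₁₀ A C * c₀₀ A C) * g m
  swapSum₁₁ [] [] g = base (g 0) (g 1)
    where
    base : ∀ x y → 0ℚ * 0ℚ * x ≡ 0ℚ * 0ℚ * y + 0ℚ * (0ℚ * x) + (0ℚ * 0ℚ + 0ℚ * 0ℚ) * x
    base = solve-∀ ℚ-ring
  swapSum₁₁ (outside ∷ A) (outside ∷ C) g = via
      (λ t → c₁₀ A C * c₀₁ A C * g (suc m) + t * (c₁₁ A C * g (m ∸ 1)) + (c₁₁ A C * c₀₁ A C + c₁₀ A C * t) *
      g m)
    (∣ ∁ A ∩ ∁ C ∣) (trans
      (cong₂ _+_ (swapSum₁₁ A C g) (swapSum₁₀ A C g))
      (collect (c₁₁ A C) (c₁₀ A C) (c₀₁ A C) (c₀₀ A C) (g (suc m)) (g (m ∸ 1)) (g m)))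
    where
    m = ∣ A ∩ C ∣
    collect : ∀ a b c d x y z →
      b * c * x + d * (a * y) + (a * c + b * d) * z + (a * y + b * z) ≡
      b * c * x + (1ℚ + d) * (a * y) + (a * c + b * (1ℚ + d)) * z
    collect = solve-∀ ℚ-ring
  swapSum₁₁ (outside ∷ A) (inside ∷ C) g = via
      (λ t → c₁₀ A C * t * g (suc m) + c₀₀ A C * (c₁₁ A C * g (m ∸ 1)) + (c₁₁ A C * t + c₁₀ A C * c₀₀ A C) *
      g m)
    (∣ C ∩ ∁ A ∣) (trans
      (cong₂ _+_ (swapSum₁₁ A C g) (trans (swapSum₁₀ A C (g ∘ suc))
          (cong (_+ c₁₀ A C * g (suc m)) (scaled-pred m g))))
      (collect (c₁₁ A C) (c₁₀ A C) (c₀₁ A C) (c₀₀ A C) (g (suc m)) (g (m ∸ 1)) (g m)))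
    where
    m = ∣ A ∩ C ∣
    collect : ∀ a b c d x y z →
      b * c * x + d * (a * y) + (a * c + b * d) * z + (a * z + b * x) ≡
      b * (1ℚ + c) * x + d * (a * y) + (a * (1ℚ + c) + b * d) * z
    collect = solve-∀ ℚ-ring
  swapSum₁₁ (inside ∷ A) (inside ∷ C) g = via
      (λ t → c₁₀ A C * c₀₁ A C * g (suc (suc m)) + c₀₀ A C * (t * g m) + (t * c₀₁ A C + c₁₀ A C * c₀₀ A C) *
      g (suc m))
    (∣ A ∩ C ∣) (trans
      (cong₂ _+_ (swapSum₀₁ A C g) (trans (swapSum₁₁ A C (g ∘ suc))
        (cong (λ t → c₁₀ A C * c₀₁ A C * g (suc (suc m)) + c₀₀ A C * t +
            (c₁₁ A C * c₀₁ A C + c₁₀ A C * c₀₀ A C) * g (suc m))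
          (scaled-pred m g))))
      (collect (c₁₁ A C) (c₁₀ A C) (c₀₁ A C) (c₀₀ A C) (g (suc (suc m))) (g m) (g (suc m))))
    where
    m = ∣ A ∩ C ∣
    collect : ∀ a b c d x y z →
      c * z + d * y + (b * c * x + d * (a * y) + (a * c + b * d) * z) ≡
      b * c * x + d * ((1ℚ + a) * y) + ((1ℚ + a) * c + b * d) * z
    collect = solve-∀ ℚ-ring
  swapSum₁₁ (inside ∷ A) (outside ∷ C) g = via
      (λ t → t * c₀₁ A C * g (suc m) + c₀₀ A C * (c₁₁ A C * g (m ∸ 1)) + (c₁₁ A C * c₀₁ A C + t * c₀₀ A C) *
      g m)
    (∣ A ∩ ∁ C ∣) (trans
      (cong₂ _+_ (swapSum₀₁ A C g) (swapSum₁₁ A C g))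
      (collect (c₁₁ A C) (c₁₀ A C) (c₀₁ A C) (c₀₀ A C) (g (suc m)) (g (m ∸ 1)) (g m)))
    where
    m = ∣ A ∩ C ∣
    collect : ∀ a b c d x y z →
      c * x + d * z + (b * c * x + d * (a * y) + (a * c + b * d) * z) ≡
      (1ℚ + b) * c * x + d * (a * y) + (a * c + (1ℚ + b) * d) * z
    collect = solve-∀ ℚ-ring

  -- Exchanging as many elements as are inserted preserves the size, so the size indicator is
  -- absorbed. Hence a swap sum over `k`-subsets can be computed over the whole power set.
  swap-size : ∀ {n} α (A B : Subset n) → 𝟙 (∣ B ∣) (∣ A ∣) * swap α α A B ≡ swap α α A B
  swap-size α A B = begin
    𝟙 (∣ B ∣) (∣ A ∣) * (𝟙 a α * 𝟙 b α)      ≡⟨ cong (_* (𝟙 a α * 𝟙 b α)) size ⟩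
    𝟙 b a * (𝟙 a α * 𝟙 b α)                  ≡⟨ rotate (𝟙 b a) (𝟙 a α) (𝟙 b α) ⟩
    𝟙 a α * (𝟙 b α * 𝟙 b a)                  ≡⟨ cong (𝟙 a α *_) (𝟙-subst b α (λ x → 𝟙 x a)) ⟩
    𝟙 a α * (𝟙 b α * 𝟙 α a)                  ≡⟨ rotate (𝟙 a α) (𝟙 b α) (𝟙 α a) ⟩
    𝟙 b α * (𝟙 α a * 𝟙 a α)                  ≡⟨ cong (𝟙 b α *_) (ℚP.*-comm (𝟙 α a) (𝟙 a α)) ⟩
    𝟙 b α * (𝟙 a α * 𝟙 α a)                  ≡⟨ cong (𝟙 b α *_) (𝟙-subst a α (𝟙 α)) ⟩
    𝟙 b α * (𝟙 a α * 𝟙 α α)                  ≡⟨ cong (λ x → 𝟙 b α * (𝟙 a α * x)) (𝟙-refl α) ⟩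
    𝟙 b α * (𝟙 a α * 1ℚ)                     ≡⟨ unit (𝟙 b α) (𝟙 a α) ⟩
    𝟙 a α * 𝟙 b α                            ∎
    where
    open ≡-Reasoning
    a = ∣ A ∩ ∁ B ∣
    b = ∣ B ∩ ∁ A ∣
    size : 𝟙 (∣ B ∣) (∣ A ∣) ≡ 𝟙 b a
    size = trans (cong₂ 𝟙 (trans (sym (∣∩∣+∣∩∁∣ B A)) (cong (λ S → ∣ S ∣ ℕ.+ b) (∩-comm B A)))
                          (sym (∣∩∣+∣∩∁∣ A B)))
                 (𝟙-cancelˡ (∣ A ∩ B ∣) b a)
    rotate : ∀ x y z → x * (y * z) ≡ y * (z * x)
    rotate = solve-∀ ℚ-ring
    unit : ∀ x y → x * (y * 1ℚ) ≡ y * x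
    unit = solve-∀ ℚ-ring

  ∑ₖ-swap : ∀ {n} {k} α (A C : Subset n) g → ∣ A ∣ ≡ k →
    ∑ₖ n k (λ B → swap α α A (proj₁ B) * g (∣ proj₁ B ∩ C ∣)) ≡ swapSum α α A C g
  ∑ₖ-swap {n} {k} α A C g refl = trans
    (∑ₖ≡∑² n k (λ B → swap α α A B * g (∣ B ∩ C ∣)))
    (∑²-cong n (λ B → trans (sym (ℚP.*-assoc (𝟙 (∣ B ∣) k) (swap α α A B) (g (∣ B ∩ C ∣))))
      (cong (_* g (∣ B ∩ C ∣)) (swap-size α A B))))

-- Limits with rate 1/n and polynomial growth.

module Asymptotics where
  open Rational
  open Binomial
  open import Data.Rational.Base using (mkℚ; ½; _+_; _*_; _-_; -_; _≤_; _<_; ∣_∣; ↥_)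
  open import Data.Nat.Base using (_!)

  ev-const : ∀ {P : ℕ → Set} → (∀ n → P n) → Eventually P
  ev-const h = 0 , λ n _ → h n

  ev-map : ∀ {P Q : ℕ → Set} → (∀ n → P n → Q n) → Eventually P → Eventually Q
  ev-map f (n₀ , h) = n₀ , λ n n₀≤n → f n (h n n₀≤n)

  ev-map₂ : ∀ {P Q R : ℕ → Set} → (∀ n → P n → Q n → R n) → Eventually P → Eventually Q → Eventually R
  ev-map₂ f (a , h) (b , h′) = a ℕ.⊔ b , λ n a⊔b≤n →
    f n (h n (ℕP.m⊔n≤o⇒m≤o a b a⊔b≤n)) (h′ n (ℕP.m⊔n≤o⇒n≤o a b a⊔b≤n))

  ev-≥ : ∀ m → Eventually (λ n → m ℕ.≤ n)
  ev-≥ m = m , λ _ m≤n → m≤n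

  ev-all : ∀ m {P : ℕ → ℕ → Set} → (∀ j → j ℕ.< m → Eventually (P j)) → Eventually
      (λ n → ∀ j → j ℕ.< m → P j n)
  ev-all zero    h = ev-const λ _ _ ()
  ev-all (suc m) {P} h = ev-map₂ (λ n p q j j≤m → combine p q j≤m (ℕP.m≤n⇒m<n∨m≡n (ℕP.≤-pred j≤m)))
    (ev-all m (λ j j<m → h j (ℕP.m≤n⇒m≤1+n j<m))) (h m ℕP.≤-refl)
    where
    combine : ∀ {n} → (∀ j → j ℕ.< m → P j n) → P m n → ∀ {j} → j ℕ.< suc m → j ℕ.< m ⊎ j ≡ m → P j n
    combine p q _ (inj₁ j<m)  = p _ j<m
    combine p q _ (inj₂ refl) = q

  ρ : ℕ → ℚ
  ρ n = inv (fromℕ n)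

  n*ρ : ∀ {n} → 0 ℕ.< n → fromℕ n * ρ n ≡ 1ℚ
  n*ρ 0<n = *-inv (fromℕ≢0 0<n)

  ρ-pos : ∀ {n} → 0 ℕ.< n → 0ℚ < ρ n
  ρ-pos 0<n = inv-pos (fromℕ-pos 0<n)

  ρ-nonNeg : ∀ n → 0ℚ ≤ ρ n
  ρ-nonNeg zero    = ℚP.≤-reflexive (sym inv-zero)
  ρ-nonNeg (suc n) = ℚP.<⇒≤ (ρ-pos {suc n} (s≤s z≤n))

  ρ≤1 : ∀ n → ρ n ≤ 1ℚ
  ρ≤1 zero    = ℚP.≤-trans (ℚP.≤-reflexive inv-zero) (ℚP.<⇒≤ 0<1)
  ρ≤1 (suc n) = ℚP.≤-trans (ℚP.≤-reflexive (sym (ℚP.*-identityˡ (ρ (suc n)))))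
    (ℚP.≤-trans (*-monoʳ (ρ-nonNeg (suc n)) (fromℕ-mono {1} {suc n} (s≤s z≤n)))
        (ℚP.≤-reflexive (n*ρ {suc n} (s≤s z≤n))))

  -- The Archimedean property: the denominator is at least 1, so the numerator alone bounds the
  -- fraction.
  q≤∣↥q∣ : ∀ q → q ≤ fromℕ ℤ.∣ ↥ q ∣
  q≤∣↥q∣ (mkℚ i d c) rewrite i/1≡mkℚ (ℤ.+ ℤ.∣ i ∣) = ℚ.*≤* (lemma i)
    where
    lemma : ∀ i → i ℤ.* ℤ.+ 1 ℤ.≤ ℤ.+ ℤ.∣ i ∣ ℤ.* ℤ.+ suc d
    lemma (ℤ.+ a)  rewrite ℤP.*-identityʳ (ℤ.+ a) | sym (ℤP.pos-* a (suc d)) = ℤ.+≤+ (ℕP.m≤m*n a (suc d))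
    lemma -[1+ a ] = ℤ.-≤+

  ρ-small : ∀ K {ε} → 0ℚ < ε → Eventually (λ n → K * ρ n ≤ ε)
  ρ-small K {ε} 0<ε = suc m , λ n m<n → bound n m<n
    where
    m = ℤ.∣ ↥ (inv ε * K) ∣
    bound : ∀ n → m ℕ.< n → K * ρ n ≤ ε
    bound n m<n = ℚP.≤-trans (*-monoʳ (ρ-nonNeg n) K≤εn) (ℚP.≤-reflexive
        (trans (ℚP.*-assoc ε (fromℕ n) (ρ n))
            (trans (cong (ε *_) (n*ρ (ℕP.≤-trans (s≤s z≤n) m<n))) (ℚP.*-identityʳ ε))))
      where
      K≤εn : K ≤ ε * fromℕ n
      K≤εn = subst (_≤ ε * fromℕ n) (inv-*-cancel K (pos⇒≢0 0<ε))
        (*-monoˡ (ℚP.<⇒≤ 0<ε) (ℚP.≤-trans (q≤∣↥q∣ (inv ε * K)) (fromℕ-mono (ℕP.<⇒≤ m<n))))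

  -- Convergence with error O(1/n). The rate is kept because the final estimates assert an error one
  -- power of n below the leading term, which a bare limit would not give.
  record Lim (φ : ℕ → ℚ) (c : ℚ) : Set where
    constructor within
    field
      K     : ℚ
      0≤K   : 0ℚ ≤ K
      close : Eventually (λ n → ∣ φ n - c ∣ ≤ K * ρ n)

  lim-cong : ∀ {φ ψ c} → Eventually (λ n → φ n ≡ ψ n) → Lim φ c → Lim ψ c
  lim-cong {c = c} e (within K 0≤K h) = within K 0≤K
      (ev-map₂ (λ n p q → subst (λ x → ∣ x - c ∣ ≤ K * ρ n) p q) e h)

  lim-limit : ∀ {φ c d} → c ≡ d → Lim φ c → Lim φ d
  lim-limit refl l = l

  lim-const : ∀ c → Lim (λ _ → c) c
  lim-const c = within 0ℚ ℚP.≤-refl (ev-const λ n → ℚP.≤-reflexive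
    (trans (cong ∣_∣ (ℚP.+-inverseʳ c)) (sym (ℚP.*-zeroˡ (ρ n)))))

  lim-ρ : Lim ρ 0ℚ
  lim-ρ = within 1ℚ (ℚP.<⇒≤ 0<1) (ev-const λ n → ℚP.≤-reflexive
    (trans (cong ∣_∣ (ℚP.+-identityʳ (ρ n)))
        (trans (ℚP.0≤p⇒∣p∣≡p (ρ-nonNeg n)) (sym (ℚP.*-identityˡ (ρ n))))))

  lim-+ : ∀ {φ ψ c d} → Lim φ c → Lim ψ d → Lim (λ n → φ n + ψ n) (c + d)
  lim-+ {φ} {ψ} {c} {d} (within K 0≤K h) (within L 0≤L h′) = within (K + L) (+-nonNeg 0≤K 0≤L)
      (ev-map₂ (λ n p q → begin
      ∣ φ n + ψ n - (c + d) ∣             ≡⟨ cong ∣_∣ (regroup (φ n) (ψ n) c d) ⟩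
      ∣ (φ n - c) + (ψ n - d) ∣           ≤⟨ ℚP.∣p+q∣≤∣p∣+∣q∣ (φ n - c) (ψ n - d) ⟩
      ∣ φ n - c ∣ + ∣ ψ n - d ∣           ≤⟨ ℚP.+-mono-≤ p q ⟩
      K * ρ n + L * ρ n                   ≡⟨ sym (ℚP.*-distribʳ-+ (ρ n) K L) ⟩
      (K + L) * ρ n                       ∎) h h′)
    where
    open ℚP.≤-Reasoning
    regroup : ∀ a b c d → a + b - (c + d) ≡ (a - c) + (b - d)
    regroup = solve-∀ ℚ-ring

  lim-* : ∀ {φ ψ c d} → Lim φ c → Lim ψ d → Lim (λ n → φ n * ψ n) (c * d)
  lim-* {φ} {ψ} {c} {d} (within K 0≤K h) (within L 0≤L h′) = within (K * (L + ∣ d ∣) + ∣ c ∣ * L) 0≤M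
      (ev-map₂ (λ n p q → begin
      ∣ φ n * ψ n - c * d ∣
        ≡⟨ cong ∣_∣ (regroup (φ n) (ψ n) c d) ⟩
      ∣ (φ n - c) * ((ψ n - d) + d) + c * (ψ n - d) ∣
        ≤⟨ ℚP.∣p+q∣≤∣p∣+∣q∣ ((φ n - c) * ((ψ n - d) + d)) (c * (ψ n - d)) ⟩
      ∣ (φ n - c) * ((ψ n - d) + d) ∣ + ∣ c * (ψ n - d) ∣
        ≡⟨ cong₂ _+_ (ℚP.∣p*q∣≡∣p∣*∣q∣ (φ n - c) ((ψ n - d) + d)) (ℚP.∣p*q∣≡∣p∣*∣q∣ c (ψ n - d)) ⟩
      ∣ φ n - c ∣ * ∣ (ψ n - d) + d ∣ + ∣ c ∣ * ∣ ψ n - d ∣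
        ≤⟨ ℚP.+-mono-≤ (ℚP.≤-trans (*-monoʳ (ℚP.0≤∣p∣ ((ψ n - d) + d)) p)
            (*-monoˡ (*-nonNeg 0≤K (ρ-nonNeg n)) (bounded n q)))
                       (*-monoˡ (ℚP.0≤∣p∣ c) q) ⟩
      K * ρ n * (L + ∣ d ∣) + ∣ c ∣ * (L * ρ n)
        ≡⟨ collect K (ρ n) (L + ∣ d ∣) (∣ c ∣) L ⟩
      (K * (L + ∣ d ∣) + ∣ c ∣ * L) * ρ n ∎) h h′)
    where
    open ℚP.≤-Reasoning
    0≤M : 0ℚ ≤ K * (L + ∣ d ∣) + ∣ c ∣ * L
    0≤M = +-nonNeg (*-nonNeg 0≤K (+-nonNeg 0≤L (ℚP.0≤∣p∣ d))) (*-nonNeg (ℚP.0≤∣p∣ c) 0≤L)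
    regroup : ∀ a b c d → a * b - c * d ≡ (a - c) * ((b - d) + d) + c * (b - d)
    regroup = solve-∀ ℚ-ring
    collect : ∀ k r l c m → k * r * l + c * (m * r) ≡ (k * l + c * m) * r
    collect = solve-∀ ℚ-ring
    bounded : ∀ n → ∣ ψ n - d ∣ ≤ L * ρ n → ∣ (ψ n - d) + d ∣ ≤ L + ∣ d ∣
    bounded n q = ℚP.≤-trans (ℚP.∣p+q∣≤∣p∣+∣q∣ (ψ n - d) d) (ℚP.+-monoˡ-≤ (∣ d ∣)
      (ℚP.≤-trans q (ℚP.≤-trans (*-monoˡ 0≤L (ρ≤1 n)) (ℚP.≤-reflexive (ℚP.*-identityʳ L)))))

  lim-scale : ∀ c {φ d} → Lim φ d → Lim (λ n → c * φ n) (c * d)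
  lim-scale c = lim-* (lim-const c)

  lim-sum : ∀ m {φ : ℕ → ℕ → ℚ} {c : ℕ → ℚ} → (∀ i → i ℕ.< m → Lim (φ i) (c i)) →
    Lim (λ n → ∑[ i < m ] φ i n) (∑< m c)
  lim-sum zero    h = lim-const 0ℚ
  lim-sum (suc m) h = lim-+ (h 0 (s≤s z≤n)) (lim-sum m (λ i i<m → h (suc i) (s≤s i<m)))

  ½*-pos : ∀ {c} → 0ℚ < c → 0ℚ < ½ * c
  ½*-pos = *-pos (ℚP.positive⁻¹ ½)

  lim-lower : ∀ {φ c} → Lim φ c → 0ℚ < c → Eventually (λ n → ½ * c ≤ φ n)
  lim-lower {φ} {c} (within K 0≤K h) 0<c = ev-map₂ (λ n p q → 0≤-⇒≤ (begin
      0ℚ                              ≤⟨ ≤⇒0≤- (ℚP.≤-trans p q) ⟩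
      ½ * c - ∣ φ n - c ∣             ≤⟨ ℚP.+-monoʳ-≤ (½ * c)
          (ℚP.neg-antimono-≤ (ℚP.≤-trans (≤∣∣ (- (φ n - c))) (ℚP.≤-reflexive (ℚP.∣-p∣≡∣p∣ (φ n - c))))) ⟩
      ½ * c - - (φ n - c)             ≡⟨ cong (λ z → ½ * c - - (φ n - z)) (halves c) ⟩
      ½ * c - - (φ n - (½ * c + ½ * c)) ≡⟨ finish (½ * c) (φ n) ⟩
      φ n - ½ * c                     ∎)) h (ρ-small K (½*-pos 0<c))
    where
    open ℚP.≤-Reasoning
    ≤∣∣ : ∀ q → q ≤ ∣ q ∣
    ≤∣∣ q with ℚP.≤-total 0ℚ q
    ... | inj₁ 0≤q = ℚP.≤-reflexive (sym (ℚP.0≤p⇒∣p∣≡p 0≤q))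
    ... | inj₂ q≤0 = ℚP.≤-trans q≤0 (ℚP.0≤∣p∣ q)
    halves : ∀ c → c ≡ ½ * c + ½ * c
    halves c = trans (sym (ℚP.*-identityˡ c)) (ℚP.*-distribʳ-+ c ½ ½)
    finish : ∀ h f → h - - (f - (h + h)) ≡ f - h
    finish = solve-∀ ℚ-ring

  lim-pos : ∀ {φ c} → Lim φ c → 0ℚ < c → Eventually (λ n → 0ℚ < φ n)
  lim-pos l 0<c = ev-map (λ n → ℚP.<-≤-trans (½*-pos 0<c)) (lim-lower l 0<c)

  -- The quotient is described by the equation `φ n * ψ n ≡ χ n`. From φ(ψ - e) = (χ - c e) - e(φ -
  -- c) the error of `ψ` inherits the rate, since `φ` is eventually at least `½ * c`.
  lim-quotient : ∀ {φ ψ χ c e} → Eventually (λ n → φ n * ψ n ≡ χ n) →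
    Lim φ c → 0ℚ < c → Lim χ (c * e) → Lim ψ e
  lim-quotient {φ} {ψ} {χ} {c} {e} φψ≡χ lφ@(within K 0≤K hφ) 0<c (within L 0≤L hχ) =
    within M (*-nonNeg (ℚP.<⇒≤ (inv-pos 0<h)) (+-nonNeg 0≤L (*-nonNeg (ℚP.0≤∣p∣ e) 0≤K)))
    (ev-map₂ (λ n eq (p , q , r) → bound n eq p q r) φψ≡χ
      (ev-map₂ (λ _ → _,_) (lim-lower lφ 0<c) (ev-map₂ (λ _ → _,_) hφ hχ)))
    where
    open ℚP.≤-Reasoning
    h = ½ * c
    0<h = ½*-pos 0<c
    M = inv h * (L + ∣ e ∣ * K)
    split : ∀ f p c e → f * (p - e) ≡ (f * p - c * e) + - e * (f - c)
    split = solve-∀ ℚ-ring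
    collect : ∀ l r e k → l * r + e * (k * r) ≡ (l + e * k) * r
    collect = solve-∀ ℚ-ring
    bound : ∀ n → φ n * ψ n ≡ χ n → h ≤ φ n → ∣ φ n - c ∣ ≤ K * ρ n → ∣ χ n - c * e ∣ ≤ L * ρ n → ∣ ψ n -
        e ∣ ≤ M * ρ n
    bound n eq h≤φ p q = begin
      ∣ ψ n - e ∣
        ≡⟨ sym (trans (sym (ℚP.*-assoc (inv h) h (∣ ψ n - e ∣)))
            (trans (cong (_* ∣ ψ n - e ∣) (trans (ℚP.*-comm (inv h) h) (*-inv (pos⇒≢0 0<h))))
            (ℚP.*-identityˡ (∣ ψ n - e ∣)))) ⟩
      inv h * (h * ∣ ψ n - e ∣)
        ≤⟨ *-monoˡ (ℚP.<⇒≤ (inv-pos 0<h)) (begin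
          h * ∣ ψ n - e ∣                     ≤⟨ *-monoʳ (ℚP.0≤∣p∣ (ψ n - e)) h≤φ ⟩
          φ n * ∣ ψ n - e ∣                   ≡⟨ cong (_* ∣ ψ n - e ∣)
              (sym (ℚP.0≤p⇒∣p∣≡p (ℚP.≤-trans (ℚP.<⇒≤ 0<h) h≤φ))) ⟩
          ∣ φ n ∣ * ∣ ψ n - e ∣               ≡⟨ sym (ℚP.∣p*q∣≡∣p∣*∣q∣ (φ n) (ψ n - e)) ⟩
          ∣ φ n * (ψ n - e) ∣                 ≡⟨
              cong ∣_∣ (trans (split (φ n) (ψ n) c e) (cong (λ z → z - c * e + - e * (φ n - c)) eq)) ⟩
          ∣ (χ n - c * e) + - e * (φ n - c) ∣ ≤⟨ ℚP.∣p+q∣≤∣p∣+∣q∣ (χ n - c * e) (- e * (φ n - c)) ⟩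
          ∣ χ n - c * e ∣ + ∣ - e * (φ n - c) ∣ ≡⟨ cong (∣ χ n - c * e ∣ +_)
              (trans (ℚP.∣p*q∣≡∣p∣*∣q∣ (- e) (φ n - c)) (cong (_* ∣ φ n - c ∣) (ℚP.∣-p∣≡∣p∣ e))) ⟩
          ∣ χ n - c * e ∣ + ∣ e ∣ * ∣ φ n - c ∣ ≤⟨ ℚP.+-mono-≤ q (*-monoˡ (ℚP.0≤∣p∣ e) p) ⟩
          L * ρ n + ∣ e ∣ * (K * ρ n)         ≡⟨ collect L (ρ n) (∣ e ∣) K ⟩
          (L + ∣ e ∣ * K) * ρ n               ∎) ⟩
      inv h * ((L + ∣ e ∣ * K) * ρ n)
        ≡⟨ sym (ℚP.*-assoc (inv h) (L + ∣ e ∣ * K) (ρ n)) ⟩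
      M * ρ n ∎

  pow : ℚ → ℕ → ℚ
  pow q zero    = 1ℚ
  pow q (suc d) = q * pow q d

  pow-+ : ∀ q a b → pow q (a ℕ.+ b) ≡ pow q a * pow q b
  pow-+ q zero    b = sym (ℚP.*-identityˡ (pow q b))
  pow-+ q (suc a) b = trans (cong (q *_) (pow-+ q a b)) (sym (ℚP.*-assoc q (pow q a) (pow q b)))

  pow-pos : ∀ {q} d → 0ℚ < q → 0ℚ < pow q d
  pow-pos zero    _   = 0<1
  pow-pos (suc d) 0<q = *-pos 0<q (pow-pos d 0<q)

  lim-pow : ∀ d → Lim (λ n → pow (ρ n) d) (𝟙 d 0)
  lim-pow zero    = lim-const 1ℚ
  lim-pow (suc d) = lim-limit (ℚP.*-zeroˡ (𝟙 d 0)) (lim-* lim-ρ (lim-pow d))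

  infix 4 _~_·n^_

  -- f n = c nᵈ + O(nᵈ⁻¹).
  record _~_·n^_ (f : ℕ → ℚ) (c : ℚ) (d : ℕ) : Set where
    constructor asymp
    field normalised : Lim (λ n → f n * pow (ρ n) d) c

  open _~_·n^_ public

  ~-limit : ∀ {f c d a} → c ≡ d → f ~ c ·n^ a → f ~ d ·n^ a
  ~-limit refl l = l

  ~-cong : ∀ {f g c a} → Eventually (λ n → f n ≡ g n) → f ~ c ·n^ a → g ~ c ·n^ a
  ~-cong {a = a} e (asymp l) = asymp (lim-cong (ev-map (λ n → cong (_* pow (ρ n) a)) e) l)

  ~-zero : ∀ {a} → (λ _ → 0ℚ) ~ 0ℚ ·n^ a
  ~-zero {a} = asymp (lim-cong (ev-const λ n → sym (ℚP.*-zeroˡ (pow (ρ n) a))) (lim-const 0ℚ))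

  -- Terms of lower order enter a sum of higher order with coefficient 0.
  ~-raise : ∀ {f c a b} → a ℕ.< b → f ~ c ·n^ a → f ~ 0ℚ ·n^ b
  ~-raise {f} {c} {a} {b} a<b (asymp l) with ℕP.m≤n⇒∃[o]m+o≡n a<b
  ... | d , refl = asymp (lim-cong (ev-const λ n → trans
      (ℚP.*-assoc (f n) (pow (ρ n) a) (pow (ρ n) (suc d)))
        (cong (f n *_) (trans (sym (pow-+ (ρ n) a (suc d))) (cong (pow (ρ n)) (ℕP.+-suc a d)))))
      (lim-limit (ℚP.*-zeroʳ c) (lim-* l (lim-pow (suc d)))))

  ~-scale : ∀ e {f c a} → f ~ c ·n^ a → (λ n → e * f n) ~ e * c ·n^ a
  ~-scale e {f} {a = a} (asymp l) = asymp
      (lim-cong (ev-const λ n → sym (ℚP.*-assoc e (f n) (pow (ρ n) a))) (lim-scale e l))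

  ~-+ : ∀ {f g c d a} → f ~ c ·n^ a → g ~ d ·n^ a → (λ n → f n + g n) ~ c + d ·n^ a
  ~-+ {f} {g} {a = a} (asymp l) (asymp l′) = asymp
      (lim-cong (ev-const λ n → sym (ℚP.*-distribʳ-+ (pow (ρ n) a) (f n) (g n))) (lim-+ l l′))

  ~-sum : ∀ m {f : ℕ → ℕ → ℚ} {c : ℕ → ℚ} {a} → (∀ i → i ℕ.< m → f i ~ c i ·n^ a) →
    (λ n → ∑[ i < m ] f i n) ~ ∑< m c ·n^ a
  ~-sum m {f} {a = a} h = asymp (lim-cong (ev-const λ n → sym (∑<-distribʳ m (λ i → f i n) (pow (ρ n) a)))
    (lim-sum m (λ i i<m → normalised (h i i<m))))

  ~-pos : ∀ {f c a} → f ~ c ·n^ a → 0ℚ < c → Eventually (λ n → 0ℚ < f n)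
  ~-pos {f} {a = a} (asymp l) 0<c = ev-map₂ (λ n 0<n 0<fρ → ℚP.*-cancelʳ-<-nonNeg (pow (ρ n) a)
      {{ℚ.nonNegative (ℚP.<⇒≤ (pow-pos a (ρ-pos 0<n)))}}
          (subst (_< f n * pow (ρ n) a) (sym (ℚP.*-zeroˡ (pow (ρ n) a))) 0<fρ))
    (ev-≥ 1) (lim-pos l 0<c)

  ~-quotient : ∀ {f g h c e a b} → Eventually (λ n → f n * g n ≡ h n) →
    f ~ c ·n^ a → 0ℚ < c → h ~ c * e ·n^ (a ℕ.+ b) → g ~ e ·n^ b
  ~-quotient {f} {g} {h} {a = a} {b} fg≡h (asymp l) 0<c (asymp l′) = asymp (lim-quotient
    (ev-map (λ n eq → trans (regroup (f n) (pow (ρ n) a) (g n) (pow (ρ n) b))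
        (cong₂ _*_ eq (sym (pow-+ (ρ n) a b)))) fg≡h) l 0<c l′)
    where
    regroup : ∀ a b c d → (a * b) * (c * d) ≡ (a * c) * (b * d)
    regroup = solve-∀ ℚ-ring

  invfact : ℕ → ℚ
  invfact zero    = 1ℚ
  invfact (suc d) = inv (fromℕ (suc d)) * invfact d

  invfact-pos : ∀ d → 0ℚ < invfact d
  invfact-pos zero    = 0<1
  invfact-pos (suc d) = *-pos (inv-pos (fromℕ-pos {suc d} (s≤s z≤n))) (invfact-pos d)

  !*invfact : ∀ d → fromℕ (d !) * invfact d ≡ 1ℚ
  !*invfact zero    = refl
  !*invfact (suc d) = trans (cong (_* (inv (fromℕ (suc d)) * invfact d)) (fromℕ-* (suc d) (d !)))
    (trans (regroup (fromℕ (suc d)) (fromℕ (d !)) (inv (fromℕ (suc d))) (invfact d))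
      (trans (cong₂ _*_ (*-inv (fromℕ≢0 {suc d} (s≤s z≤n))) (!*invfact d)) (ℚP.*-identityˡ 1ℚ)))
    where
    regroup : ∀ a b c d → a * b * (c * d) ≡ (a * c) * (b * d)
    regroup = solve-∀ ℚ-ring

  -- Induction by `binom-next`: passing from `d` to `suc d` multiplies by (n - a - d)/(d + 1), and
  -- (n - a - d) `ρ n` tends to 1 with error O(1/n).
  binom~ : ∀ a d → (λ n → binom (n ∸ a) d) ~ invfact d ·n^ d
  binom~ a zero    = asymp (lim-cong (ev-const λ n → sym
      (trans (ℚP.*-identityʳ (binom (n ∸ a) 0)) (binom-zero (n ∸ a)))) (lim-const 1ℚ))
  binom~ a (suc d) = asymp (lim-cong (ev-map₂ step (ev-≥ 1) (ev-≥ a))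
      (lim-limit (simplify (inv (fromℕ (suc d))) (invfact d) (fromℕ a + fromℕ d))
        (lim-scale (inv (fromℕ (suc d))) (lim-*
            (lim-+ (lim-const 1ℚ) (lim-scale (- (fromℕ a + fromℕ d)) lim-ρ)) (normalised (binom~ a d))))))
    where
    simplify : ∀ i f s → i * ((1ℚ + - s * 0ℚ) * f) ≡ i * f
    simplify = solve-∀ ℚ-ring
    step : ∀ n → 1 ℕ.≤ n → a ℕ.≤ n →
      inv (fromℕ (suc d)) * ((1ℚ + - (fromℕ a + fromℕ d) * ρ n) * (binom (n ∸ a) d * pow (ρ n) d)) ≡
      binom (n ∸ a) (suc d) * (ρ n * pow (ρ n) d)
    step n 1≤n a≤n = *-cancelˡ S (fromℕ≢0 {suc d} (s≤s z≤n)) (begin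
      S * (inv S * ((1ℚ + - (fromℕ a + fromℕ d) * ρ n) * (b * P)))
        ≡⟨ inv-*-cancel _ (fromℕ≢0 {suc d} (s≤s z≤n)) ⟩
      (1ℚ + - (fromℕ a + fromℕ d) * ρ n) * (b * P)
        ≡⟨ cong (λ z → (z + - (fromℕ a + fromℕ d) * ρ n) * (b * P)) (sym (n*ρ 1≤n)) ⟩
      (fromℕ n * ρ n + - (fromℕ a + fromℕ d) * ρ n) * (b * P)
        ≡⟨ regroup (fromℕ n) (ρ n) (fromℕ a) (fromℕ d) b P ⟩
      (fromℕ n - fromℕ a - fromℕ d) * b * (ρ n * P)
        ≡⟨ cong (λ z → (z - fromℕ d) * b * (ρ n * P)) (sym (fromℕ-∸ a≤n)) ⟩
      (fromℕ (n ∸ a) - fromℕ d) * b * (ρ n * P)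
        ≡⟨ cong (_* (ρ n * P)) (sym (binom-next (n ∸ a) d)) ⟩
      S * binom (n ∸ a) (suc d) * (ρ n * P)
        ≡⟨ ℚP.*-assoc S (binom (n ∸ a) (suc d)) (ρ n * P) ⟩
      S * (binom (n ∸ a) (suc d) * (ρ n * P)) ∎)
      where
      open ≡-Reasoning
      S = fromℕ (suc d)
      b = binom (n ∸ a) d
      P = pow (ρ n) d
      regroup : ∀ n r a d b p → (n * r + - (a + d) * r) * (b * p) ≡ (n - a - d) * b * (r * p)
      regroup = solve-∀ ℚ-ring

-- Signs and growth of the eigenvalues for large n.

module Spectrum (k ℓ : ℕ) (ℓ<k : ℓ ℕ.< k) where
  open Rational
  open Binomial
  open Asymptotics
  open import Data.Rational.Base using (_+_; _*_; _-_; -_; _≤_; _<_)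

  weight~ : ∀ s j → (λ n → weight n k s j) ~ binom⊖ (k ∸ j) s j * invfact (k ∸ s) ·n^ (k ∸ s)
  weight~ s j = ~-cong (ev-const λ n → cong (λ m → binom⊖ (k ∸ j) s j * binom m (k ∸ s))
      (sym (ℕP.∸-+-assoc n j s)))
    (~-scale (binom⊖ (k ∸ j) s j) (binom~ (j ℕ.+ s) (k ∸ s)))

  weight~0 : ∀ {s j p} → k ∸ s ℕ.< p → (λ n → weight n k s j) ~ 0ℚ ·n^ p
  weight~0 {s} {j} lt = ~-raise lt (weight~ s j)

  -- The summand of index `s` has order at most n^(k - s), so the first index that need not vanish
  -- dominates. Below `s₀` either `binom s ℓ` or the weight is zero. It is applied with `s₀` the
  -- maximum of `ℓ` and `j`.
  spectrum~ : ∀ j {s₀} → s₀ ℕ.≤ k → (∀ s → s ℕ.< s₀ → s ℕ.< ℓ ⊎ s ℕ.< j) →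
    (λ n → spectrum n k ℓ j) ~ sgn (ℓ ℕ.+ s₀) * binom s₀ ℓ * (binom⊖ (k ∸ j) s₀ j * invfact (k ∸ s₀)) ·n^
        (k ∸ s₀)
  spectrum~ j {s₀} s₀≤k low = ~-limit (∑<-𝟙 (suc k) c (s≤s s₀≤k))
    (~-sum (suc k) {f = λ s n → σ s * weight n k s j} {c = λ s → 𝟙 s s₀ * c s}
        (λ s s≤k → term s (ℕP.≤-pred s≤k) (ℕP.<-cmp s s₀)))
    where
    σ c : ℕ → ℚ
    σ s = sgn (ℓ ℕ.+ s) * binom s ℓ
    c s = σ s * (binom⊖ (k ∸ j) s j * invfact (k ∸ s))
    vanish : ∀ s n → s ℕ.< ℓ ⊎ s ℕ.< j → σ s * weight n k s j ≡ 0ℚ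
    vanish s n (inj₁ s<ℓ) = trans (cong (λ z → sgn (ℓ ℕ.+ s) * z * weight n k s j) (binom-> s<ℓ))
        (lemma (sgn (ℓ ℕ.+ s)) (weight n k s j))
      where
      lemma : ∀ a b → a * 0ℚ * b ≡ 0ℚ
      lemma = solve-∀ ℚ-ring
    vanish s n (inj₂ s<j) = trans (cong (λ z → σ s * (z * binom (n ∸ j ∸ s) (k ∸ s)))
        (binom⊖-< (k ∸ j) s<j)) (lemma (σ s) (binom (n ∸ j ∸ s) (k ∸ s)))
      where
      lemma : ∀ a b → a * (0ℚ * b) ≡ 0ℚ
      lemma = solve-∀ ℚ-ring
    term : ∀ s → s ℕ.≤ k → _ → (λ n → σ s * weight n k s j) ~ 𝟙 s s₀ * c s ·n^ (k ∸ s₀)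
    term s s≤k (tri< s<s₀ s≢s₀ _) = ~-limit (sym (trans (cong (_* c s) (𝟙-≢ s≢s₀)) (ℚP.*-zeroˡ (c s))))
      (~-cong (ev-const λ n → sym (vanish s n (low s s<s₀))) ~-zero)
    term s s≤k (tri≈ _ refl _) = ~-limit (sym (trans (cong (_* c s) (𝟙-refl s)) (ℚP.*-identityˡ (c s))))
        (~-scale (σ s) (weight~ s j))
    term s s≤k (tri> _ s≢s₀ s₀<s) = ~-limit
        (trans (ℚP.*-zeroʳ (σ s)) (sym (trans (cong (_* c s) (𝟙-≢ s≢s₀)) (ℚP.*-zeroˡ (c s)))))
      (~-scale (σ s) (weight~0 {s} {j} (ℕP.∸-monoʳ-< s₀<s s≤k)))

  spectrum-low : ∀ {j} → j ℕ.≤ ℓ → (λ n → spectrum n k ℓ j) ~ binom⊖ (k ∸ j) ℓ j * invfact (k ∸ ℓ) ·n^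
      (k ∸ ℓ)
  spectrum-low {j} j≤ℓ = ~-limit
    (trans (cong₂ (λ u v → u * v * c) (trans (sgn-+ ℓ ℓ) (sgn-square ℓ)) (binom-self ℓ)) (unit c))
    (spectrum~ j (ℕP.<⇒≤ ℓ<k) (λ s → inj₁))
    where
    c = binom⊖ (k ∸ j) ℓ j * invfact (k ∸ ℓ)
    unit : ∀ c → 1ℚ * 1ℚ * c ≡ c
    unit = solve-∀ ℚ-ring

  spectrum-low-pos : ∀ {j} → j ℕ.≤ ℓ → Eventually (λ n → 0ℚ < spectrum n k ℓ j)
  spectrum-low-pos {j} j≤ℓ = ~-pos (spectrum-low j≤ℓ) (*-pos pos (invfact-pos (k ∸ ℓ)))
    where
    pos : 0ℚ < binom⊖ (k ∸ j) ℓ j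
    pos = subst (0ℚ <_) (sym (trans (cong (λ s → binom⊖ (k ∸ j) s j) (sym (ℕP.m+[n∸m]≡n j≤ℓ)))
        (binom⊖-+ (k ∸ j) j (ℓ ∸ j))))
      (binom-pos′ (ℕP.∸-monoˡ-≤ j (ℕP.<⇒≤ ℓ<k)))

  -- The least eigenvalue, with its sign changed.
  den : ℕ → ℚ
  den n = - spectrum n k ℓ (suc ℓ)

  -- The dominating index is `suc ℓ`: the sign there is that of the odd number ℓ + (ℓ + 1), and
  -- `binom (suc ℓ) ℓ` is `fromℕ (suc ℓ)`.
  den~ : den ~ fromℕ (suc ℓ) * invfact (k ∸ suc ℓ) ·n^ (k ∸ suc ℓ)
  den~ = ~-cong (ev-const λ n → negate (spectrum n k ℓ (suc ℓ)))
    (~-limit limit (~-scale (- 1ℚ) (spectrum~ (suc ℓ) ℓ<k (λ s → inj₂))))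
    where
    negate : ∀ a → - 1ℚ * a ≡ - a
    negate = solve-∀ ℚ-ring
    f = invfact (k ∸ suc ℓ)
    limit : - 1ℚ * (sgn (ℓ ℕ.+ suc ℓ) * binom (suc ℓ) ℓ * (binom⊖ (k ∸ suc ℓ) (suc ℓ) (suc ℓ) * f)) ≡ fromℕ
        (suc ℓ) * f
    limit = trans (cong₂ (λ u v → - 1ℚ * (u * binom (suc ℓ) ℓ * (v * f)))
        (trans (cong sgn (ℕP.+-suc ℓ ℓ)) (cong -_ (trans (sgn-+ ℓ ℓ) (sgn-square ℓ))))
        (trans (trans (cong (λ s → binom⊖ (k ∸ suc ℓ) s (suc ℓ)) (sym (ℕP.+-identityʳ (suc ℓ))))
            (binom⊖-+ (k ∸ suc ℓ) (suc ℓ) 0)) (binom-zero (k ∸ suc ℓ))))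
      (trans (lemma (binom (suc ℓ) ℓ) f) (cong (_* f) (binom-suc-self ℓ)))
      where
      lemma : ∀ b f → - 1ℚ * (- 1ℚ * b * (1ℚ * f)) ≡ b * f
      lemma = solve-∀ ℚ-ring
      binom-suc-self : ∀ ℓ → binom (suc ℓ) ℓ ≡ fromℕ (suc ℓ)
      binom-suc-self zero    = binom-zero 1
      binom-suc-self (suc ℓ) = trans (binom-pascal (suc ℓ) ℓ)
          (trans (cong₂ _+_ (binom-suc-self ℓ) (binom-self (suc ℓ)))
        (trans (ℚP.+-comm (fromℕ (suc ℓ)) 1ℚ) (sym (fromℕ-suc (suc ℓ)))))

  den-limit-pos : 0ℚ < fromℕ (suc ℓ) * invfact (k ∸ suc ℓ)
  den-limit-pos = *-pos (fromℕ-pos {suc ℓ} (s≤s z≤n)) (invfact-pos (k ∸ suc ℓ))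

  den-pos : Eventually (λ n → 0ℚ < den n)
  den-pos = ~-pos den~ den-limit-pos

  -- Beyond `suc ℓ` the signs of the eigenvalues do not matter: they are of smaller order than
  -- `den`.
  den+spectrum-high : ∀ {j} → suc ℓ ℕ.< j → j ℕ.≤ k → Eventually (λ n → 0ℚ < den n + spectrum n k ℓ j)
  den+spectrum-high {j} ℓ+1<j j≤k = ~-pos (~-+ den~
      (~-raise (ℕP.∸-monoʳ-< ℓ+1<j j≤k) (spectrum~ j j≤k (λ s → inj₂))))
    (subst (0ℚ <_) (sym (ℚP.+-identityʳ (fromℕ (suc ℓ) * invfact (k ∸ suc ℓ)))) den-limit-pos)

  den+spectrum-nonNeg : Eventually (λ n → ∀ j → j ℕ.< suc k → 0ℚ ≤ den n + spectrum n k ℓ j)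
  den+spectrum-nonNeg = ev-all (suc k) (λ j j≤k → each j (ℕP.≤-pred j≤k) (ℕP.<-cmp j (suc ℓ)))
    where
    each : ∀ j → j ℕ.≤ k → _ → Eventually (λ n → 0ℚ ≤ den n + spectrum n k ℓ j)
    each j j≤k (tri< j≤ℓ _ _)  = ev-map₂ (λ n p q → +-nonNeg (ℚP.<⇒≤ p) (ℚP.<⇒≤ q)) den-pos
        (spectrum-low-pos (ℕP.≤-pred j≤ℓ))
    each j j≤k (tri≈ _ refl _) = ev-const λ n → ℚP.≤-reflexive
        (sym (ℚP.+-inverseˡ (spectrum n k ℓ (suc ℓ))))
    each j j≤k (tri> _ _ ℓ+1<j) = ev-map (λ n → ℚP.<⇒≤) (den+spectrum-high ℓ+1<j j≤k)

  -- The left side has order at most n^(k - s) and the right side exactly n^(k - j). This is the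
  -- growth comparison behind the strict positivity of the diagonal of an idempotent.
  weight-small : ∀ {s j} → j ℕ.< s → s ℕ.≤ k → ∀ {ε} → 0ℚ < ε → Eventually
      (λ n → weight n k s j ≤ ε * weight n k j j)
  weight-small {s} {j} j<s s≤k {ε} 0<ε = ev-map
      (λ n p → 0≤-⇒≤ (ℚP.≤-trans (ℚP.<⇒≤ p) (ℚP.≤-reflexive (minus (ε * weight n k j j) (weight n k s j)))))
    (~-pos (~-+ (~-scale ε (weight~ j j)) (~-scale (- 1ℚ) (weight~0 {s} {j} (ℕP.∸-monoʳ-< j<s s≤k))))
      (subst (0ℚ <_) (sym (limit ε (binom⊖ (k ∸ j) j j) (invfact (k ∸ j))))
          (*-pos 0<ε (*-pos pos (invfact-pos (k ∸ j))))))
    where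
    minus : ∀ a b → a + - 1ℚ * b ≡ a - b
    minus = solve-∀ ℚ-ring
    limit : ∀ e b f → e * (b * f) + - 1ℚ * 0ℚ ≡ e * (b * f)
    limit = solve-∀ ℚ-ring
    pos : 0ℚ < binom⊖ (k ∸ j) j j
    pos = subst (0ℚ <_) (sym (trans (cong (λ s → binom⊖ (k ∸ j) s j) (sym (ℕP.+-identityʳ j)))
        (binom⊖-+ (k ∸ j) j 0))) (binom-pos′ z≤n)

-- Weak duality for real matrices given by rational approximations.

module SemidefiniteDuality where
  open Rational
  open Asymptotics using (ev-const; ev-map; ev-map₂)
  open import Data.Rational.Base using (_+_; _*_; _-_; -_; _≤_; _<_)

  -- `Null` and `NN` say that a sequence of approximations represents 0, or a nonnegative number.
  -- They apply to any rational sequence, so the summands of an identity can be treated separately.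
  record Null (p : ℕ → ℚ) : Set where
    constructor null
    field small : ∀ ε → 0ℚ < ε → Eventually λ i → ℚ.∣ p i ∣ ≤ ε

  record NN (p : ℕ → ℚ) : Set where
    constructor nn
    field above : ∀ ε → 0ℚ < ε → Eventually λ i → - ε ≤ p i

  ½+½ : ∀ ε → ℚ.½ * ε + ℚ.½ * ε ≡ ε
  ½+½ ε = trans (sym (ℚP.*-distribʳ-+ ε ℚ.½ ℚ.½)) (ℚP.*-identityˡ ε)

  0<½* : ∀ {ε} → 0ℚ < ε → 0ℚ < ℚ.½ * ε
  0<½* = *-pos (ℚP.positive⁻¹ ℚ.½)

  -- Dividing by `1ℚ + c` instead of `c` covers `c = 0` as well.
  shrink : ∀ {c ε} → 0ℚ ≤ c → 0ℚ < ε → c * (inv (1ℚ + c) * ε) ≤ ε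
  shrink {c} {ε} 0≤c 0<ε = ℚP.≤-trans
    (*-monoʳ (*-nonNeg (ℚP.<⇒≤ (inv-pos 0<1+c)) (ℚP.<⇒≤ 0<ε)) c≤1+c)
    (ℚP.≤-reflexive (inv-*-cancel ε (pos⇒≢0 0<1+c)))
    where
    0<1+c : 0ℚ < 1ℚ + c
    0<1+c = ℚP.+-mono-<-≤ 0<1 0≤c
    c≤1+c : c ≤ 1ℚ + c
    c≤1+c = subst (_≤ 1ℚ + c) (ℚP.+-identityˡ c) (ℚP.+-monoˡ-≤ c (ℚP.<⇒≤ 0<1))

  shrunk-pos : ∀ {c ε} → 0ℚ ≤ c → 0ℚ < ε → 0ℚ < inv (1ℚ + c) * ε
  shrunk-pos 0≤c 0<ε = *-pos (inv-pos (ℚP.+-mono-<-≤ 0<1 0≤c)) 0<ε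

  null-+ : ∀ {p q} → Null p → Null q → Null (λ i → p i + q i)
  null-+ {p} {q} (null h) (null h′) = null λ ε 0<ε → ev-map₂
      (λ i a b → ℚP.≤-trans (ℚP.∣p+q∣≤∣p∣+∣q∣ (p i) (q i))
      (ℚP.≤-trans (ℚP.+-mono-≤ a b) (ℚP.≤-reflexive (½+½ ε))))
    (h (ℚ.½ * ε) (0<½* 0<ε)) (h′ (ℚ.½ * ε) (0<½* 0<ε))

  null-zero : ∀ {p} → (∀ i → p i ≡ 0ℚ) → Null p
  null-zero e = null λ ε 0<ε → ev-const λ i → ℚP.≤-trans (ℚP.≤-reflexive (cong ℚ.∣_∣ (e i))) (ℚP.<⇒≤ 0<ε)

  null-sum : ∀ {m} {p : Fin m → ℕ → ℚ} → (∀ x → Null (p x)) → Null (λ i → sum (λ x → p x i))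
  null-sum {zero}  h = null-zero (λ _ → refl)
  null-sum {suc m} h = null-+ (h Fin.zero) (null-sum (λ x → h (Fin.suc x)))

  null-scale : ∀ c {p} → Null p → Null (λ i → c * p i)
  null-scale c {p} (null h) = null λ ε 0<ε → ev-map
    (λ i a → ℚP.≤-trans (ℚP.≤-reflexive (ℚP.∣p*q∣≡∣p∣*∣q∣ c (p i)))
      (ℚP.≤-trans (*-monoˡ (ℚP.0≤∣p∣ c) a) (shrink (ℚP.0≤∣p∣ c) 0<ε)))
    (h _ (shrunk-pos (ℚP.0≤∣p∣ c) 0<ε))

  null⇒nn : ∀ {p} → Null p → NN p
  null⇒nn {p} (null h) = nn λ ε 0<ε → ev-map (λ i a → ℚP.≤-trans (ℚP.neg-antimono-≤ a) (-∣q∣≤q (p i)))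
      (h ε 0<ε)
    where
    neg-neg : ∀ q → - - q ≡ q
    neg-neg = solve-∀ ℚ-ring
    -∣q∣≤q : ∀ q → - ℚ.∣ q ∣ ≤ q
    -∣q∣≤q q with ℚP.≤-total 0ℚ q
    ... | inj₁ 0≤q = ℚP.≤-trans (ℚP.neg-antimono-≤ (ℚP.0≤∣p∣ q)) 0≤q
    ... | inj₂ q≤0 = ℚP.≤-reflexive (trans
        (cong -_ (trans (sym (ℚP.∣-p∣≡∣p∣ q)) (ℚP.0≤p⇒∣p∣≡p (ℚP.neg-antimono-≤ q≤0)))) (neg-neg q))

  nn-+ : ∀ {p q} → NN p → NN q → NN (λ i → p i + q i)
  nn-+ (nn h) (nn h′) = nn λ ε 0<ε → ev-map₂ (λ i a b → ℚP.≤-trans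
      (ℚP.≤-reflexive (trans (cong -_ (sym (½+½ ε))) (ℚP.neg-distrib-+ (ℚ.½ * ε) (ℚ.½ * ε))))
          (ℚP.+-mono-≤ a b))
    (h (ℚ.½ * ε) (0<½* 0<ε)) (h′ (ℚ.½ * ε) (0<½* 0<ε))

  nn-sum : ∀ {m} {p : Fin m → ℕ → ℚ} → (∀ x → NN (p x)) → NN (λ i → sum (λ x → p x i))
  nn-sum {zero}  h = null⇒nn (null-zero (λ _ → refl))
  nn-sum {suc m} h = nn-+ (h Fin.zero) (nn-sum (λ x → h (Fin.suc x)))

  nn-scale : ∀ {c} → 0ℚ ≤ c → ∀ {p} → NN p → NN (λ i → c * p i)
  nn-scale {c} 0≤c (nn h) = nn λ ε 0<ε → ev-map
    (λ i a → ℚP.≤-trans (ℚP.neg-antimono-≤ (shrink 0≤c 0<ε))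
      (ℚP.≤-trans (ℚP.≤-reflexive (ℚP.neg-distribʳ-* c (inv (1ℚ + c) * ε))) (*-monoˡ 0≤c a)))
    (h _ (shrunk-pos 0≤c 0<ε))

  nn-cong : ∀ {p q} → (∀ i → p i ≡ q i) → NN p → NN q
  nn-cong e (nn h) = nn λ ε 0<ε → ev-map (λ i → subst (- ε ≤_) (e i)) (h ε 0<ε)

  sumℝ : ∀ {m} → (Fin m → ℝ) → ℝ
  sumℝ = RawMonoidDefs.sum Defs.ℝ-+-rawMonoid

  seq-sum : ∀ {m} (f : Fin m → ℝ) i → seq (sumℝ f) i ≡ sum (λ x → seq (f x) i)
  seq-sum {zero}  f i = refl
  seq-sum {suc m} f i = cong (seq (f Fin.zero) i +_) (seq-sum (f ∘ Fin.suc) i)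

  ≡⇒≈ : ∀ {x y} → (∀ i → seq x i ≡ seq y i) → x Defs.≈ y
  ≡⇒≈ {x} {y} e ε 0<ε = ev-const λ i → ℚP.≤-trans
    (ℚP.≤-reflexive (cong ℚ.∣_∣ (trans (cong (_- seq y i) (e i)) (ℚP.+-inverseʳ (seq y i))))) (ℚP.<⇒≤ 0<ε)

  ≈0⇒null : ∀ {x} → x Defs.≈ Defs.0ℝ → Null (seq x)
  ≈0⇒null {x} h = null λ ε 0<ε → ev-map (λ i → subst (λ q → ℚ.∣ q ∣ ≤ ε) (ℚP.+-identityʳ (seq x i)))
      (h ε 0<ε)

  0≤⇒nn : ∀ {x} → Defs.0ℝ Defs.≤ x → NN (seq x)
  0≤⇒nn {x} h = nn λ ε 0<ε → ev-map (λ i a → subst₂ _≤_ (ℚP.+-identityˡ (- ε)) (cancel (seq x i) ε)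
      (ℚP.+-monoˡ-≤ (- ε) a)) (h ε 0<ε)
    where
    cancel : ∀ q e → q + e - e ≡ q
    cancel = solve-∀ ℚ-ring

  nn⇒≤ : ∀ {x t} → NN (λ i → t - seq x i) → x Defs.≤ fromℚ t
  nn⇒≤ {x} {t} (nn h) ε 0<ε = ev-map (λ i a → subst₂ _≤_ (l (seq x i) ε) (r t (seq x i) ε)
      (ℚP.+-monoˡ-≤ (seq x i + ε) a)) (h ε 0<ε)
    where
    l : ∀ x e → - e + (x + e) ≡ x
    l = solve-∀ ℚ-ring
    r : ∀ t x e → t - x + (x + e) ≡ t + e
    r = solve-∀ ℚ-ring

  sum-const : ∀ m c → sum {m} (λ _ → c) ≡ fromℕ m * c
  sum-const zero    c = sym (ℚP.*-zeroˡ c)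
  sum-const (suc m) c = trans (cong (c +_) (sum-const m c))
      (trans (collect c (fromℕ m)) (cong (_* c) (sym (fromℕ-suc m))))
    where
    collect : ∀ c m → c + m * c ≡ (1ℚ + m) * c
    collect = solve-∀ ℚ-ring

  sum-single : ∀ {m} (f : Fin m → ℚ) i → (∀ j → j ≢ i → f j ≡ 0ℚ) → sum f ≡ f i
  sum-single {suc m} f Fin.zero h = trans
      (cong (f Fin.zero +_) (sum-zero (f ∘ Fin.suc) (λ j → h (Fin.suc j) (λ ()))))
      (ℚP.+-identityʳ (f Fin.zero))
  sum-single {suc m} f (Fin.suc i) h = trans
      (cong₂ _+_ (h Fin.zero (λ ())) (sum-single (f ∘ Fin.suc) i
      (λ j j≢i → h (Fin.suc j) (j≢i ∘ FinP.suc-injective)))) (ℚP.+-identityˡ (f (Fin.suc i)))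

  module Duality (G : Graph) where
    open Graph G

    pt : Fin order → Vertex
    pt = Inverse.to enumeration

    ∑q : (Vertex → ℚ) → ℚ
    ∑q f = sum (f ∘ pt)

    ∑q-cong : ∀ {f g : Vertex → ℚ} → (∀ u → f u ≡ g u) → ∑q f ≡ ∑q g
    ∑q-cong e = sum-cong-≗ (e ∘ pt)

    ∑q₂ : (Vertex → Vertex → ℚ) → ℚ
    ∑q₂ f = ∑q (λ u → ∑q (f u))

    ∑q₂-+ : ∀ f g → ∑q₂ (λ u v → f u v + g u v) ≡ ∑q₂ f + ∑q₂ g
    ∑q₂-+ f g = trans (∑q-cong (λ u → ∑-distrib-+ (f u ∘ pt) (g u ∘ pt)))
        (∑-distrib-+ (λ u → ∑q (f (pt u))) (λ u → ∑q (g (pt u))))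

    ∑q₂-scale : ∀ c f → ∑q₂ (λ u v → c * f u v) ≡ c * ∑q₂ f
    ∑q₂-scale c f = trans (∑q-cong (λ u → sym (*-distribˡ-sum c (f u ∘ pt))))
        (sym (*-distribˡ-sum c (λ u → ∑q (f (pt u)))))

    seq-∑ᵥ : ∀ f i → seq (∑ᵥ G f) i ≡ ∑q (λ u → seq (f u) i)
    seq-∑ᵥ f = seq-sum (f ∘ pt)

    seq-∑ᵥ₂ : ∀ (f : Vertex → Vertex → ℝ) i → seq (∑ᵥ G (λ u → ∑ᵥ G (f u))) i ≡ ∑q₂ (λ u v → seq (f u v) i)
    seq-∑ᵥ₂ f i = trans (seq-∑ᵥ (λ u → ∑ᵥ G (f u)) i) (∑q-cong (λ u → seq-∑ᵥ (f u) i))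

    form : (B : Vertex → Vertex → ℝ) (x : Vertex → ℝ) (i : ℕ) → ℚ
    form B x i = ∑q₂ (λ u v → seq (x u) i * seq (B u v) i * seq (x v) i)

    form-nonNeg : ∀ (B : Vertex → Vertex → ℝ) (x : Vertex → ℝ) → (∀ i → 0ℚ ≤ form B x i) →
      Defs.0ℝ Defs.≤ ∑ᵥ G λ u → ∑ᵥ G λ v → x u Defs.* B u v Defs.* x v
    form-nonNeg B x h ε 0<ε = ev-const λ i → subst (λ q → 0ℚ ≤ q + ε)
      (sym (seq-∑ᵥ₂ (λ u v → x u Defs.* B u v Defs.* x v) i)) (+-nonNeg (h i) (ℚP.<⇒≤ 0<ε))

    form-nn : ∀ (B : Vertex → Vertex → ℝ) (x : Vertex → ℝ) →
      Defs.0ℝ Defs.≤ (∑ᵥ G λ u → ∑ᵥ G λ v → x u Defs.* B u v Defs.* x v) → NN (form B x)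
    form-nn B x h = nn-cong (seq-∑ᵥ₂ (λ u v → x u Defs.* B u v Defs.* x v))
        (0≤⇒nn {∑ᵥ G λ u → ∑ᵥ G λ v → x u Defs.* B u v Defs.* x v} h)

    -- A constant matrix needs only rational test vectors: at each index of approximation the form
    -- at a real vector is the rational form at the vector of its approximants.
    rational-psd : ∀ (β : Vertex → Vertex → ℚ) → (∀ u v → β u v ≡ β v u) →
      (∀ (X : Vertex → ℚ) → 0ℚ ≤ ∑q₂ (λ u v → X u * β u v * X v)) → PositiveSemidefinite G
          (λ u v → fromℚ (β u v))
    rational-psd β symm psd =
      (λ u v → ≡⇒≈ {fromℚ (β u v)} {fromℚ (β v u)} (λ _ → symm u v)) ,
      (λ x → form-nonNeg (λ u v → fromℚ (β u v)) x (λ i → psd (λ u → seq (x u) i)))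

    rational-trace : ∀ (β : Vertex → Vertex → ℚ) → ∑q (λ u → β u u) ≡ 1ℚ → trace G (λ u v → fromℚ (β u v))
        Defs.≈ Defs.1ℝ
    rational-trace β e = ≡⇒≈ {trace G (λ u v → fromℚ (β u v))} {Defs.1ℝ}
        (λ i → trans (seq-∑ᵥ (λ u → fromℚ (β u u)) i) e)

    rational-entrySum : ∀ (β : Vertex → Vertex → ℚ) {t} → ∑q₂ β ≡ t → entrySum G (λ u v → fromℚ (β u v))
        Defs.≈ fromℚ t
    rational-entrySum β {t} e = ≡⇒≈ {entrySum G (λ u v → fromℚ (β u v))} {fromℚ t}
        (λ i → trans (seq-∑ᵥ₂ (λ u v → fromℚ (β u v)) i) e)

    -- The dual certificate is h = t δ − J off the edges; pairing says that it is a
    -- nonnegative combination of the rank one matrices e j w ⊗ e j w.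
    weak-duality : ∀ {m r t} (b : Fin m → ℚ) (e : Fin m → Fin r → Vertex → ℚ) (h δ : Vertex → Vertex → ℚ) →
      (∀ j → 0ℚ ≤ b j) →
      (∀ (Y : Vertex → Vertex → ℚ) → ∑q₂ (λ u v → h u v * Y u v) ≡ sum
          (λ j → b j * sum (λ w → ∑q₂ (λ u v → e j w u * Y u v * e j w v)))) →
      (∀ (Y : Vertex → Vertex → ℚ) → ∑q₂ (λ u v → δ u v * Y u v) ≡ ∑q (λ u → Y u u)) →
      (∀ u v → Adj u v ⊎ h u v ≡ t * δ u v - 1ℚ) →
      ∀ B → Feasible G B → entrySum G B Defs.≤ fromℚ t
    weak-duality {t = t} b e h δ b≥0 pairing diagonal cover B ((_ , psd) , trace-one , off) =
      nn⇒≤ {entrySum G B} {t} (nn-cong (λ i → sym (gap i))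
        (nn-+ (null⇒nn (null-+ (null-scale t trace-null)
                               (null-scale (- 1ℚ) (null-sum (λ u → null-sum
                                   (λ v → null-entry (pt u) (pt v)))))))
              (nn-sum (λ j → nn-scale (b≥0 j) (nn-sum (λ w → nn-form (e j w)))))))
      where
      Y : ℕ → Vertex → Vertex → ℚ
      Y i u v = seq (B u v) i

      -- The defect h + J - t δ. By `cover` it is zero wherever there is no edge; on an edge the
      -- entry of `B` tends to 0.
      coeff : Vertex → Vertex → ℚ
      coeff u v = h u v + 1ℚ - t * δ u v

      null-entry : ∀ u v → Null (λ i → coeff u v * Y i u v)
      null-entry u v = either (cover u v)
        where
        cancel : ∀ x → x - 1ℚ + 1ℚ - x ≡ 0ℚ
        cancel = solve-∀ ℚ-ring
        coeff≡0 : h u v ≡ t * δ u v - 1ℚ → coeff u v ≡ 0ℚ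
        coeff≡0 eq = trans (cong (λ z → z + 1ℚ - t * δ u v) eq) (cancel (t * δ u v))
        either : Adj u v ⊎ h u v ≡ t * δ u v - 1ℚ → Null (λ i → coeff u v * Y i u v)
        either (inj₁ adj) = null-scale (coeff u v) (≈0⇒null {B u v} (off u v adj))
        either (inj₂ eq)  = null-zero (λ i → trans (cong (_* Y i u v) (coeff≡0 eq)) (ℚP.*-zeroˡ (Y i u v)))

      trace-null : Null (λ i → 1ℚ - ∑q (λ u → Y i u u))
      trace-null = null λ ε 0<ε → ev-map (λ i → subst (_≤ ε)
          (trans (sym (ℚP.∣-p∣≡∣p∣ (seq (trace G B) i - 1ℚ)))
          (cong ℚ.∣_∣ (trans (flip (seq (trace G B) i)) (cong (λ z → 1ℚ - z) (seq-∑ᵥ (λ u → B u u) i))))))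
        (trace-one ε 0<ε)
        where
        flip : ∀ x → - (x - 1ℚ) ≡ 1ℚ - x
        flip = solve-∀ ℚ-ring

      -- Semidefiniteness of `B` is tested against constant rational vectors only.
      nn-form : ∀ x → NN (λ i → ∑q₂ (λ u v → x u * Y i u v * x v))
      nn-form x = form-nn B (λ u → fromℚ (x u)) (psd (λ u → fromℚ (x u)))

      -- An exact identity at every stage: the trace error and the edge error tend to 0, and the
      -- remaining sum is nonnegative in the limit.
      gap : ∀ i → t - seq (entrySum G B) i ≡
        (t * (1ℚ - ∑q (λ u → Y i u u)) + - 1ℚ * ∑q₂ (λ u v → coeff u v * Y i u v))
        + sum (λ j → b j * sum (λ w → ∑q₂ (λ u v → e j w u * Y i u v * e j w v)))
      gap i = begin
        t - seq (entrySum G B) i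
          ≡⟨ cong (λ z → t - z) (seq-∑ᵥ₂ B i) ⟩
        t - ∑∑Y
          ≡⟨ rearrange t ∑∑Y tr H ⟩
        t * (1ℚ - tr) + - 1ℚ * (H + ∑∑Y + (- t) * tr) + H
          ≡⟨ cong₂ (λ p q → t * (1ℚ - tr) + - 1ℚ * p + q) (sym expand) (pairing (Y i)) ⟩
        t * (1ℚ - tr) + - 1ℚ * ∑q₂ (λ u v → coeff u v * Y i u v)
          + sum (λ j → b j * sum (λ w → ∑q₂ (λ u v → e j w u * Y i u v * e j w v))) ∎
        where
        open ≡-Reasoning
        ∑∑Y = ∑q₂ (Y i)
        tr = ∑q (λ u → Y i u u)
        H = ∑q₂ (λ u v → h u v * Y i u v)
        rearrange : ∀ t s r h → t - s ≡ t * (1ℚ - r) + - 1ℚ * (h + s + (- t) * r) + h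
        rearrange = solve-∀ ℚ-ring
        split : ∀ c t d y → (c + 1ℚ - t * d) * y ≡ c * y + y + (- t) * (d * y)
        split = solve-∀ ℚ-ring
        expand : ∑q₂ (λ u v → coeff u v * Y i u v) ≡ H + ∑∑Y + (- t) * tr
        expand = trans (∑q-cong (λ u → ∑q-cong λ v → split (h u v) t (δ u v) (Y i u v)))
          (trans (∑q₂-+ (λ u v → h u v * Y i u v + Y i u v) (λ u v → (- t) * (δ u v * Y i u v)))
            (cong₂ _+_ (∑q₂-+ (λ u v → h u v * Y i u v) (Y i))
              (trans (∑q₂-scale (- t) (λ u v → δ u v * Y i u v)) (cong ((- t) *_) (diagonal (Y i))))))

-- The Johnson scheme for n ≥ 2k: the swap operator.

module JohnsonScheme (n k : ℕ) (2k≤n : k ℕ.+ k ℕ.≤ n) where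
  open Rational
  open Binomial
  open SwapSum
  open SemidefiniteDuality
  open import Data.Rational.Base using (_+_; _*_; _-_; -_; _≤_; _<_)
  open import Data.Fin.Subset as Subset using (Subset; inside; outside; _∩_; ∁; ∣_∣; ⁅_⁆)

  private
    κ ν : ℚ
    κ = fromℕ k
    ν = fromℕ n

    k≤n : k ℕ.≤ n
    k≤n = ℕP.≤-trans (ℕP.m≤m+n k k) 2k≤n

  -- The Johnson graph acting on functions of the intersection size: `swapSum₁₁` with cell sizes k -
  -- m, k - m and n - 2k + m. As a formula it makes sense for every `m`, so the identities below are
  -- ring identities and are proved for all `m`.
  T : (ℕ → ℚ) → ℕ → ℚ
  T g m = let x = fromℕ m in
    (κ - x) * (κ - x) * g (suc m) + (ν - κ - (κ - x)) * (x * g (m ∸ 1))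
    + (x * (κ - x) + (κ - x) * (ν - κ - (κ - x))) * g m

  T-swap : (A C : KSubset n k) (g : ℕ → ℚ) →
    ∑ₖ n k (λ B → swap 1 1 (proj₁ A) (proj₁ B) * g (∣ proj₁ B ∩ proj₁ C ∣)) ≡ T g (∣ proj₁ A ∩ proj₁ C ∣)
  T-swap (A , ∣A∣≡k) (C , ∣C∣≡k) g = begin
    _ ≡⟨ ∑ₖ-swap 1 A C g ∣A∣≡k ⟩
    _ ≡⟨ swapSum₁₁ A C g ⟩
    F (c₁₀ A C) (c₀₁ A C) (c₀₀ A C) ≡⟨ cong (F (c₁₀ A C) (c₀₁ A C)) e₀₀ ⟩
    F (c₁₀ A C) (c₀₁ A C) (ν - κ - c₀₁ A C) ≡⟨ cong₂ (λ a b → F a b (ν - κ - b)) e₁₀ e₀₁ ⟩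
    F (κ - x) (κ - x) (ν - κ - (κ - x)) ∎
    where
    open ≡-Reasoning
    m = ∣ A ∩ C ∣
    x = fromℕ m
    F : ℚ → ℚ → ℚ → ℚ
    F b c d = b * c * g (suc m) + d * (x * g (m ∸ 1)) + (x * c + b * d) * g m
    minus : ∀ {a b c} → a + b ≡ c → b ≡ c - a
    minus {a} {b} refl = lemma a b
      where
      lemma : ∀ a b → b ≡ a + b - a
      lemma = solve-∀ ℚ-ring
    part : ∀ (P Q : Subset n) → fromℕ (∣ P ∩ Q ∣) + fromℕ (∣ P ∩ ∁ Q ∣) ≡ fromℕ (∣ P ∣)
    part P Q = trans (sym (fromℕ-+ (∣ P ∩ Q ∣) (∣ P ∩ ∁ Q ∣))) (cong fromℕ (∣∩∣+∣∩∁∣ P Q))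
    e₁₀ : c₁₀ A C ≡ κ - x
    e₁₀ = minus (trans (part A C) (cong fromℕ ∣A∣≡k))
    e₀₁ : c₀₁ A C ≡ κ - x
    e₀₁ = minus (trans (cong (λ S → fromℕ (∣ S ∣) + c₀₁ A C) (∩-comm A C))
        (trans (part C A) (cong fromℕ ∣C∣≡k)))
    e₀₀ : c₀₀ A C ≡ ν - κ - c₀₁ A C
    e₀₀ = minus (trans (cong (λ S → fromℕ (∣ S ∣) + c₀₀ A C) (∩-comm C (∁ A))) (trans (part (∁ A) C)
      (trans (cong fromℕ (trans (∣∁p∣≡n∸∣p∣ A) (cong (n ∸_) ∣A∣≡k))) (fromℕ-∸ k≤n))))

  -- The eigenvalues of the Johnson graph, k(n - k) - s(n + 1 - s).
  μ : ℕ → ℚ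
  μ s = κ * (ν - κ) - fromℕ s * (ν + 1ℚ - fromℕ s)

  T-binom-zero : ∀ m → T (λ x → binom x 0) m ≡ μ 0 * binom m 0
  T-binom-zero m = trans (cong₂ (λ a b → (κ - x) * (κ - x) * a + (ν - κ - (κ - x)) * (x * b)
        + (x * (κ - x) + (κ - x) * (ν - κ - (κ - x))) * binom m 0)
      (trans (binom-zero (suc m)) (sym (binom-zero m))) (trans (binom-zero (m ∸ 1)) (sym (binom-zero m))))
    (lemma κ ν x (binom m 0))
    where
    x = fromℕ m
    lemma : ∀ κ ν x b → (κ - x) * (κ - x) * b + (ν - κ - (κ - x)) * (x * b)
        + (x * (κ - x) + (κ - x) * (ν - κ - (κ - x))) * b ≡ (κ * (ν - κ) - 0ℚ * (ν + 1ℚ - 0ℚ)) * b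
    lemma = solve-∀ ℚ-ring

  T-binom-suc : ∀ s m → T (λ x → binom x (suc s)) m ≡
    μ (suc s) * binom m (suc s) + (κ - fromℕ s) * (κ - fromℕ s) * binom m s
  T-binom-suc s m = begin
    (κ - x) * (κ - x) * binom (suc m) (suc s) + c * (x * binom (m ∸ 1) (suc s))
        + (x * (κ - x) + (κ - x) * c) * b
      ≡⟨ cong₂ (λ u v → (κ - x) * (κ - x) * u + c * v + (x * (κ - x) + (κ - x) * c) * b)
           (binom-pascal m s) (trans (binom-pred m (suc s)) (cong (λ z → (x - z) * b) (fromℕ-suc s))) ⟩
    (κ - x) * (κ - x) * (d + b) + c * ((x - (1ℚ + S)) * b) + (x * (κ - x) + (κ - x) * c) * b
      -- The step is a ring identity once a multiple of the relation `binom-next m s`, which is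
      -- zero, is split off.
      ≡⟨ expand κ ν x S b d ⟩
    (κ * (ν - κ) - (1ℚ + S) * (ν + 1ℚ - (1ℚ + S))) * b + (κ - S) * (κ - S) * d
      + (κ + κ - S - x) * ((1ℚ + S) * b - (x - S) * d)
      ≡⟨ cong (λ z → (κ * (ν - κ) - (1ℚ + S) * (ν + 1ℚ - (1ℚ + S))) * b + (κ - S) * (κ - S) * d +
          (κ + κ - S - x) * z)
           (trans (cong (λ z → z * b - (x - S) * d) (sym (fromℕ-suc s)))
             (trans (cong (_- (x - S) * d) (binom-next m s)) (ℚP.+-inverseʳ ((x - S) * d)))) ⟩
    (κ * (ν - κ) - (1ℚ + S) * (ν + 1ℚ - (1ℚ + S))) * b + (κ - S) * (κ - S) * d + (κ + κ - S - x) * 0ℚ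
      ≡⟨ drop ((κ * (ν - κ) - (1ℚ + S) * (ν + 1ℚ - (1ℚ + S))) * b) ((κ - S) * (κ - S) * d) (κ + κ - S - x) ⟩
    (κ * (ν - κ) - (1ℚ + S) * (ν + 1ℚ - (1ℚ + S))) * b + (κ - S) * (κ - S) * d
      ≡⟨ cong (λ z → (κ * (ν - κ) - z * (ν + 1ℚ - z)) * b + (κ - S) * (κ - S) * d) (sym (fromℕ-suc s)) ⟩
    μ (suc s) * b + (κ - S) * (κ - S) * d ∎
    where
    open ≡-Reasoning
    x = fromℕ m
    S = fromℕ s
    b = binom m (suc s)
    d = binom m s
    c = ν - κ - (κ - x)
    drop : ∀ a b c → a + b + c * 0ℚ ≡ a + b
    drop = solve-∀ ℚ-ring
    expand : ∀ κ ν x S b d →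
      (κ - x) * (κ - x) * (d + b) + (ν - κ - (κ - x)) * ((x - (1ℚ + S)) * b) +
          (x * (κ - x) + (κ - x) * (ν - κ - (κ - x))) * b
      ≡ (κ * (ν - κ) - (1ℚ + S) * (ν + 1ℚ - (1ℚ + S))) * b + (κ - S) * (κ - S) * d
        + (κ + κ - S - x) * ((1ℚ + S) * b - (x - S) * d)
    expand = solve-∀ ℚ-ring

  -- Weights and the elimination that defines the idempotents.

  θ : ℕ → ℕ → ℚ
  θ = weight n k

  θ-< : ∀ {s j} → s ℕ.< j → θ s j ≡ 0ℚ
  θ-< {s} {j} s<j = trans (cong (_* binom (n ∸ j ∸ s) (k ∸ s)) (binom⊖-< (k ∸ j) s<j))
      (ℚP.*-zeroˡ (binom (n ∸ j ∸ s) (k ∸ s)))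

  θ-nonNeg : ∀ s j → 0ℚ ≤ θ s j
  θ-nonNeg s j = *-nonNeg (binom⊖-nonNeg (k ∸ j) s j) (binom-nonNeg (n ∸ j ∸ s) (k ∸ s))

  θ-diag : ∀ j → θ j j ≡ binom (n ∸ j ∸ j) (k ∸ j)
  θ-diag j = trans (cong (_* binom (n ∸ j ∸ j) (k ∸ j))
      (trans (trans (cong (λ s → binom⊖ (k ∸ j) s j) (sym (ℕP.+-identityʳ j))) (binom⊖-+ (k ∸ j) j 0))
          (binom-zero (k ∸ j))))
    (ℚP.*-identityˡ (binom (n ∸ j ∸ j) (k ∸ j)))

  -- At `s = k` the inclusion matrix is the identity, so all its eigenvalues are 1; this is what
  -- makes the `E j` sum to the identity.
  θ-top : ∀ {j} → j ℕ.≤ k → θ k j ≡ 1ℚ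
  θ-top {j} j≤k = trans (cong₂ _*_ e (trans (cong (binom (n ∸ j ∸ k)) (ℕP.n∸n≡0 k))
      (binom-zero (n ∸ j ∸ k)))) (ℚP.*-identityˡ 1ℚ)
    where
    e : binom⊖ (k ∸ j) k j ≡ 1ℚ
    e = trans (cong (λ s → binom⊖ (k ∸ j) s j) (sym (ℕP.m+[n∸m]≡n j≤k)))
          (trans (binom⊖-+ (k ∸ j) j (k ∸ j)) (binom-self (k ∸ j)))

  θ-zero : θ 0 0 ≡ binom n k
  θ-zero = trans (cong (_* binom n k) (binom-zero k)) (ℚP.*-identityˡ (binom n k))

  θ-diag-pos : ∀ {j} → j ℕ.≤ k → 0ℚ < θ j j
  θ-diag-pos {j} j≤k = subst (0ℚ <_) (sym (θ-diag j)) (binom-pos′ le)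
    where
    le : k ∸ j ℕ.≤ n ∸ j ∸ j
    le = ℕP.m+n≤o⇒m≤o∸n (k ∸ j) (ℕP.m+n≤o⇒m≤o∸n (k ∸ j ℕ.+ j)
      (ℕP.≤-trans (ℕP.+-mono-≤ (ℕP.≤-reflexive (ℕP.m∸n+n≡m j≤k)) j≤k) 2k≤n))

  μ-diff : ∀ i j → μ i - μ j ≡ (fromℕ j - fromℕ i) * (ν + 1ℚ - fromℕ i - fromℕ j)
  μ-diff i j = lemma κ ν (fromℕ i) (fromℕ j)
    where
    lemma : ∀ κ ν i j → (κ * (ν - κ) - i * (ν + 1ℚ - i)) - (κ * (ν - κ) - j * (ν + 1ℚ - j)) ≡ (j - i) *
        (ν + 1ℚ - i - j)
    lemma = solve-∀ ℚ-ring

  -- The condition on the coefficients under which elimination preserves eigenvectors of `T`. The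
  -- difference of eigenvalues is (s + 1 - j)(n - j - s); each factor is absorbed by one of the two
  -- binomials of the weight and leaves a factor k - s.
  θ-rec : ∀ {s j} → j ℕ.≤ s → s ℕ.< k →
    (μ j - μ (suc s)) * θ (suc s) j ≡ (κ - fromℕ s) * (κ - fromℕ s) * θ s j
  θ-rec {s} {j} j≤s s<k
    with ℕP.m≤n⇒∃[o]m+o≡n j≤s | ℕP.m≤n⇒∃[o]m+o≡n s<k
  ... | i , refl | q , k≡ = begin
    (μ j - μ (suc s)) * θ (suc s) j
      ≡⟨ cong₂ _*_ (trans (μ-diff j (suc s)) (cong₂ _*_ eᵢ eᵣ))
           (cong₂ _*_ (trans (cong (λ t → binom⊖ p t j) (sym (ℕP.+-suc j i))) (binom⊖-+ p j (suc i)))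
                      (cong₂ binom r≡′ q≡′)) ⟩
    fromℕ (suc i) * fromℕ (suc r) * (binom p (suc i) * binom r q)
      ≡⟨ rearrange₁ (fromℕ (suc i)) (fromℕ (suc r)) (binom p (suc i)) (binom r q) ⟩
    (fromℕ (suc i) * binom p (suc i)) * (fromℕ (suc r) * binom r q)
      ≡⟨ cong₂ _*_ (trans (binom-next p i) (cong (_* binom p i) e_p)) (sym (binom-absorb r q)) ⟩
    (Q * binom p i) * (Q * binom (suc r) (suc q))
      ≡⟨ rearrange₂ Q (binom p i) (binom (suc r) (suc q)) ⟩
    Q * Q * (binom p i * binom (suc r) (suc q))
      ≡⟨ cong₂ _*_ (cong (λ z → z * z) (sym eK))
          (cong₂ _*_ (sym (binom⊖-+ p j i)) (cong₂ binom (sym r≡) (sym q≡))) ⟩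
    (κ - fromℕ s) * (κ - fromℕ s) * θ s j ∎
    where
    open ≡-Reasoning
    p = k ∸ j
    Q = fromℕ (suc q)
    r = n ∸ suc (j ℕ.+ s)
    j+s<n : j ℕ.+ s ℕ.< n
    j+s<n = ℕP.≤-trans (ℕP.+-mono-≤-< (ℕP.≤-trans j≤s (ℕP.<⇒≤ s<k)) s<k) 2k≤n
    r≡ : n ∸ j ∸ s ≡ suc r
    r≡ = trans (ℕP.∸-+-assoc n j s) (ℕP.+-∸-assoc 1 j+s<n)
    r≡′ : n ∸ j ∸ suc s ≡ r
    r≡′ = trans (ℕP.∸-+-assoc n j (suc s)) (cong (n ∸_) (ℕP.+-suc j s))
    q≡ : k ∸ s ≡ suc q
    q≡ = trans (cong (_∸ s) (sym (trans (ℕP.+-suc s q) k≡))) (ℕP.m+n∸m≡n s (suc q))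
    q≡′ : k ∸ suc s ≡ q
    q≡′ = trans (cong (_∸ suc s) (sym k≡)) (ℕP.m+n∸m≡n (suc s) q)
    eK : κ - fromℕ s ≡ Q
    eK = trans (sym (fromℕ-∸ (ℕP.<⇒≤ s<k))) (cong fromℕ q≡)
    e_p : fromℕ p - fromℕ i ≡ Q
    e_p = trans (sym (fromℕ-∸ i≤p)) (cong fromℕ (trans (ℕP.∸-+-assoc k j i) q≡))
      where
      i≤p : i ℕ.≤ p
      i≤p = ℕP.m+n≤o⇒m≤o∸n i (ℕP.≤-trans (ℕP.≤-reflexive (ℕP.+-comm i j)) (ℕP.<⇒≤ s<k))
    eᵢ : fromℕ (suc s) - fromℕ j ≡ fromℕ (suc i)
    eᵢ = trans (sym (fromℕ-∸ (ℕP.m≤n⇒m≤1+n j≤s)))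
      (cong fromℕ (trans (cong (_∸ j) (sym (ℕP.+-suc j i))) (ℕP.m+n∸m≡n j (suc i))))
    eᵣ : ν + 1ℚ - fromℕ j - fromℕ (suc s) ≡ fromℕ (suc r)
    eᵣ = trans (cong (λ z → ν + 1ℚ - fromℕ j - z) (fromℕ-suc s))
      (trans (cancel ν (fromℕ j) (fromℕ s))
        (trans (cong (λ z → ν - z) (sym (fromℕ-+ j s)))
          (trans (sym (fromℕ-∸ (ℕP.<⇒≤ j+s<n))) (cong fromℕ (ℕP.+-∸-assoc 1 j+s<n)))))
      where
      cancel : ∀ ν a b → ν + 1ℚ - a - (1ℚ + b) ≡ ν - (a + b)
      cancel = solve-∀ ℚ-ring
    rearrange₁ : ∀ a b c d → a * b * (c * d) ≡ (a * c) * (b * d)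
    rearrange₁ = solve-∀ ℚ-ring
    rearrange₂ : ∀ a b c → (a * b) * (a * c) ≡ a * a * (b * c)
    rearrange₂ = solve-∀ ℚ-ring

  -- `binom m s` with its components along `E 0`, ..., `E (j − 1)` removed; for `j = s` a multiple
  -- of `E s` is left. The subtracted term contains `E j m` written out, so that the recursion is
  -- structural in the second index.
  residual : ℕ → ℕ → ℕ → ℚ
  residual s zero    m = binom m s
  residual s (suc j) m = residual s j m - θ s j * (inv (θ j j) * residual j j m)

  E : ℕ → ℕ → ℚ
  E j m = inv (θ j j) * residual j j m

  residual-sum : ∀ s j m → residual s j m ≡ binom m s - ∑[ i < j ] (θ s i * E i m)
  residual-sum s zero    m = lemma (binom m s)
    where
    lemma : ∀ a → a ≡ a - 0ℚ
    lemma = solve-∀ ℚ-ring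
  residual-sum s (suc j) m = trans (cong (_- θ s j * E j m) (residual-sum s j m))
    (trans (lemma (binom m s) (∑[ i < j ] (θ s i * E i m)) (θ s j * E j m))
      (cong (λ z → binom m s - z) (sym (∑<-snoc j (λ i → θ s i * E i m)))))
    where
    lemma : ∀ a b c → a - b - c ≡ a - (b + c)
    lemma = solve-∀ ℚ-ring

  residual≡θE : ∀ {s} → s ℕ.≤ k → ∀ m → residual s s m ≡ θ s s * E s m
  residual≡θE {s} s≤k m = sym (inv-*-cancel (residual s s m) (pos⇒≢0 (θ-diag-pos s≤k)))

  binom-expand′ : ∀ {s} → s ℕ.≤ k → ∀ m → binom m s ≡ ∑[ j < suc s ] (θ s j * E j m)
  binom-expand′ {s} s≤k m = begin
    binom m s                           ≡⟨ add-sub (binom m s) Σ′ ⟩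
    Σ′ + (binom m s - Σ′)
        ≡⟨ cong (Σ′ +_) (trans (sym (residual-sum s s m)) (residual≡θE s≤k m)) ⟩
    Σ′ + θ s s * E s m                  ≡⟨ sym (∑<-snoc s (λ j → θ s j * E j m)) ⟩
    ∑[ j < suc s ] (θ s j * E j m)      ∎
    where
    open ≡-Reasoning
    Σ′ = ∑[ j < s ] (θ s j * E j m)
    add-sub : ∀ a b → a ≡ b + (a - b)
    add-sub = solve-∀ ℚ-ring

  binom-expand : ∀ {s} → s ℕ.≤ k → ∀ m → binom m s ≡ ∑[ j < suc k ] (θ s j * E j m)
  binom-expand {s} s≤k m = begin
    binom m s                                    ≡⟨ binom-expand′ s≤k m ⟩
    ∑< (suc s) f                                 ≡⟨ sym (ℚP.+-identityʳ (∑< (suc s) f)) ⟩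
    ∑< (suc s) f + 0ℚ                            ≡⟨ cong (∑< (suc s) f +_) (sym (∑<-zero (k ∸ s) λ i _ →
        trans (cong (_* E (suc s ℕ.+ i) m) (θ-< (s≤s (ℕP.m≤m+n s i)))) (ℚP.*-zeroˡ (E (suc s ℕ.+ i) m)))) ⟩
    ∑< (suc s) f + ∑[ i < k ∸ s ] f (suc s ℕ.+ i)  ≡⟨ sym (∑<-split (suc s) (k ∸ s) f) ⟩
    ∑< (suc s ℕ.+ (k ∸ s)) f                     ≡⟨ cong (λ z → ∑< (suc z) f) (ℕP.m+[n∸m]≡n s≤k) ⟩
    ∑< (suc k) f                                 ∎
    where
    open ≡-Reasoning
    f : ℕ → ℚ
    f j = θ s j * E j m

  T-residual : ∀ s j m → (∀ i → i ℕ.< j → T (E i) m ≡ μ i * E i m) →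
    T (residual s j) m ≡ T (λ x → binom x s) m - ∑[ i < j ] (θ s i * (μ i * E i m))
  T-residual s zero    m h = lemma (T (λ x → binom x s) m)
    where
    lemma : ∀ a → a ≡ a - 0ℚ
    lemma = solve-∀ ℚ-ring
  T-residual s (suc j) m h = begin
    T (residual s (suc j)) m
      ≡⟨ linear ((κ - x) * (κ - x)) (ν - κ - (κ - x)) x (x * (κ - x) + (κ - x) * (ν - κ - (κ - x)))
           (residual s j (suc m)) (residual s j (m ∸ 1)) (residual s j m) (θ s j) (E j (suc m))
               (E j (m ∸ 1)) (E j m) ⟩
    T (residual s j) m - θ s j * T (E j) m
      ≡⟨ cong₂ (λ a b → a - θ s j * b) (T-residual s j m (λ i i<j → h i (ℕP.m≤n⇒m≤1+n i<j)))
          (h j ℕP.≤-refl) ⟩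
    b - Σ′ - f j
      ≡⟨ regroup b Σ′ (f j) ⟩
    b - (Σ′ + f j)
      ≡⟨ cong (λ z → b - z) (sym (∑<-snoc j f)) ⟩
    b - ∑< (suc j) f ∎
    where
    open ≡-Reasoning
    x = fromℕ m
    b = T (λ x → binom x s) m
    f : ℕ → ℚ
    f i = θ s i * (μ i * E i m)
    Σ′ = ∑< j f
    regroup : ∀ a b c → a - b - c ≡ a - (b + c)
    regroup = solve-∀ ℚ-ring
    linear : ∀ α β x γ a b c t d e f → α * (a - t * d) + β * (x * (b - t * e)) + γ * (c - t * f)
      ≡ (α * a + β * (x * b) + γ * c) - t * (α * d + β * (x * e) + γ * f)
    linear = solve-∀ ℚ-ring

  T-scale : ∀ c g m → T (λ x → c * g x) m ≡ c * T g m
  T-scale c g m = lemma ((κ - x) * (κ - x)) (ν - κ - (κ - x)) x (x * (κ - x) + (κ - x) * (ν - κ - (κ - x)))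
      c (g (suc m)) (g (m ∸ 1)) (g m)
    where
    x = fromℕ m
    lemma : ∀ α β x γ c a b d → α * (c * a) + β * (x * (c * b)) + γ * (c * d) ≡ c *
        (α * a + β * (x * b) + γ * d)
    lemma = solve-∀ ℚ-ring

  -- The off-diagonal part of `T-binom-suc` is a multiple of `binom m s`. Expanded in the earlier
  -- `E i`, it is matched term by term by `θ-rec`, and what remains is `μ (suc s)` times the
  -- residual.
  T-residual-eigen : ∀ s → s ℕ.≤ k → ∀ m → (∀ i → i ℕ.< s → T (E i) m ≡ μ i * E i m) →
    T (residual s s) m ≡ μ s * residual s s m
  T-residual-eigen zero    _   m _ = T-binom-zero m
  T-residual-eigen (suc s) s<k m h = begin
    T (residual (suc s) (suc s)) m
      ≡⟨ T-residual (suc s) (suc s) m h ⟩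
    T (λ x → binom x (suc s)) m - ∑[ i < suc s ] (θ (suc s) i * (μ i * E i m))
      ≡⟨ cong (_- ∑[ i < suc s ] (θ (suc s) i * (μ i * E i m))) (T-binom-suc s m) ⟩
    μ (suc s) * binom m (suc s) + c * binom m s - ∑[ i < suc s ] (θ (suc s) i * (μ i * E i m))
      ≡⟨ cong₂ (λ u v → μ (suc s) * binom m (suc s) + u - v)
           (trans (cong (c *_) (binom-expand′ (ℕP.<⇒≤ s<k) m))
               (∑<-distribˡ (suc s) c (λ i → θ s i * E i m)))
           (trans (∑<-cong (suc s) (λ i i≤s → split i (ℕP.≤-pred i≤s)))
             (trans (∑<-+ (suc s) (λ i → c * (θ s i * E i m)) (λ i → μ (suc s) * (θ (suc s) i * E i m)))
               (cong (P +_) (sym (∑<-distribˡ (suc s) (μ (suc s)) (λ i → θ (suc s) i * E i m)))))) ⟩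
    μ (suc s) * binom m (suc s) + P - (P + μ (suc s) * R)
      ≡⟨ cancel (μ (suc s)) (binom m (suc s)) P R ⟩
    μ (suc s) * (binom m (suc s) - R)
      ≡⟨ cong (μ (suc s) *_) (sym (residual-sum (suc s) (suc s) m)) ⟩
    μ (suc s) * residual (suc s) (suc s) m ∎
    where
    open ≡-Reasoning
    c = (κ - fromℕ s) * (κ - fromℕ s)
    P = ∑[ i < suc s ] (c * (θ s i * E i m))
    R = ∑[ i < suc s ] (θ (suc s) i * E i m)
    cancel : ∀ μ b p r → μ * b + p - (p + μ * r) ≡ μ * (b - r)
    cancel = solve-∀ ℚ-ring
    split : ∀ i → i ℕ.≤ s → θ (suc s) i * (μ i * E i m) ≡ c * (θ s i * E i m) + μ (suc s) *
        (θ (suc s) i * E i m)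
    split i i≤s = trans (lemma₁ (θ (suc s) i) (μ i) (μ (suc s)) (E i m))
      (cong (_+ μ (suc s) * (θ (suc s) i * E i m))
        (trans (cong (_* E i m) (θ-rec i≤s s<k)) (ℚP.*-assoc c (θ s i) (E i m))))
      where
      lemma₁ : ∀ t a b e → t * (a * e) ≡ (a - b) * t * e + b * (t * e)
      lemma₁ = solve-∀ ℚ-ring

  T-E : ∀ j → j ℕ.≤ k → ∀ m → T (E j) m ≡ μ j * E j m
  T-E j j≤k m = below (suc j) (s≤s j≤k) j ℕP.≤-refl
    where
    below : ∀ s → s ℕ.≤ suc k → ∀ i → i ℕ.< s → T (E i) m ≡ μ i * E i m
    below (suc s) (s≤s s≤k) i (s≤s i≤s) with ℕP.m≤n⇒m<n∨m≡n i≤s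
    ... | inj₁ i<s = below s (ℕP.m≤n⇒m≤1+n s≤k) i i<s
    ... | inj₂ refl = begin
      T (E i) m                                   ≡⟨ T-scale (inv (θ i i)) (residual i i) m ⟩
      inv (θ i i) * T (residual i i) m            ≡⟨ cong (inv (θ i i) *_)
        (T-residual-eigen i s≤k m (below i (ℕP.m≤n⇒m≤1+n s≤k))) ⟩
      inv (θ i i) * (μ i * residual i i m)        ≡⟨ lemma (inv (θ i i)) (μ i) (residual i i m) ⟩
      μ i * E i m                                 ∎
      where
      open ≡-Reasoning
      lemma : ∀ a b c → a * (b * c) ≡ b * (a * c)
      lemma = solve-∀ ℚ-ring

  -- Matrix products of functions of the intersection size.

  private
    V : Set
    V = KSubset n k

    ∑V : (V → ℚ) → ℚ
    ∑V = ∑ₖ n k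

    #V : ℕ
    #V = #KSubset n k

    ∑V-cong : ∀ {f g : V → ℚ} → (∀ A → f A ≡ g A) → ∑V f ≡ ∑V g
    ∑V-cong e = sum-cong-≗ (e ∘ enum)

  infix 5 ⟨_,_⟩
  ⟨_,_⟩ : V → V → ℕ
  ⟨ A , B ⟩ = ∣ proj₁ A ∩ proj₁ B ∣

  ⟨⟩-comm : ∀ A B → ⟨ A , B ⟩ ≡ ⟨ B , A ⟩
  ⟨⟩-comm A B = cong ∣_∣ (∩-comm (proj₁ A) (proj₁ B))

  ⟨⟩-self : ∀ A → ⟨ A , A ⟩ ≡ k
  ⟨⟩-self (A , ∣A∣≡k) = trans (cong ∣_∣ (∩-idem A)) ∣A∣≡k

  ⟨⟩≤k : ∀ A B → ⟨ A , B ⟩ ℕ.≤ k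
  ⟨⟩≤k (A , ∣A∣≡k) (B , _) = ℕP.≤-trans (∣p∩q∣≤∣p∣ A B) (ℕP.≤-reflexive ∣A∣≡k)

  convolve : (ℕ → ℚ) → (ℕ → ℚ) → V → V → ℚ
  convolve g h A C = ∑V (λ B → g ⟨ A , B ⟩ * h ⟨ B , C ⟩)

  nbr : V → V → ℚ
  nbr A B = swap 1 1 (proj₁ A) (proj₁ B)

  E-eigen : ∀ {j} → j ℕ.≤ k → ∀ A C → ∑V (λ B → nbr A B * E j ⟨ B , C ⟩) ≡ μ j * E j ⟨ A , C ⟩
  E-eigen {j} j≤k A C = trans (T-swap A C (E j)) (T-E j j≤k ⟨ A , C ⟩)

  E-eigenʳ : ∀ {j} → j ℕ.≤ k → ∀ A C → ∑V (λ B → E j ⟨ A , B ⟩ * nbr B C) ≡ μ j * E j ⟨ A , C ⟩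
  E-eigenʳ {j} j≤k A C = trans (∑V-cong (λ B → trans (ℚP.*-comm (E j ⟨ A , B ⟩) (nbr B C))
      (cong₂ _*_ (swap-sym 1 (proj₁ B) (proj₁ C)) (cong (E j) (⟨⟩-comm A B)))))
    (trans (E-eigen j≤k C A) (cong (λ m → μ j * E j m) (⟨⟩-comm C A)))

  -- Both factors in `μ-diff` are positive, the second because i + j ≤ 2k ≤ n.
  μ-distinct : ∀ {i j} → i ℕ.< j → j ℕ.≤ k → μ i - μ j ≢ 0ℚ
  μ-distinct {i} {j} i<j j≤k e = pos⇒≢0 (*-pos j-i>0 r>0) (trans (sym (μ-diff i j)) e)
    where
    j-i>0 : 0ℚ < fromℕ j - fromℕ i
    j-i>0 = subst (0ℚ <_) (fromℕ-∸ (ℕP.<⇒≤ i<j)) (fromℕ-pos (ℕP.m<n⇒0<n∸m i<j))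
    i+j≤n : i ℕ.+ j ℕ.≤ n
    i+j≤n = ℕP.≤-trans (ℕP.+-mono-≤ (ℕP.≤-trans (ℕP.<⇒≤ i<j) j≤k) j≤k) 2k≤n
    regroup : ∀ N i j → 1ℚ + (N - (i + j)) ≡ N + 1ℚ - i - j
    regroup = solve-∀ ℚ-ring
    r>0 : 0ℚ < fromℕ n + 1ℚ - fromℕ i - fromℕ j
    r>0 = subst (0ℚ <_) (trans (fromℕ-suc (n ∸ (i ℕ.+ j)))
        (trans (cong (1ℚ +_) (trans (fromℕ-∸ i+j≤n) (cong (λ z → fromℕ n - z) (fromℕ-+ i j))))
          (regroup (fromℕ n) (fromℕ i) (fromℕ j))))
      (fromℕ-pos {suc (n ∸ (i ℕ.+ j))} (s≤s z≤n))

  -- Eigenvectors of the symmetric matrix nbr for distinct eigenvalues are orthogonal.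
  E-orthogonal : ∀ {i j} → i ℕ.≤ k → j ℕ.≤ k → i ≢ j → ∀ A C → convolve (E i) (E j) A C ≡ 0ℚ
  E-orthogonal {i} {j} i≤k j≤k i≢j A C = *-cancelˡ (μ i - μ j) distinct
    (trans (ℚP.*-distribʳ-+ P (μ i) (- μ j)) (trans (cong (_+ (- μ j) * P) slide)
      (trans (sym (ℚP.*-distribʳ-+ P (μ j) (- μ j))) (trans (cong (_* P) (ℚP.+-inverseʳ (μ j)))
        (trans (ℚP.*-zeroˡ P) (sym (ℚP.*-zeroʳ (μ i - μ j))))))))
    where
    open ≡-Reasoning
    P = convolve (E i) (E j) A C
    distinct : μ i - μ j ≢ 0ℚ
    distinct with ℕP.<-cmp i j
    ... | tri< i<j _ _ = μ-distinct i<j j≤k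
    ... | tri≈ _ i≡j _ = ⊥-elim (i≢j i≡j)
    ... | tri> _ _ j<i = λ e → μ-distinct j<i i≤k (trans (flip (μ i) (μ j)) (cong -_ e))
      where
      flip : ∀ a b → b - a ≡ - (a - b)
      flip = solve-∀ ℚ-ring
    -- The adjacency matrix is inserted between the two factors and absorbed once to the left and
    -- once to the right.
    slide : μ i * P ≡ μ j * P
    slide = begin
      μ i * P
        ≡⟨ *-distribˡ-sum (μ i) (λ b → E i ⟨ A , enum b ⟩ * E j ⟨ enum b , C ⟩) ⟩
      ∑V (λ B → μ i * (E i ⟨ A , B ⟩ * E j ⟨ B , C ⟩))
        ≡⟨ ∑V-cong (λ B → trans (sym (ℚP.*-assoc (μ i) _ _))
            (trans (cong (_* E j ⟨ B , C ⟩) (sym (E-eigenʳ i≤k A B)))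
             (*-distribʳ-sum (E j ⟨ B , C ⟩) (λ x → E i ⟨ A , enum x ⟩ * nbr (enum x) B)))) ⟩
      ∑V (λ B → ∑V (λ X → E i ⟨ A , X ⟩ * nbr X B * E j ⟨ B , C ⟩))
        ≡⟨ ∑-comm (λ b x → E i ⟨ A , enum x ⟩ * nbr (enum x) (enum b) * E j ⟨ enum b , C ⟩) ⟩
      ∑V (λ X → ∑V (λ B → E i ⟨ A , X ⟩ * nbr X B * E j ⟨ B , C ⟩))
        ≡⟨ ∑V-cong (λ X → trans (∑V-cong (λ B → ℚP.*-assoc (E i ⟨ A , X ⟩) (nbr X B) (E j ⟨ B , C ⟩)))
             (trans (sym (*-distribˡ-sum (E i ⟨ A , X ⟩) (λ b → nbr X (enum b) * E j ⟨ enum b , C ⟩)))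
               (trans (cong (E i ⟨ A , X ⟩ *_) (E-eigen j≤k X C))
                   (exchange (E i ⟨ A , X ⟩) (μ j) (E j ⟨ X , C ⟩))))) ⟩
      ∑V (λ X → μ j * (E i ⟨ A , X ⟩ * E j ⟨ X , C ⟩))
        ≡⟨ sym (*-distribˡ-sum (μ j) (λ b → E i ⟨ A , enum b ⟩ * E j ⟨ enum b , C ⟩)) ⟩
      μ j * P ∎
      where
      exchange : ∀ a b c → a * (b * c) ≡ b * (a * c)
      exchange = solve-∀ ℚ-ring

  -- Between `k`-subsets `binom ⟨ B , C ⟩ k` detects equality, so it is the identity matrix,
  -- recognised here as the empty exchange `swap 0 0`.
  convolve-identity : ∀ g A C → convolve g (λ m → binom m k) A C ≡ g ⟨ A , C ⟩
  convolve-identity g A C = begin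
    convolve g (λ m → binom m k) A C
      ≡⟨ ∑V-cong (λ B → trans (ℚP.*-comm (g ⟨ A , B ⟩) (binom ⟨ B , C ⟩ k))
           (cong₂ _*_ (binom≡swap B) (cong g (⟨⟩-comm A B)))) ⟩
    ∑V (λ B → swap 0 0 (proj₁ C) (proj₁ B) * g ⟨ B , A ⟩)
      ≡⟨ ∑ₖ-swap 0 (proj₁ C) (proj₁ A) g (proj₂ C) ⟩
    swapSum 0 0 (proj₁ C) (proj₁ A) g
      ≡⟨ swapSum₀₀ (proj₁ C) (proj₁ A) g ⟩
    g ⟨ C , A ⟩
      ≡⟨ cong g (⟨⟩-comm C A) ⟩
    g ⟨ A , C ⟩ ∎
    where
    open ≡-Reasoning
    lemma : ∀ m {x y} → m ℕ.+ x ≡ k → m ℕ.+ y ≡ k → binom m k ≡ 𝟙 x 0 * 𝟙 y 0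
    lemma m {x} {y} refl e with ℕP.+-cancelˡ-≡ m y x e
    lemma m {zero}  refl e | refl = trans (cong (binom m) (ℕP.+-identityʳ m)) (binom-self m)
    lemma m {suc x} refl e | refl = binom-> (ℕP.m<m+n m (s≤s z≤n))
    binom≡swap : ∀ B → binom ⟨ B , C ⟩ k ≡ swap 0 0 (proj₁ C) (proj₁ B)
    binom≡swap B = lemma ⟨ B , C ⟩
      (trans (cong (ℕ._+ ∣ proj₁ C ∩ ∁ (proj₁ B) ∣) (⟨⟩-comm B C))
          (trans (∣∩∣+∣∩∁∣ (proj₁ C) (proj₁ B)) (proj₂ C)))
      (trans (∣∩∣+∣∩∁∣ (proj₁ B) (proj₁ C)) (proj₂ B))

  convolve-combʳ : ∀ g (c : ℕ → ℚ) A C →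
    convolve g (λ m → ∑[ j < suc k ] (c j * E j m)) A C ≡ ∑[ j < suc k ] (c j * convolve g (E j) A C)
  convolve-combʳ g c A C = begin
    ∑V (λ B → g ⟨ A , B ⟩ * ∑[ j < suc k ] (c j * E j ⟨ B , C ⟩))
      ≡⟨ ∑V-cong (λ B → trans (∑<-distribˡ (suc k) (g ⟨ A , B ⟩) (λ j → c j * E j ⟨ B , C ⟩))
           (∑<-cong (suc k) (λ j _ → exchange (g ⟨ A , B ⟩) (c j) (E j ⟨ B , C ⟩)))) ⟩
    ∑V (λ B → ∑[ j < suc k ] (c j * (g ⟨ A , B ⟩ * E j ⟨ B , C ⟩)))
      ≡⟨ ∑-comm (λ b (j : Fin (suc k)) → c (toℕ j) * (g ⟨ A , enum b ⟩ * E (toℕ j) ⟨ enum b , C ⟩)) ⟩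
    ∑[ j < suc k ] ∑V (λ B → c j * (g ⟨ A , B ⟩ * E j ⟨ B , C ⟩))
      ≡⟨ ∑<-cong (suc k) (λ j _ → sym (*-distribˡ-sum (c j)
          (λ b → g ⟨ A , enum b ⟩ * E j ⟨ enum b , C ⟩))) ⟩
    ∑[ j < suc k ] (c j * convolve g (E j) A C) ∎
    where
    open ≡-Reasoning
    exchange : ∀ a b c → a * (b * c) ≡ b * (a * c)
    exchange = solve-∀ ℚ-ring

  E-mul-𝟙 : ∀ {i j} → i ℕ.≤ k → j ℕ.≤ k → ∀ A C → convolve (E i) (E j) A C ≡ 𝟙 j i * convolve (E i) (E i) A
      C
  E-mul-𝟙 {i} {j} i≤k j≤k A C with j ℕP.≟ i
  ... | yes refl = sym (trans (cong (_* convolve (E i) (E i) A C) (𝟙-refl i))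
      (ℚP.*-identityˡ (convolve (E i) (E i) A C)))
  ... | no j≢i = trans (E-orthogonal i≤k j≤k (j≢i ∘ sym) A C)
      (sym (trans (cong (_* convolve (E i) (E i) A C) (𝟙-≢ j≢i)) (ℚP.*-zeroˡ (convolve (E i) (E i) A C))))

  convolve-E-comb : ∀ {i} → i ℕ.≤ k → ∀ c A C →
    convolve (E i) (λ m → ∑[ j < suc k ] (c j * E j m)) A C ≡ c i * convolve (E i) (E i) A C
  convolve-E-comb {i} i≤k c A C = begin
    convolve (E i) (λ m → ∑[ j < suc k ] (c j * E j m)) A C
      ≡⟨ convolve-combʳ (E i) c A C ⟩
    ∑[ j < suc k ] (c j * convolve (E i) (E j) A C)
      ≡⟨ ∑<-cong (suc k) (λ j j≤k → trans (cong (c j *_) (E-mul-𝟙 i≤k (ℕP.≤-pred j≤k) A C))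
           (exchange (c j) (𝟙 j i) (convolve (E i) (E i) A C))) ⟩
    ∑[ j < suc k ] (𝟙 j i * (c j * convolve (E i) (E i) A C))
      ≡⟨ ∑<-𝟙 (suc k) (λ j → c j * convolve (E i) (E i) A C) (s≤s i≤k) ⟩
    c i * convolve (E i) (E i) A C ∎
    where
    open ≡-Reasoning
    exchange : ∀ a b c → a * (b * c) ≡ b * (a * c)
    exchange = solve-∀ ℚ-ring

  -- The E j sum to the identity matrix, so orthogonality makes each of them idempotent.
  E-idempotent : ∀ {i} → i ℕ.≤ k → ∀ A C → convolve (E i) (E i) A C ≡ E i ⟨ A , C ⟩
  E-idempotent {i} i≤k A C = begin
    P                                                 ≡⟨ sym (ℚP.*-identityˡ P) ⟩
    1ℚ * P                                            ≡⟨ cong (_* P) (sym (θ-top i≤k)) ⟩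
    θ k i * P                                         ≡⟨ sym (convolve-E-comb i≤k (θ k) A C) ⟩
    convolve (E i) (λ m → ∑[ j < suc k ] (θ k j * E j m)) A C
      ≡⟨ ∑V-cong (λ B → cong (E i ⟨ A , B ⟩ *_) (sym (binom-expand ℕP.≤-refl ⟨ B , C ⟩))) ⟩
    convolve (E i) (λ m → binom m k) A C              ≡⟨ convolve-identity (E i) A C ⟩
    E i ⟨ A , C ⟩                                     ∎
    where
    open ≡-Reasoning
    P = convolve (E i) (E i) A C

  convolve-E : ∀ {i} → i ℕ.≤ k → ∀ c A C →
    convolve (E i) (λ m → ∑[ j < suc k ] (c j * E j m)) A C ≡ c i * E i ⟨ A , C ⟩
  convolve-E {i} i≤k c A C = trans (convolve-E-comb i≤k c A C) (cong (c i *_) (E-idempotent i≤k A C))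

  E₀ : ∀ m → binom n k * E 0 m ≡ 1ℚ
  E₀ m = trans (cong (_* E 0 m) (sym θ-zero))
    (trans (sym (residual≡θE z≤n m)) (binom-zero m))

  someV : V
  someV = pick #V (λ e → pos⇒≢0 (binom-pos′ k≤n) (trans (sym (#KSubset≡binom n k)) (cong fromℕ e))) enum
    where
    pick : ∀ m → m ≢ 0 → (Fin m → V) → V
    pick zero    m≢0 f = ⊥-elim (m≢0 refl)
    pick (suc m) m≢0 f = f Fin.zero

  -- The all-ones matrix is `binom n k` times `E 0`, so orthogonality kills every row sum but that
  -- of `E 0`.
  E-rowSum : ∀ {j} → j ℕ.≤ k → ∀ A → ∑V (λ B → E j ⟨ A , B ⟩) ≡ 𝟙 j 0
  E-rowSum {j} j≤k A = begin
    ∑V (λ B → E j ⟨ A , B ⟩)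
      ≡⟨ ∑V-cong (λ B → trans (sym (ℚP.*-identityʳ (E j ⟨ A , B ⟩)))
          (cong (E j ⟨ A , B ⟩ *_) (one ⟨ B , A ⟩))) ⟩
    convolve (E j) (λ m → ∑[ i < suc k ] (𝟙 i 0 * binom n k * E i m)) A A
      ≡⟨ convolve-E j≤k (λ i → 𝟙 i 0 * binom n k) A A ⟩
    𝟙 j 0 * binom n k * E j ⟨ A , A ⟩
      ≡⟨ ℚP.*-assoc (𝟙 j 0) (binom n k) (E j ⟨ A , A ⟩) ⟩
    𝟙 j 0 * (binom n k * E j ⟨ A , A ⟩)
      ≡⟨ 𝟙-subst j 0 (λ i → binom n k * E i ⟨ A , A ⟩) ⟩
    𝟙 j 0 * (binom n k * E 0 ⟨ A , A ⟩)
      ≡⟨ trans (cong (𝟙 j 0 *_) (E₀ ⟨ A , A ⟩)) (ℚP.*-identityʳ (𝟙 j 0)) ⟩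
    𝟙 j 0 ∎
    where
    open ≡-Reasoning
    one : ∀ m → 1ℚ ≡ ∑[ i < suc k ] (𝟙 i 0 * binom n k * E i m)
    one m = sym (trans (∑<-cong (suc k) (λ i _ → ℚP.*-assoc (𝟙 i 0) (binom n k) (E i m)))
      (trans (∑<-𝟙 (suc k) (λ i → binom n k * E i m) (s≤s z≤n)) (E₀ m)))

  comb-rowSum : ∀ c A → ∑V (λ B → ∑[ j < suc k ] (c j * E j ⟨ A , B ⟩)) ≡ c 0
  comb-rowSum c A = begin
    ∑V (λ B → ∑[ j < suc k ] (c j * E j ⟨ A , B ⟩))
      ≡⟨ ∑-comm (λ b (j : Fin (suc k)) → c (toℕ j) * E (toℕ j) ⟨ A , enum b ⟩) ⟩
    ∑[ j < suc k ] ∑V (λ B → c j * E j ⟨ A , B ⟩)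
      ≡⟨ ∑<-cong (suc k) (λ j j≤k → trans (sym (*-distribˡ-sum (c j) (λ b → E j ⟨ A , enum b ⟩)))
           (trans (cong (c j *_) (E-rowSum (ℕP.≤-pred j≤k) A)) (ℚP.*-comm (c j) (𝟙 j 0)))) ⟩
    ∑[ j < suc k ] (𝟙 j 0 * c j)
      ≡⟨ ∑<-𝟙 (suc k) c (s≤s z≤n) ⟩
    c 0 ∎
    where open ≡-Reasoning

  -- By idempotence and symmetry a diagonal entry is a sum of squares of the entries of its row.
  E-diag-nonNeg : ∀ {j} → j ℕ.≤ k → 0ℚ ≤ E j k
  E-diag-nonNeg {j} j≤k = subst (0ℚ ≤_) (trans (E-idempotent j≤k A A) (cong (E j) (⟨⟩-self A)))
    (sum-nonNeg _ (λ b → subst (λ m → 0ℚ ≤ E j ⟨ A , enum b ⟩ * E j m) (⟨⟩-comm A (enum b))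
        (square-nonNeg (E j ⟨ A , enum b ⟩))))
    where A = someV

  -- Eigenvalues of the matrix indicating a fixed intersection size.

  eigenvalue : ℕ → ℕ → ℚ
  eigenvalue = spectrum n k

  -- Binomial inversion writes the indicator through the functions `binom m s`, and each of these is
  -- a combination of the `E j` with coefficients `θ s j`; exchanging the sums gives the definition
  -- of `spectrum`.
  𝟙-expand : ∀ ℓ {m} → m ℕ.≤ k → 𝟙 m ℓ ≡ ∑[ j < suc k ] (eigenvalue ℓ j * E j m)
  𝟙-expand ℓ {m} m≤k = begin
    𝟙 m ℓ
      ≡⟨ sym (ℚP.*-identityˡ (𝟙 m ℓ)) ⟩
    1ℚ * 𝟙 m ℓ
      ≡⟨ cong (_* 𝟙 m ℓ) (sym (sgn-square ℓ)) ⟩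
    sgn ℓ * sgn ℓ * 𝟙 m ℓ
      ≡⟨ trans (ℚP.*-comm (sgn ℓ * sgn ℓ) (𝟙 m ℓ)) (sym (𝟙-subst m ℓ (λ x → sgn ℓ * sgn x))) ⟩
    𝟙 m ℓ * (sgn ℓ * sgn m)
      ≡⟨ rotate (𝟙 m ℓ) (sgn ℓ) (sgn m) ⟩
    sgn ℓ * (sgn m * 𝟙 m ℓ)
      ≡⟨ cong (sgn ℓ *_) (sym (binomial-inversion ℓ m≤k)) ⟩
    sgn ℓ * ∑[ s < suc k ] (sgn s * binom m s * binom s ℓ)
      ≡⟨ ∑<-distribˡ (suc k) (sgn ℓ) (λ s → sgn s * binom m s * binom s ℓ) ⟩
    ∑[ s < suc k ] (sgn ℓ * (sgn s * binom m s * binom s ℓ))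
      ≡⟨ ∑<-cong (suc k) (λ s s≤k → trans (regroup (sgn ℓ) (sgn s) (binom m s) (binom s ℓ))
           (cong₂ (λ u v → u * binom s ℓ * v) (sym (sgn-+ ℓ s)) (binom-expand (ℕP.≤-pred s≤k) m))) ⟩
    ∑[ s < suc k ] (σ s * ∑[ j < suc k ] (θ s j * E j m))
      ≡⟨ ∑<-cong (suc k) (λ s _ → ∑<-distribˡ (suc k) (σ s) (λ j → θ s j * E j m)) ⟩
    ∑[ s < suc k ] (∑[ j < suc k ] (σ s * (θ s j * E j m)))
      ≡⟨ ∑-comm (λ (s j : Fin (suc k)) → σ (toℕ s) * (θ (toℕ s) (toℕ j) * E (toℕ j) m)) ⟩
    ∑[ j < suc k ] (∑[ s < suc k ] (σ s * (θ s j * E j m)))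
      ≡⟨ ∑<-cong (suc k) (λ j _ → trans (∑<-cong (suc k) (λ s _ → sym (ℚP.*-assoc (σ s) (θ s j) (E j m))))
           (sym (∑<-distribʳ (suc k) (λ s → σ s * θ s j) (E j m)))) ⟩
    ∑[ j < suc k ] (eigenvalue ℓ j * E j m) ∎
    where
    open ≡-Reasoning
    σ : ℕ → ℚ
    σ s = sgn (ℓ ℕ.+ s) * binom s ℓ
    rotate : ∀ a b c → a * (b * c) ≡ b * (c * a)
    rotate = solve-∀ ℚ-ring
    regroup : ∀ a b c d → a * (b * c * d) ≡ (a * b) * d * c
    regroup = solve-∀ ℚ-ring

  -- A diagonal entry of the product of `E j` with the indicator matrix, computed twice: entrywise
  -- it is `E j ℓ` times the row sum `eigenvalue ℓ 0`, spectrally it is `eigenvalue ℓ j` times the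
  -- diagonal entry of `E j`.
  E-at-ℓ : ∀ ℓ {j} → j ℕ.≤ k → E j ℓ * eigenvalue ℓ 0 ≡ eigenvalue ℓ j * E j k
  E-at-ℓ ℓ {j} j≤k = begin
    E j ℓ * eigenvalue ℓ 0
      ≡⟨ cong (E j ℓ *_) (sym (trans (∑V-cong (λ B → 𝟙-expand ℓ (⟨⟩≤k A B)))
          (comb-rowSum (eigenvalue ℓ) A))) ⟩
    E j ℓ * ∑V (λ B → 𝟙 ⟨ A , B ⟩ ℓ)
      ≡⟨ *-distribˡ-sum (E j ℓ) (λ b → 𝟙 ⟨ A , enum b ⟩ ℓ) ⟩
    ∑V (λ B → E j ℓ * 𝟙 ⟨ A , B ⟩ ℓ)
      ≡⟨ ∑V-cong (λ B → trans (ℚP.*-comm (E j ℓ) (𝟙 ⟨ A , B ⟩ ℓ)) (trans (sym (𝟙-subst ⟨ A , B ⟩ ℓ (E j)))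
           (trans (ℚP.*-comm (𝟙 ⟨ A , B ⟩ ℓ) (E j ⟨ A , B ⟩)) (cong (E j ⟨ A , B ⟩ *_)
             (trans (cong (λ m → 𝟙 m ℓ) (⟨⟩-comm A B)) (𝟙-expand ℓ (⟨⟩≤k B A))))))) ⟩
    convolve (E j) (λ m → ∑[ i < suc k ] (eigenvalue ℓ i * E i m)) A A
      ≡⟨ convolve-E j≤k (eigenvalue ℓ) A A ⟩
    eigenvalue ℓ j * E j ⟨ A , A ⟩
      ≡⟨ cong (λ m → eigenvalue ℓ j * E j m) (⟨⟩-self A) ⟩
    eigenvalue ℓ j * E j k ∎
    where
    open ≡-Reasoning
    A = someV

  -- The terms with `s < j` vanish. With `s = j + i` the rest is an umbral power, which
  -- `D-vandermonde` rewrites with fixed upper entries.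
  eigenvalue-formula : ∀ ℓ {j} → j ℕ.≤ k → let p = k ∸ j in
    eigenvalue ℓ j ≡ sgn (ℓ ℕ.+ j) * ∑[ a < suc p ]
        (sgn a * binom p a * binom⊖ j ℓ a * binom (n ∸ k ∸ j) (p ∸ a))
  eigenvalue-formula ℓ {j} j≤k = begin
    ∑< (suc k) f
      ≡⟨ cong (λ x → ∑< x f) (sym (trans (ℕP.+-suc j p) (cong suc (ℕP.m+[n∸m]≡n j≤k)))) ⟩
    ∑< (j ℕ.+ suc p) f
      ≡⟨ ∑<-split j (suc p) f ⟩
    ∑< j f + ∑[ i < suc p ] f (j ℕ.+ i)
      ≡⟨ cong₂ _+_ (∑<-zero j (λ s s<j → trans (cong (sgn (ℓ ℕ.+ s) * binom s ℓ *_) (θ-< s<j))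
          (ℚP.*-zeroʳ (sgn (ℓ ℕ.+ s) * binom s ℓ))))
           (∑<-cong (suc p) (λ i i≤p → term i (ℕP.≤-pred i≤p))) ⟩
    0ℚ + ∑[ i < suc p ] (sgn (ℓ ℕ.+ j) *
        (sgn i * binom p i * binom (j ℕ.+ i) ℓ * binom (M ℕ.+ (p ∸ i)) (p ∸ i)))
      ≡⟨ trans (ℚP.+-identityˡ (∑[ i < suc p ]
          (sgn (ℓ ℕ.+ j) * (sgn i * binom p i * binom (j ℕ.+ i) ℓ * binom (M ℕ.+ (p ∸ i)) (p ∸ i)))))
          (sym (∑<-distribˡ (suc p) (sgn (ℓ ℕ.+ j))
           (λ i → sgn i * binom p i * binom (j ℕ.+ i) ℓ * binom (M ℕ.+ (p ∸ i)) (p ∸ i)))) ⟩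
    sgn (ℓ ℕ.+ j) * ∑[ i < suc p ] (sgn i * binom p i * binom (j ℕ.+ i) ℓ * binom (M ℕ.+ (p ∸ i)) (p ∸ i))
      ≡⟨ cong (sgn (ℓ ℕ.+ j) *_) (trans (D-sum p (λ i → binom (j ℕ.+ i) ℓ) (λ x → binom (M ℕ.+ x) x)
          ℕP.≤-refl)
           (trans (D-vandermonde p j ℓ M) (sym (D-sum p (binom⊖ j ℓ) (binom M) ℕP.≤-refl)))) ⟩
    sgn (ℓ ℕ.+ j) * ∑[ a < suc p ] (sgn a * binom p a * binom⊖ j ℓ a * binom M (p ∸ a)) ∎
    where
    open ≡-Reasoning
    p = k ∸ j
    M = n ∸ k ∸ j
    f : ℕ → ℚ
    f s = sgn (ℓ ℕ.+ s) * binom s ℓ * θ s j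
    term : ∀ i → i ℕ.≤ p → f (j ℕ.+ i) ≡ sgn (ℓ ℕ.+ j) *
        (sgn i * binom p i * binom (j ℕ.+ i) ℓ * binom (M ℕ.+ (p ∸ i)) (p ∸ i))
    term i i≤p = trans
      (cong₂ (λ u v → u * binom (j ℕ.+ i) ℓ * v)
        (trans (cong sgn (sym (ℕP.+-assoc ℓ j i))) (sgn-+ (ℓ ℕ.+ j) i))
        (cong₂ _*_ (binom⊖-+ p j i) (cong₂ binom top (sym (ℕP.∸-+-assoc k j i)))))
      (regroup (sgn (ℓ ℕ.+ j)) (sgn i) (binom (j ℕ.+ i) ℓ) (binom p i) (binom (M ℕ.+ (p ∸ i)) (p ∸ i)))
      where
      regroup : ∀ a b c d e → (a * b) * c * (d * e) ≡ a * (b * d * c * e)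
      regroup = solve-∀ ℚ-ring
      k+j≤n : k ℕ.+ j ℕ.≤ n
      k+j≤n = ℕP.≤-trans (ℕP.+-monoʳ-≤ k j≤k) 2k≤n
      M≡ : M ≡ n ∸ (k ℕ.+ j)
      M≡ = ℕP.∸-+-assoc n k j
      j+i≤k : j ℕ.+ i ℕ.≤ k
      j+i≤k = ℕP.≤-trans (ℕP.+-monoʳ-≤ j i≤p) (ℕP.≤-reflexive (ℕP.m+[n∸m]≡n j≤k))
      top : n ∸ j ∸ (j ℕ.+ i) ≡ M ℕ.+ (p ∸ i)
      top = begin
        n ∸ j ∸ (j ℕ.+ i)                       ≡⟨ ℕP.∸-+-assoc n j (j ℕ.+ i) ⟩
        n ∸ (j ℕ.+ (j ℕ.+ i))
            ≡⟨ cong₂ _∸_ (sym (ℕP.m∸n+n≡m k+j≤n)) (ℕP.+-comm j (j ℕ.+ i)) ⟩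
        n ∸ (k ℕ.+ j) ℕ.+ (k ℕ.+ j) ∸ (j ℕ.+ i ℕ.+ j)
            ≡⟨ ℕP.+-∸-assoc (n ∸ (k ℕ.+ j)) (ℕP.+-monoˡ-≤ j j+i≤k) ⟩
        n ∸ (k ℕ.+ j) ℕ.+ (k ℕ.+ j ∸ (j ℕ.+ i ℕ.+ j))
            ≡⟨ cong₂ ℕ._+_ (sym M≡) (trans ([m+n]∸[o+n] k (j ℕ.+ i) j) (sym (ℕP.∸-+-assoc k j i))) ⟩
        M ℕ.+ (p ∸ i) ∎
        where
        [m+n]∸[o+n] : ∀ m o n → m ℕ.+ n ∸ (o ℕ.+ n) ≡ m ∸ o
        [m+n]∸[o+n] m o n = trans (cong₂ _∸_ (ℕP.+-comm m n) (ℕP.+-comm o n)) (ℕP.[m+n]∸[m+o]≡n∸o n m o)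

  -- Combinations of idempotents as certificates.

  ∣∩∁∣≡0⇒≡ : ∀ {m} (A C : Subset m) → ∣ A ∩ ∁ C ∣ ≡ 0 → ∣ C ∩ ∁ A ∣ ≡ 0 → A ≡ C
  ∣∩∁∣≡0⇒≡ []            []            _ _ = refl
  ∣∩∁∣≡0⇒≡ (inside  ∷ A) (inside  ∷ C) p q = cong (inside ∷_) (∣∩∁∣≡0⇒≡ A C p q)
  ∣∩∁∣≡0⇒≡ (outside ∷ A) (outside ∷ C) p q = cong (outside ∷_) (∣∩∁∣≡0⇒≡ A C p q)
  ∣∩∁∣≡0⇒≡ (inside  ∷ A) (outside ∷ C) () q
  ∣∩∁∣≡0⇒≡ (outside ∷ A) (inside  ∷ C) p ()

  ⟨⟩≡k⇒≡ : ∀ A C → ⟨ A , C ⟩ ≡ k → proj₁ A ≡ proj₁ C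
  ⟨⟩≡k⇒≡ A C e = ∣∩∁∣≡0⇒≡ (proj₁ A) (proj₁ C) (zero-part A C e) (zero-part C A (trans (⟨⟩-comm C A) e))
    where
    zero-part : ∀ A C → ⟨ A , C ⟩ ≡ k → ∣ proj₁ A ∩ ∁ (proj₁ C) ∣ ≡ 0
    zero-part A C e = ℕP.+-cancelˡ-≡ k _ 0 (trans (cong (ℕ._+ _) (sym e))
      (trans (∣∩∣+∣∩∁∣ (proj₁ A) (proj₁ C)) (trans (proj₂ A) (sym (ℕP.+-identityʳ k)))))

  enum-injective : ∀ {x y : Fin #V} → proj₁ (enum {n} {k} x) ≡ proj₁ (enum {n} {k} y) → x ≡ y
  enum-injective {x} {y} e = trans (sym (Inverse.strictlyInverseʳ (KSubset-enumeration n k) x))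
    (trans (cong (Inverse.from (KSubset-enumeration n k)) (pair e))
        (Inverse.strictlyInverseʳ (KSubset-enumeration n k) y))
    where
    pair : ∀ {A C : V} → proj₁ A ≡ proj₁ C → A ≡ C
    pair {A , p} {.A , q} refl = cong (A ,_) (ℕP.≡-irrelevant p q)

  comb : (ℕ → ℚ) → ℕ → ℚ
  comb a m = ∑[ j < suc k ] (a j * E j m)

  -- Each E j is the square of a symmetric matrix.
  comb-pairing : ∀ a (Y : V → V → ℚ) →
    ∑V (λ A → ∑V λ C → comb a ⟨ A , C ⟩ * Y A C) ≡
    ∑[ j < suc k ] (a j * ∑V λ W → ∑V λ A → ∑V λ C → E j ⟨ W , A ⟩ * Y A C * E j ⟨ W , C ⟩)
  comb-pairing a Y = begin
    ∑V (λ A → ∑V λ C → comb a ⟨ A , C ⟩ * Y A C)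
      ≡⟨ ∑V-cong (λ A → ∑V-cong λ C → trans (∑<-distribʳ (suc k) (λ j → a j * E j ⟨ A , C ⟩) (Y A C))
           (∑<-cong (suc k) (λ j j≤k → entry j (ℕP.≤-pred j≤k) A C))) ⟩
    ∑V (λ A → ∑V λ C → ∑[ j < suc k ] (a j * ∑V λ W → t j W A C))
      ≡⟨ ∑V-cong (λ A → ∑-comm (λ c (j : Fin (suc k)) → a (toℕ j) * ∑V λ W → t (toℕ j) W A (enum c))) ⟩
    ∑V (λ A → ∑[ j < suc k ] ∑V λ C → a j * ∑V λ W → t j W A C)
      ≡⟨ ∑-comm (λ x (j : Fin (suc k)) → ∑V λ C → a (toℕ j) * ∑V λ W → t (toℕ j) W (enum x) C) ⟩
    ∑[ j < suc k ] ∑V (λ A → ∑V λ C → a j * ∑V λ W → t j W A C)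
      ≡⟨ ∑<-cong (suc k) (λ j _ → trans (∑V-cong
          (λ A → sym (*-distribˡ-sum (a j) (λ c → ∑V λ W → t j W A (enum c)))))
           (sym (*-distribˡ-sum (a j) (λ x → ∑V λ C → ∑V λ W → t j W (enum x) C)))) ⟩
    ∑[ j < suc k ] (a j * ∑V (λ A → ∑V λ C → ∑V λ W → t j W A C))
      ≡⟨ ∑<-cong (suc k) (λ j _ → cong (a j *_)
          (trans (∑V-cong (λ A → ∑-comm (λ c w → t j (enum w) A (enum c))))
           (∑-comm (λ x w → ∑V λ C → t j (enum w) (enum x) C)))) ⟩
    ∑[ j < suc k ] (a j * ∑V λ W → ∑V λ A → ∑V λ C → t j W A C) ∎
    where
    open ≡-Reasoning
    t : ℕ → V → V → V → ℚ
    t j W A C = E j ⟨ W , A ⟩ * Y A C * E j ⟨ W , C ⟩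
    rotate : ∀ x y z → x * y * z ≡ x * z * y
    rotate = solve-∀ ℚ-ring
    entry : ∀ j → j ℕ.≤ k → ∀ A C → a j * E j ⟨ A , C ⟩ * Y A C ≡ a j * ∑V (λ W → t j W A C)
    entry j j≤k A C = trans (ℚP.*-assoc (a j) (E j ⟨ A , C ⟩) (Y A C)) (cong (a j *_)
      (trans (cong (_* Y A C) (sym (E-idempotent j≤k A C)))
        (trans (*-distribʳ-sum (Y A C) (λ w → E j ⟨ A , enum w ⟩ * E j ⟨ enum w , C ⟩))
          (∑V-cong (λ W → trans (cong (λ m → E j m * E j ⟨ W , C ⟩ * Y A C) (⟨⟩-comm A W))
              (rotate (E j ⟨ W , A ⟩) (E j ⟨ W , C ⟩) (Y A C)))))))

  -- The pairing with the rank one matrix X ⊗ X turns each inner sum into a square.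
  comb-psd : ∀ {a} → (∀ j → j ℕ.< suc k → 0ℚ ≤ a j) → ∀ (X : V → ℚ) →
    0ℚ ≤ ∑V (λ A → ∑V λ C → comb a ⟨ A , C ⟩ * (X A * X C))
  comb-psd {a} a≥0 X = subst (0ℚ ≤_) (sym (comb-pairing a (λ A C → X A * X C)))
    (∑<-nonNeg (suc k) (λ j j≤k → *-nonNeg (a≥0 j j≤k)
        (sum-nonNeg _ (λ w → subst (0ℚ ≤_) (square j (enum w))
        (square-nonNeg (∑V (λ A → E j ⟨ enum w , A ⟩ * X A)))))))
    where
    regroup : ∀ a x y b → a * x * (b * y) ≡ a * (x * y) * b
    regroup = solve-∀ ℚ-ring
    square : ∀ j W → ∑V (λ A → E j ⟨ W , A ⟩ * X A) * ∑V (λ A → E j ⟨ W , A ⟩ * X A) ≡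
      ∑V (λ A → ∑V λ C → E j ⟨ W , A ⟩ * (X A * X C) * E j ⟨ W , C ⟩)
    square j W = trans (*-distribʳ-sum (∑V (λ A → E j ⟨ W , A ⟩ * X A))
        (λ x → E j ⟨ W , enum x ⟩ * X (enum x)))
      (∑V-cong (λ A → trans (*-distribˡ-sum (E j ⟨ W , A ⟩ * X A) (λ y → E j ⟨ W , enum y ⟩ * X (enum y)))
        (∑V-cong (λ C → regroup (E j ⟨ W , A ⟩) (X A) (X C) (E j ⟨ W , C ⟩)))))

  _∈ᴸ?_ : ∀ m (L : Subset k) → Dec (m ∈ᴸ L)
  m ∈ᴸ? L = FinP.any? (λ i → (i ∈? L) ×-dec (toℕ i ℕP.≟ m))

  -- The matrices comb a ⟨ A , C ⟩ / N and comb b ⟨ A , C ⟩ certify the lower and the upper bound.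
  lovász : ∀ (L : Subset k) (a b : ℕ → ℚ) {t} →
    (∀ j → j ℕ.< suc k → 0ℚ ≤ a j) → (∀ j → j ℕ.< suc k → 0ℚ ≤ b j) →
    comb a k ≡ 1ℚ → (∀ m → m ℕ.< k → ¬ m ∈ᴸ L → comb a m ≡ 0ℚ) →
    comb b k ≡ t - 1ℚ → (∀ m → m ℕ.< k → m ∈ᴸ L → comb b m ≡ - 1ℚ) →
    a 0 ≡ t → IsLovászNumber (GeneralizedJohnson n k L) (fromℚ t)
  lovász L a b {t} a≥0 b≥0 ak a-off bk b-on a0 =
    ((λ A C → fromℚ (β A C)) , (rational-psd β symmetric psd , rational-trace β trace-one , off) ,
        rational-entrySum β total) ,
    weak-duality {t = t} (λ j → b (toℕ j)) (λ j w A → E (toℕ j) ⟨ enum w , A ⟩) (λ A C → comb b ⟨ A , C ⟩)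
        (λ A C → 𝟙 ⟨ A , C ⟩ k)
      (λ j → b≥0 (toℕ j) (FinP.toℕ<n j)) (comb-pairing b) diagonal
          (λ A C → cover A C (⟨ A , C ⟩ ℕP.≟ k) (⟨ A , C ⟩ ∈ᴸ? L))
    where
    open Duality (GeneralizedJohnson n k L)

    N : ℚ
    N = binom n k

    N-pos : 0ℚ < N
    N-pos = binom-pos′ (ℕP.≤-trans (ℕP.m≤m+n k k) 2k≤n)

    β : V → V → ℚ
    β A C = inv N * comb a ⟨ A , C ⟩

    average : ∀ c → sum {#V} (λ _ → inv N * c) ≡ c
    average c = trans (sum-const #V (inv N * c))
        (trans (cong (_* (inv N * c)) (#KSubset≡binom n k)) (inv-*-cancel c (pos⇒≢0 N-pos)))

    symmetric : ∀ A C → β A C ≡ β C A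
    symmetric A C = cong (λ m → inv N * comb a m) (⟨⟩-comm A C)

    psd : ∀ (X : V → ℚ) → 0ℚ ≤ ∑V (λ A → ∑V λ C → X A * β A C * X C)
    psd X = subst (0ℚ ≤_) (sym value) (*-nonNeg (ℚP.<⇒≤ (inv-pos N-pos)) (comb-psd a≥0 X))
      where
      regroup : ∀ x c f y → x * (c * f) * y ≡ c * (f * (x * y))
      regroup = solve-∀ ℚ-ring
      value : ∑V (λ A → ∑V λ C → X A * β A C * X C) ≡ inv N * ∑V
          (λ A → ∑V λ C → comb a ⟨ A , C ⟩ * (X A * X C))
      value = trans (∑V-cong (λ A → ∑V-cong (λ C → regroup (X A) (inv N) (comb a ⟨ A , C ⟩) (X C))))
        (∑q₂-scale (inv N) (λ A C → comb a ⟨ A , C ⟩ * (X A * X C)))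

    trace-one : ∑V (λ A → β A A) ≡ 1ℚ
    trace-one = trans (∑V-cong (λ A → cong (inv N *_) (trans (cong (comb a) (⟨⟩-self A)) ak))) (average 1ℚ)

    off : ∀ A C → proj₁ A ≢ proj₁ C × ¬ (⟨ A , C ⟩ ∈ᴸ L) → fromℚ (β A C) Defs.≈ Defs.0ℝ
    off A C (A≢C , ∉L) = ≡⇒≈ {fromℚ (β A C)} {Defs.0ℝ} (λ _ → trans (cong (inv N *_)
      (a-off ⟨ A , C ⟩ (ℕP.≤∧≢⇒< (⟨⟩≤k A C) (A≢C ∘ ⟨⟩≡k⇒≡ A C)) ∉L)) (ℚP.*-zeroʳ (inv N)))

    total : ∑V (λ A → ∑V λ C → β A C) ≡ t
    total = trans (∑V-cong (λ A → trans (sym (*-distribˡ-sum (inv N) (λ v → comb a ⟨ A , enum v ⟩)))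
        (cong (inv N *_) (trans (comb-rowSum a A) a0))))
      (average t)

    diagonal : ∀ (Y : V → V → ℚ) → ∑V (λ A → ∑V λ C → 𝟙 ⟨ A , C ⟩ k * Y A C) ≡ ∑V (λ A → Y A A)
    diagonal Y = sum-cong-≗ {#V} (λ u → trans
      (sum-single (λ v → 𝟙 ⟨ enum u , enum v ⟩ k * Y (enum u) (enum v)) u (λ v v≢u →
        trans (cong (_* Y (enum u) (enum v))
            (𝟙-≢ (λ e → v≢u (sym (enum-injective (⟨⟩≡k⇒≡ (enum u) (enum v) e))))))
          (ℚP.*-zeroˡ (Y (enum u) (enum v)))))
      (trans (cong (_* Y (enum u) (enum u)) (trans (cong (λ m → 𝟙 m k) (⟨⟩-self (enum u))) (𝟙-refl k)))
        (ℚP.*-identityˡ (Y (enum u) (enum u)))))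

    cover : ∀ A C → Dec (⟨ A , C ⟩ ≡ k) → Dec (⟨ A , C ⟩ ∈ᴸ L) →
      (proj₁ A ≢ proj₁ C × ¬ (⟨ A , C ⟩ ∈ᴸ L)) ⊎ comb b ⟨ A , C ⟩ ≡ t * 𝟙 ⟨ A , C ⟩ k - 1ℚ
    cover A C (yes e) _ = inj₂ (trans (trans (cong (comb b) e) bk)
        (cong (_- 1ℚ) (sym (trans (cong (t *_) (trans (cong (λ m → 𝟙 m k) e) (𝟙-refl k)))
            (ℚP.*-identityʳ t)))))
    cover A C (no ≢k) (no ∉L) = inj₁ ((λ e → ≢k (trans (cong (λ S → ∣ S ∩ proj₁ C ∣) e) (⟨⟩-self C))) , ∉L)
    cover A C (no ≢k) (yes ∈L) = inj₂ (trans (b-on ⟨ A , C ⟩ (ℕP.≤∧≢⇒< (⟨⟩≤k A C) ≢k) ∈L)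
        (cong (_- 1ℚ) (sym (trans (cong (t *_) (𝟙-≢ ≢k)) (ℚP.*-zeroʳ t)))))

  -- At `m = k` the expansion of `binom k s` has the last term `θ s s * E s k`. Each earlier term is
  -- at most ε `binom k j`, because `θ j j * E j k` is one nonnegative term in the expansion of
  -- `binom k j`. The earlier terms thus add up to less than 1, while `binom k s` is at least 1.
  E-diag-pos : ∀ {s} → s ℕ.≤ k →
    (∀ j → j ℕ.< s → weight n k s j ≤ inv (1ℚ + ∑[ i < s ] binom k i) * weight n k j j) → 0ℚ < E s k
  E-diag-pos {s} s≤k small = ℚP.≰⇒> (λ E≤0 → pos⇒≢0 θE-pos
      (trans (cong (θ s s *_) (ℚP.≤-antisym E≤0 (E-diag-nonNeg s≤k))) (ℚP.*-zeroʳ (θ s s))))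
    where
    W ε : ℚ
    W = ∑[ i < s ] binom k i
    ε = inv (1ℚ + W)
    W≥0 : 0ℚ ≤ W
    W≥0 = ∑<-nonNeg s (λ i _ → binom-nonNeg k i)
    1+W>0 : 0ℚ < 1ℚ + W
    1+W>0 = ℚP.+-mono-<-≤ 0<1 W≥0
    θE≤ : ∀ j → j ℕ.≤ k → θ j j * E j k ≤ binom k j
    θE≤ j j≤k = subst₂ _≤_ (ℚP.+-identityˡ (θ j j * E j k))
      (trans (sym (∑<-snoc j (λ i → θ j i * E i k))) (sym (binom-expand′ j≤k k)))
      (ℚP.+-monoˡ-≤ (θ j j * E j k) (∑<-nonNeg j
          (λ i i<j → *-nonNeg (θ-nonNeg j i) (E-diag-nonNeg (ℕP.≤-trans (ℕP.<⇒≤ i<j) j≤k)))))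
    lower : ∑[ j < s ] (θ s j * E j k) ≤ ε * W
    lower = ℚP.≤-trans (∑<-mono s (λ j j<s → let j≤k = ℕP.≤-trans (ℕP.<⇒≤ j<s) s≤k in
        ℚP.≤-trans (*-monoʳ (E-diag-nonNeg j≤k) (small j j<s))
          (ℚP.≤-trans (ℚP.≤-reflexive (ℚP.*-assoc ε (θ j j) (E j k)))
              (*-monoˡ (ℚP.<⇒≤ (inv-pos 1+W>0)) (θE≤ j j≤k)))))
      (ℚP.≤-reflexive (sym (∑<-distribˡ s ε (λ i → binom k i))))
    1≤binom : ∀ {m k} → k ℕ.≤ m → 1ℚ ≤ binom m k
    1≤binom {m} {zero}  _ = ℚP.≤-reflexive (sym (binom-zero m))
    1≤binom {suc m} {suc k} (s≤s k≤m) = subst₂ _≤_ (ℚP.+-identityʳ 1ℚ) (sym (binom-pascal m k))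
        (ℚP.+-mono-≤ (1≤binom k≤m) (binom-nonNeg m (suc k)))
    -- The reason for the constant 1/(1 + W): the last term keeps at least ε.
    εW≡ : ε * W ≡ 1ℚ - ε
    εW≡ = trans (expand ε W) (cong (_- ε) (trans (ℚP.*-comm ε (1ℚ + W)) (*-inv (pos⇒≢0 1+W>0))))
      where
      expand : ∀ e w → e * w ≡ e * (1ℚ + w) - e
      expand = solve-∀ ℚ-ring
    θE≡ : θ s s * E s k ≡ binom k s - ∑[ j < s ] (θ s j * E j k)
    θE≡ = trans (sym (residual≡θE s≤k k)) (residual-sum s s k)
    θE-pos : 0ℚ < θ s s * E s k
    θE-pos = subst (0ℚ <_) (sym θE≡) (ℚP.<-≤-trans (inv-pos 1+W>0)
      (subst (_≤ binom k s - ∑[ j < s ] (θ s j * E j k)) (trans (cong (λ z → 1ℚ - z) εW≡) (cancel ε))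
        (ℚP.+-mono-≤ (1≤binom s≤k) (ℚP.neg-antimono-≤ lower))))
      where
      cancel : ∀ e → 1ℚ - (1ℚ - e) ≡ e
      cancel = solve-∀ ℚ-ring

  comb-+ : ∀ a b m → comb (λ j → a j + b j) m ≡ comb a m + comb b m
  comb-+ a b m = trans (∑<-cong (suc k) (λ j _ → ℚP.*-distribʳ-+ (E j m) (a j) (b j)))
      (∑<-+ (suc k) (λ j → a j * E j m) (λ j → b j * E j m))

  comb-scale : ∀ c a m → comb (λ j → c * a j) m ≡ c * comb a m
  comb-scale c a m = trans (∑<-cong (suc k) (λ j _ → ℚP.*-assoc c (a j) (E j m)))
      (sym (∑<-distribˡ (suc k) c (λ j → a j * E j m)))

  comb-𝟙 : ∀ {j₀} → j₀ ℕ.≤ k → ∀ m → comb (λ j → 𝟙 j j₀) m ≡ E j₀ m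
  comb-𝟙 j₀≤k m = ∑<-𝟙 (suc k) (λ j → E j m) (s≤s j₀≤k)

  comb-one : ∀ m → comb (λ _ → 1ℚ) m ≡ binom m k
  comb-one m = trans (∑<-cong (suc k) (λ j j≤k → cong (_* E j m) (sym (θ-top (ℕP.≤-pred j≤k)))))
      (sym (binom-expand ℕP.≤-refl m))

  -- Optimal certificates for the graph and for the complementary set L.

  module Optimum (ℓ : ℕ) (ℓ<k : ℓ ℕ.< k) (den num t t′ : ℚ)
    (den≡ : - spectrum n k ℓ (suc ℓ) ≡ den) (num≡ : spectrum n k ℓ 0 ≡ num)
    (t≡ : t ≡ 1ℚ + num * inv den) (t′≡ : t′ ≡ binom n k * inv t)
    (den-pos : 0ℚ < den) (t-pos : 0ℚ < t) (num-nonNeg : 0ℚ ≤ num)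
    (least : ∀ j → j ℕ.< suc k → 0ℚ ≤ den + spectrum n k ℓ j)
    (E-pos : 0ℚ < E (suc ℓ) k) where

    private
      Eₖ N τ : ℚ
      Eₖ = E (suc ℓ) k
      N = binom n k
      -- Equal to (t - 1)/`Eₖ`, the multiple of `E (suc ℓ)` whose diagonal entry is t - 1.
      τ = num * inv den * inv Eₖ

      L : Subset k
      L = ⁅ fromℕ< ℓ<k ⁆

      N-pos : 0ℚ < N
      N-pos = binom-pos′ (ℕP.≤-trans (ℕP.m≤m+n k k) 2k≤n)

      ∈L⇒≡ : ∀ {m} → m ∈ᴸ L → m ≡ ℓ
      ∈L⇒≡ (i , i∈L , refl) = trans (cong toℕ (x∈⁅y⁆⇒x≡y (fromℕ< ℓ<k) i∈L)) (toℕ-fromℕ< ℓ<k)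

      ≡⇒∈L : ∀ {m} → m ≡ ℓ → m ∈ᴸ L
      ≡⇒∈L refl = fromℕ< ℓ<k , x∈⁅x⁆ (fromℕ< ℓ<k) , toℕ-fromℕ< ℓ<k

      ∈∁L⇒≢ : ∀ {m} → m ∈ᴸ ∁ L → m ≢ ℓ
      ∈∁L⇒≢ (i , i∈∁L , refl) e = x∈∁p⇒x∉p i∈∁L
          (subst (Subset._∈ L) (toℕ-injective (trans (toℕ-fromℕ< ℓ<k) (sym e))) (x∈⁅x⁆ (fromℕ< ℓ<k)))

      ∉∁L⇒≡ : ∀ {m} → m ℕ.< k → ¬ m ∈ᴸ ∁ L → m ≡ ℓ
      ∉∁L⇒≡ {m} m<k ∉∁L with m ℕP.≟ ℓ
      ... | yes m≡ℓ = m≡ℓ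
      ... | no m≢ℓ = ⊥-elim (∉∁L (fromℕ< m<k , x∉p⇒x∈∁p
          (λ i∈L → m≢ℓ (∈L⇒≡ (fromℕ< m<k , i∈L , toℕ-fromℕ< m<k))) , toℕ-fromℕ< m<k))

      -- Coefficients in the `E j`. In matrix terms `a` is I + M/den. Since `N * E 0` is the
      -- all-ones matrix J, `a′` is (J + b)/t and `b′` is t′ a - J: adding J turns the value -1 at
      -- `ℓ` into 0, and subtracting it turns the values 0 away from `ℓ` into -1.
      a b a′ b′ : ℕ → ℚ
      a j = 1ℚ + inv den * spectrum n k ℓ j
      b j = τ * 𝟙 j (suc ℓ)
      a′ j = inv t * (N * 𝟙 j 0 + b j)
      b′ j = t′ * a j + - N * 𝟙 j 0

      a≥0 : ∀ j → j ℕ.< suc k → 0ℚ ≤ a j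
      a≥0 j j≤k = subst (0ℚ ≤_) (trans (ℚP.*-distribˡ-+ (inv den) den (spectrum n k ℓ j))
          (cong (_+ inv den * spectrum n k ℓ j) (trans (ℚP.*-comm (inv den) den) (*-inv (pos⇒≢0 den-pos)))))
        (*-nonNeg (ℚP.<⇒≤ (inv-pos den-pos)) (least j j≤k))

      τ≥0 : 0ℚ ≤ τ
      τ≥0 = *-nonNeg (*-nonNeg num-nonNeg (ℚP.<⇒≤ (inv-pos den-pos))) (ℚP.<⇒≤ (inv-pos E-pos))

      b≥0 : ∀ j → j ℕ.< suc k → 0ℚ ≤ b j
      b≥0 j _ = *-nonNeg τ≥0 (𝟙-nonNeg j (suc ℓ))

      a0 : a 0 ≡ t
      a0 = trans (cong (1ℚ +_) (trans (cong (inv den *_) num≡) (ℚP.*-comm (inv den) num))) (sym t≡)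

      comb-a : ∀ {m} → m ℕ.≤ k → comb a m ≡ binom m k + inv den * 𝟙 m ℓ
      comb-a {m} m≤k = trans (comb-+ (λ _ → 1ℚ) (λ j → inv den * spectrum n k ℓ j) m)
        (cong₂ _+_ (comb-one m) (trans (comb-scale (inv den) (spectrum n k ℓ) m)
            (cong (inv den *_) (sym (𝟙-expand ℓ m≤k)))))

      a-k : comb a k ≡ 1ℚ
      a-k = trans (comb-a ℕP.≤-refl) (trans
          (cong₂ (λ p q → p + inv den * q) (binom-self k) (𝟙-≢ (λ e → ℕP.<⇒≢ ℓ<k (sym e))))
          (lemma (inv den)))
        where
        lemma : ∀ x → 1ℚ + x * 0ℚ ≡ 1ℚ
        lemma = solve-∀ ℚ-ring

      a-off : ∀ {m} → m ℕ.< k → m ≢ ℓ → comb a m ≡ 0ℚ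
      a-off m<k m≢ℓ = trans (comb-a (ℕP.<⇒≤ m<k))
          (trans (cong₂ (λ p q → p + inv den * q) (binom-> m<k) (𝟙-≢ m≢ℓ)) (lemma (inv den)))
        where
        lemma : ∀ x → 0ℚ + x * 0ℚ ≡ 0ℚ
        lemma = solve-∀ ℚ-ring

      comb-b : ∀ m → comb b m ≡ τ * E (suc ℓ) m
      comb-b m = trans (comb-scale τ (λ j → 𝟙 j (suc ℓ)) m) (cong (τ *_) (comb-𝟙 ℓ<k m))

      b-k : comb b k ≡ t - 1ℚ
      b-k = trans (comb-b k) (trans (ℚP.*-assoc (num * inv den) (inv Eₖ) Eₖ)
        (trans (cong (num * inv den *_) (trans (ℚP.*-comm (inv Eₖ) Eₖ) (*-inv (pos⇒≢0 E-pos))))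
            (trans (lemma (num * inv den)) (cong (_- 1ℚ) (sym t≡)))))
        where
        lemma : ∀ x → x * 1ℚ ≡ 1ℚ + x - 1ℚ
        lemma = solve-∀ ℚ-ring

      -- The factor `num` in `τ` is the row sum in `E-at-ℓ`, so `num * E (suc ℓ) ℓ` becomes
      -- -`den * Eₖ` and everything else cancels.
      b-ℓ : comb b ℓ ≡ - 1ℚ
      b-ℓ = trans (comb-b ℓ) (trans (regroup num (inv den) (inv Eₖ) (E (suc ℓ) ℓ))
        (trans (cong (inv den * inv Eₖ *_) (trans (cong (E (suc ℓ) ℓ *_) (sym num≡)) (E-at-ℓ ℓ ℓ<k)))
          (trans (regroup′ (inv den) (inv Eₖ) (spectrum n k ℓ (suc ℓ)) Eₖ)
            (cong₂ (λ p q → - (p * q)) (trans (cong (_* inv den) den≡) (*-inv (pos⇒≢0 den-pos)))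
                (*-inv (pos⇒≢0 E-pos))))))
        where
        regroup : ∀ n d e x → n * d * e * x ≡ d * e * (x * n)
        regroup = solve-∀ ℚ-ring
        regroup′ : ∀ d e l x → d * e * (l * x) ≡ - ((- l * d) * (x * e))
        regroup′ = solve-∀ ℚ-ring

      comb-N𝟙 : ∀ c m → comb (λ j → c * 𝟙 j 0) m ≡ c * E 0 m
      comb-N𝟙 c m = trans (comb-scale c (λ j → 𝟙 j 0) m) (cong (c *_) (comb-𝟙 z≤n m))

      comb-a′ : ∀ m → comb a′ m ≡ inv t * (1ℚ + comb b m)
      comb-a′ m = trans (comb-scale (inv t) (λ j → N * 𝟙 j 0 + b j) m) (cong (inv t *_)
        (trans (comb-+ (λ j → N * 𝟙 j 0) b m) (cong (_+ comb b m) (trans (comb-N𝟙 N m) (E₀ m)))))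

      comb-b′ : ∀ m → comb b′ m ≡ t′ * comb a m - 1ℚ
      comb-b′ m = trans (comb-+ (λ j → t′ * a j) (λ j → - N * 𝟙 j 0) m) (cong₂ _+_ (comb-scale t′ a m)
        (trans (comb-N𝟙 (- N) m) (trans (sym (ℚP.neg-distribˡ-* N (E 0 m))) (cong -_ (E₀ m)))))

      t′≥0 : 0ℚ ≤ t′
      t′≥0 = subst (0ℚ ≤_) (sym t′≡) (ℚP.<⇒≤ (*-pos N-pos (inv-pos t-pos)))

      t′*t : t′ * t ≡ N
      t′*t = trans (cong (_* t) t′≡) (trans (lemma N (inv t) t)
          (trans (cong (N *_) (*-inv (pos⇒≢0 t-pos))) (ℚP.*-identityʳ N)))
        where
        lemma : ∀ a b c → a * b * c ≡ a * (c * b)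
        lemma = solve-∀ ℚ-ring

      a′≥0 : ∀ j → j ℕ.< suc k → 0ℚ ≤ a′ j
      a′≥0 j j≤k = *-nonNeg (ℚP.<⇒≤ (inv-pos t-pos))
          (+-nonNeg (*-nonNeg (ℚP.<⇒≤ N-pos) (𝟙-nonNeg j 0)) (b≥0 j j≤k))

      -- Subtracting J affects only the coefficient at 0, where t′ t = N makes it exactly zero.
      b′≥0 : ∀ j → j ℕ.< suc k → 0ℚ ≤ b′ j
      b′≥0 zero _ = ℚP.≤-reflexive (sym (trans (cong (λ z → t′ * z + - N * 1ℚ) a0)
          (trans (cong (_+ - N * 1ℚ) t′*t) (lemma N))))
        where
        lemma : ∀ x → x + - x * 1ℚ ≡ 0ℚ
        lemma = solve-∀ ℚ-ring
      b′≥0 (suc j) j≤k = subst (0ℚ ≤_) (lemma (t′ * a (suc j)) N) (*-nonNeg t′≥0 (a≥0 (suc j) j≤k))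
        where
        lemma : ∀ x y → x ≡ x + - y * 0ℚ
        lemma = solve-∀ ℚ-ring

    ϑ-value : IsLovászNumber (GeneralizedJohnson n k ⁅ fromℕ< ℓ<k ⁆) (fromℚ t)
    ϑ-value = lovász ⁅ fromℕ< ℓ<k ⁆ a b a≥0 b≥0 a-k (λ m m<k ∉L → a-off m<k (∉L ∘ ≡⇒∈L))
      b-k (λ m _ ∈L → trans (cong (comb b) (∈L⇒≡ ∈L)) b-ℓ) a0

    ϑ′-value : IsLovászNumber (GeneralizedJohnson n k (∁ ⁅ fromℕ< ℓ<k ⁆)) (fromℚ t′)
    ϑ′-value = lovász (∁ ⁅ fromℕ< ℓ<k ⁆) a′ b′ a′≥0 b′≥0 a′-k a′-off b′-k b′-on a′0
      where
      a′-k : comb a′ k ≡ 1ℚ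
      a′-k = trans (comb-a′ k) (trans (cong (λ z → inv t * (1ℚ + z)) b-k)
          (trans (lemma (inv t) t) (*-inv (pos⇒≢0 t-pos))))
        where
        lemma : ∀ i t → i * (1ℚ + (t - 1ℚ)) ≡ t * i
        lemma = solve-∀ ℚ-ring
      a′-off : ∀ m → m ℕ.< k → ¬ m ∈ᴸ ∁ L → comb a′ m ≡ 0ℚ
      a′-off m m<k ∉∁L = trans (comb-a′ m)
          (trans (cong (λ z → inv t * (1ℚ + z)) (trans (cong (comb b) (∉∁L⇒≡ m<k ∉∁L)) b-ℓ))
          (ℚP.*-zeroʳ (inv t)))
      b′-k : comb b′ k ≡ t′ - 1ℚ
      b′-k = trans (comb-b′ k) (cong (_- 1ℚ) (trans (cong (t′ *_) a-k) (ℚP.*-identityʳ t′)))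
      b′-on : ∀ m → m ℕ.< k → m ∈ᴸ ∁ L → comb b′ m ≡ - 1ℚ
      b′-on m m<k ∈∁L = trans (comb-b′ m)
          (cong (_- 1ℚ) (trans (cong (t′ *_) (a-off m<k (∈∁L⇒≢ ∈∁L))) (ℚP.*-zeroʳ t′)))
      a′0 : a′ 0 ≡ t′
      a′0 = trans (lemma (inv t) N τ) (sym t′≡)
        where
        lemma : ∀ i n τ → i * (n * 1ℚ + τ * 0ℚ) ≡ n * i
        lemma = solve-∀ ℚ-ring

-- Numerator and denominator of the closed formula.

module Formula where
  open Rational
  open Binomial
  open import Data.Rational.Base using (_+_; _*_; -_)
  open import Data.Nat.Combinatorics using (_C_)

  -- For `j = 0` the factor `binom⊖ 0 ℓ a` is a Kronecker delta, so one term of `eigenvalue-formula`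
  -- survives.
  numerator≡ : ∀ {n k ℓ} → k ℕ.+ k ℕ.≤ n → ℓ ℕ.< k → spectrum n k ℓ 0 ≡ fromℕ (formulaNumerator n k ℓ)
  numerator≡ {n} {k} {ℓ} 2k≤n ℓ<k = begin
    spectrum n k ℓ 0
      ≡⟨ JohnsonScheme.eigenvalue-formula n k 2k≤n ℓ z≤n ⟩
    sgn (ℓ ℕ.+ 0) * ∑[ a < suc k ] (sgn a * binom k a * binom⊖ 0 ℓ a * binom (n ∸ k) (k ∸ a))
      ≡⟨ cong₂ (λ u v → sgn u * v) (ℕP.+-identityʳ ℓ)
          (trans (∑<-cong (suc k) (λ a _ → term a)) (∑<-𝟙 (suc k) f (s≤s (ℕP.<⇒≤ ℓ<k)))) ⟩
    sgn ℓ * (sgn ℓ * binom k ℓ * binom (n ∸ k) (k ∸ ℓ))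
      ≡⟨ regroup (sgn ℓ) (binom k ℓ) (binom (n ∸ k) (k ∸ ℓ)) ⟩
    sgn ℓ * sgn ℓ * (binom k ℓ * binom (n ∸ k) (k ∸ ℓ))
      ≡⟨ trans (cong (_* (binom k ℓ * binom (n ∸ k) (k ∸ ℓ))) (sgn-square ℓ))
          (ℚP.*-identityˡ (binom k ℓ * binom (n ∸ k) (k ∸ ℓ))) ⟩
    binom k ℓ * binom (n ∸ k) (k ∸ ℓ)
      ≡⟨ cong₂ _*_ (trans (binom-sym-∸ (ℕP.<⇒≤ ℓ<k)) (binom≡fromℕ k (k ∸ ℓ)))
          (binom≡fromℕ (n ∸ k) (k ∸ ℓ)) ⟩
    fromℕ (k C (k ∸ ℓ)) * fromℕ ((n ∸ k) C (k ∸ ℓ))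
      ≡⟨ sym (fromℕ-* (k C (k ∸ ℓ)) ((n ∸ k) C (k ∸ ℓ))) ⟩
    fromℕ (formulaNumerator n k ℓ) ∎
    where
    open ≡-Reasoning
    f : ℕ → ℚ
    f a = sgn a * binom k a * binom (n ∸ k) (k ∸ a)
    rotate : ∀ a b c d → a * b * c * d ≡ c * (a * b * d)
    rotate = solve-∀ ℚ-ring
    regroup : ∀ a b c → a * (a * b * c) ≡ a * a * (b * c)
    regroup = solve-∀ ℚ-ring
    term : ∀ a → sgn a * binom k a * binom⊖ 0 ℓ a * binom (n ∸ k) (k ∸ a) ≡ 𝟙 a ℓ * f a
    term a = trans (cong (λ z → sgn a * binom k a * z * binom (n ∸ k) (k ∸ a)) (binom⊖-zero ℓ a))
      (rotate (sgn a) (binom k a) (𝟙 a ℓ) (binom (n ∸ k) (k ∸ a)))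

  /1-sum : ∀ {m} (f : Fin m → ℤ) → RawMonoidDefs.sum ℤ.+-0-rawMonoid f ℚ./ 1 ≡ sum (λ i → f i ℚ./ 1)
  /1-sum {zero}  f = refl
  /1-sum {suc m} f = trans (/1-homo-+ (f Fin.zero) (RawMonoidDefs.sum ℤ.+-0-rawMonoid (f ∘ Fin.suc)))
    (cong (f Fin.zero ℚ./ 1 +_) (/1-sum (f ∘ Fin.suc)))

  /1-sgn : ∀ j → (ℤ.-1ℤ ℤ.^ j) ℚ./ 1 ≡ sgn j
  /1-sgn zero    = refl
  /1-sgn (suc j) = trans (/1-homo-* ℤ.-1ℤ (ℤ.-1ℤ ℤ.^ j))
      (trans (cong (- 1ℚ *_) (/1-sgn j)) (negate (sgn j)))
    where
    negate : ∀ a → - 1ℚ * a ≡ - a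
    negate = solve-∀ ℚ-ring

  denominator≡ : ∀ {n k ℓ} → k ℕ.+ k ℕ.≤ n → ℓ ℕ.< k → - spectrum n k ℓ (suc ℓ) ≡ formulaDenominator n k ℓ
      ℚ./ 1
  denominator≡ {n} {k} {ℓ} 2k≤n ℓ<k = begin
    - spectrum n k ℓ (suc ℓ)
      ≡⟨ cong -_ (JohnsonScheme.eigenvalue-formula n k 2k≤n ℓ ℓ<k) ⟩
    - (sgn (ℓ ℕ.+ suc ℓ) * ∑[ a < suc p ]
        (sgn a * binom p a * binom⊖ (suc ℓ) ℓ a * binom (n ∸ k ∸ suc ℓ) (p ∸ a)))
      ≡⟨ cong (λ z → - (z * S)) (trans (cong sgn (ℕP.+-suc ℓ ℓ))
          (cong -_ (trans (sgn-+ ℓ ℓ) (sgn-square ℓ)))) ⟩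
    - (- 1ℚ * S)
      ≡⟨ unit S ⟩
    S
      ≡⟨ ∑<-cong (suc p) (λ a a≤p → term a (ℕP.≤-pred a≤p)) ⟩
    ∑< (suc p) (g ∘ suc)
      -- The index of the closed formula is a + 1. Its additional term at index 0 contains (k - ℓ -
      -- 1) C (k - ℓ) and is zero.
      ≡⟨ sym (trans (cong (_+ ∑< (suc p) (g ∘ suc)) g0) (ℚP.+-identityˡ (∑< (suc p) (g ∘ suc)))) ⟩
    ∑< (suc (suc p)) g
      ≡⟨ cong (λ x → ∑< (suc x) g) (sym k-ℓ) ⟩
    ∑< (suc (k ∸ ℓ)) g
      ≡⟨ sym (trans (/1-sum {suc (k ∸ ℓ)} (h ∘ toℕ)) (∑<-cong (suc (k ∸ ℓ)) (λ j _ → h/1 j))) ⟩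
    formulaDenominator n k ℓ ℚ./ 1 ∎
    where
    open ≡-Reasoning
    p = k ∸ suc ℓ
    S = ∑[ a < suc p ] (sgn a * binom p a * binom⊖ (suc ℓ) ℓ a * binom (n ∸ k ∸ suc ℓ) (p ∸ a))
    k-ℓ : k ∸ ℓ ≡ suc p
    k-ℓ = ℕP.+-∸-assoc 1 ℓ<k
    h : ℕ → ℤ
    h j = (ℤ.-1ℤ ℤ.^ suc j) ℤ.* ℤ.+ ((suc ℓ C j) ℕ.* ((k ∸ ℓ ∸ 1) C (k ∸ ℓ ∸ j)) ℕ.*
        ((n ∸ k ∸ ℓ ∸ 1) C (k ∸ ℓ ∸ j)))
    g : ℕ → ℚ
    g j = sgn (suc j) * (binom (suc ℓ) j * binom (k ∸ ℓ ∸ 1) (k ∸ ℓ ∸ j) * binom (n ∸ k ∸ ℓ ∸ 1)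
        (k ∸ ℓ ∸ j))
    h/1 : ∀ j → h j ℚ./ 1 ≡ g j
    h/1 j = trans (/1-homo-* (ℤ.-1ℤ ℤ.^ suc j) (ℤ.+ (a ℕ.* b ℕ.* c))) (cong₂ _*_ (/1-sgn (suc j))
      (trans (fromℕ-* (a ℕ.* b) c) (cong₂ _*_
          (trans (fromℕ-* a b) (cong₂ _*_ (sym (binom≡fromℕ (suc ℓ) j))
          (sym (binom≡fromℕ (k ∸ ℓ ∸ 1) (k ∸ ℓ ∸ j)))))
        (sym (binom≡fromℕ (n ∸ k ∸ ℓ ∸ 1) (k ∸ ℓ ∸ j))))))
      where
      a b c : ℕ
      a = suc ℓ C j
      b = (k ∸ ℓ ∸ 1) C (k ∸ ℓ ∸ j)
      c = (n ∸ k ∸ ℓ ∸ 1) C (k ∸ ℓ ∸ j)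
    unit : ∀ a → - (- 1ℚ * a) ≡ a
    unit = solve-∀ ℚ-ring
    g0 : g 0 ≡ 0ℚ
    g0 = trans (cong (λ z → sgn 1 * (binom (suc ℓ) 0 * z * binom (n ∸ k ∸ ℓ ∸ 1) (k ∸ ℓ)))
        (trans (cong₂ binom (cong (_∸ 1) k-ℓ) k-ℓ) (binom-> (ℕP.n<1+n p))))
      (vanish (sgn 1) (binom (suc ℓ) 0) (binom (n ∸ k ∸ ℓ ∸ 1) (k ∸ ℓ)))
      where
      vanish : ∀ a b c → a * (b * 0ℚ * c) ≡ 0ℚ
      vanish = solve-∀ ℚ-ring
    term : ∀ a → a ℕ.≤ p → sgn a * binom p a * binom⊖ (suc ℓ) ℓ a * binom (n ∸ k ∸ suc ℓ) (p ∸ a) ≡ g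
        (suc a)
    term a a≤p = trans
      (trans (cong₂ (λ u v → sgn a * u * v * binom (n ∸ k ∸ suc ℓ) (p ∸ a)) (binom-sym-∸ a≤p)
          (binom⊖-suc ℓ a))
        (regroup (sgn a) (binom p (p ∸ a)) (binom (suc ℓ) (suc a)) (binom (n ∸ k ∸ suc ℓ) (p ∸ a))))
      (cong (sgn (suc (suc a)) *_) (cong₂ _*_
          (cong (binom (suc ℓ) (suc a) *_) (cong₂ binom (sym (cong (_∸ 1) k-ℓ)) p-a))
        (cong₂ binom (trans (cong (n ∸ k ∸_) (sym (ℕP.+-comm ℓ 1))) (sym (ℕP.∸-+-assoc (n ∸ k) ℓ 1))) p-a)))
      where
      p-a : p ∸ a ≡ k ∸ ℓ ∸ suc a
      p-a = sym (cong (_∸ suc a) k-ℓ)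
      regroup : ∀ s b c d → s * b * c * d ≡ - - s * (c * b * d)
      regroup = solve-∀ ℚ-ring

-- The value for large n and its asymptotic expansion.

module Theta (k ℓ : ℕ) (ℓ<k : ℓ ℕ.< k) where
  open Rational
  open Binomial
  open Asymptotics
  open Formula
  open Spectrum k ℓ ℓ<k
  open import Data.Rational.Base using (_+_; _*_; _-_; -_; _≤_; _<_; ∣_∣)
  open import Data.Nat.Base using (_!)
  open import Data.Nat.Combinatorics using (_C_)
  open import Data.Fin.Subset using (⁅_⁆; ∁)

  /-*-cancel : ∀ a b .{{_ : ℕ.NonZero b}} → (ℤ.+ a ℚ./ b) * fromℕ b ≡ fromℕ a
  /-*-cancel a (suc b) = ℚP.toℚᵘ-injective (begin
    ℚ.toℚᵘ ((ℤ.+ a ℚ./ suc b) * fromℕ (suc b))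
      ≈⟨ ℚP.toℚᵘ-homo-* (ℤ.+ a ℚ./ suc b) (fromℕ (suc b)) ⟩
    ℚ.toℚᵘ (ℤ.+ a ℚ./ suc b) ℚᵘ.* ℚ.toℚᵘ (fromℕ (suc b))
      ≈⟨ ℚᵘP.*-cong (ℚP.toℚᵘ-fromℚᵘ (ℚᵘ.mkℚᵘ (ℤ.+ a) b)) (ℚP.toℚᵘ-fromℚᵘ (ℚᵘ.mkℚᵘ (ℤ.+ suc b) 0)) ⟩
    ℚᵘ.mkℚᵘ (ℤ.+ a) b ℚᵘ.* ℚᵘ.mkℚᵘ (ℤ.+ suc b) 0
      ≈⟨ ℚᵘ.*≡* (ℤP.*-assoc (ℤ.+ a) (ℤ.+ suc b) (ℤ.+ 1)) ⟩
    ℚᵘ.mkℚᵘ (ℤ.+ a) 0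
      ≈⟨ ℚᵘP.≃-sym (ℚP.toℚᵘ-fromℚᵘ (ℚᵘ.mkℚᵘ (ℤ.+ a) 0)) ⟩
    ℚ.toℚᵘ (fromℕ a) ∎)
    where open ℚᵘP.≃-Reasoning

  q num t t′ : ℕ → ℚ
  q n   = formulaDenominator n k ℓ ℚ./ 1
  num n = fromℕ (formulaNumerator n k ℓ)
  t n   = 1ℚ + num n * inv (q n)
  t′ n  = fromℕ (n C k) * inv (t n)

  Optimal : ℕ → Set
  Optimal n = (0ℚ < q n × 0ℚ < t n) ×
    (IsLovászNumber (GeneralizedJohnson n k ⁅ fromℕ< ℓ<k ⁆) (fromℚ (t n)) × IsLovászNumber
        (GeneralizedJohnson n k (∁ ⁅ fromℕ< ℓ<k ⁆)) (fromℚ (t′ n)))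

  W-pos : 0ℚ < 1ℚ + ∑[ i < suc ℓ ] binom k i
  W-pos = ℚP.+-mono-<-≤ 0<1 (∑<-nonNeg (suc ℓ) (λ i _ → binom-nonNeg k i))

  Small : ℕ → Set
  Small n = ∀ j → j ℕ.< suc ℓ → weight n k (suc ℓ) j ≤ inv (1ℚ + ∑[ i < suc ℓ ] binom k i) * weight n k j j

  small-eventually : Eventually Small
  small-eventually = ev-all (suc ℓ) {λ j n → weight n k (suc ℓ) j ≤ inv (1ℚ + ∑[ i < suc ℓ ] binom k i) *
      weight n k j j}
    (λ j j<s → weight-small {suc ℓ} {j} j<s ℓ<k (inv-pos W-pos))

  -- Three thresholds meet: n ≥ 2k for the scheme, the least eigenvalue for the semidefiniteness of
  -- `a`, and `Small` for the positive diagonal by which `τ` divides.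
  optimal : Eventually Optimal
  optimal = ev-map₂ {λ n → k ℕ.+ k ℕ.≤ n}
      {λ n → 0ℚ < den n × (∀ j → j ℕ.< suc k → 0ℚ ≤ den n + spectrum n k ℓ j) × Small n}
    (λ n 2k≤n (dp , least , small) → build n 2k≤n dp least small) (ev-≥ (k ℕ.+ k))
    (ev-map₂ (λ _ → _,_) den-pos (ev-map₂ (λ _ → _,_) den+spectrum-nonNeg small-eventually))
    where
    build : ∀ n → k ℕ.+ k ℕ.≤ n → 0ℚ < den n →
      (∀ j → j ℕ.< suc k → 0ℚ ≤ den n + spectrum n k ℓ j) → Small n → Optimal n
    build n 2k≤n dp least small = (q-pos , t-pos) , ϑ-value , ϑ′-value
      where
      q≡ : den n ≡ q n
      q≡ = denominator≡ 2k≤n ℓ<k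
      q-pos : 0ℚ < q n
      q-pos = subst (0ℚ <_) q≡ dp
      num-nonNeg : 0ℚ ≤ num n
      num-nonNeg = fromℕ-nonNeg (formulaNumerator n k ℓ)
      t-pos : 0ℚ < t n
      t-pos = ℚP.+-mono-<-≤ 0<1 (*-nonNeg num-nonNeg (ℚP.<⇒≤ (inv-pos q-pos)))
      open JohnsonScheme.Optimum n k 2k≤n ℓ ℓ<k (q n) (num n) (t n) (t′ n) q≡ (numerator≡ 2k≤n ℓ<k) refl
        (cong (_* inv (t n)) (sym (binom≡fromℕ n k))) q-pos t-pos num-nonNeg
        (λ j j≤k → subst (λ z → 0ℚ ≤ z + spectrum n k ℓ j) q≡ (least j j≤k))
            (JohnsonScheme.E-diag-pos n k 2k≤n ℓ<k small)

  k≡ : k ≡ suc (k ∸ 1)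
  k≡ = sym (ℕP.suc-pred k {{ℕ.>-nonZero (ℕP.≤-trans (s≤s z≤n) ℓ<k)}})

  k-ℓ≡ : k ∸ ℓ ≡ suc (k ∸ suc ℓ)
  k-ℓ≡ = ℕP.+-∸-assoc 1 ℓ<k

  lc lc′ X Cₖ : ℚ
  lc = leadingCoefficient k ℓ ℓ<k
  lc′ = leadingCoefficient′ k ℓ
  X = fromℕ (k ∸ ℓ) * fromℕ (suc ℓ)
  Cₖ = fromℕ (k C (k ∸ ℓ))

  private instance
    k-ℓ≢0 : ℕ.NonZero (k ∸ ℓ)
    k-ℓ≢0 = ℕ.>-nonZero (ℕP.m<n⇒0<n∸m ℓ<k)
    C≢0 : ℕ.NonZero (k C (k ∸ ℓ))
    C≢0 = nCk≢0 (ℕP.m∸n≤m k ℓ)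

  Cₖ-pos : 0ℚ < Cₖ
  Cₖ-pos = fromℕ-pos (ℕ.>-nonZero⁻¹ (k C (k ∸ ℓ)))

  X-pos : 0ℚ < X
  X-pos = *-pos (fromℕ-pos (ℕ.>-nonZero⁻¹ (k ∸ ℓ))) (fromℕ-pos {suc ℓ} (s≤s z≤n))

  lc*X : lc * X ≡ Cₖ
  lc*X = trans (cong (lc *_) (sym (fromℕ-* (k ∸ ℓ) (suc ℓ))))
    (/-*-cancel (k C (k ∸ ℓ)) ((k ∸ ℓ) ℕ.* suc ℓ) {{ℕP.m*n≢0 (k ∸ ℓ) (suc ℓ)}})

  lc′*k!*C : lc′ * (fromℕ (k !) * Cₖ) ≡ X
  lc′*k!*C = trans (cong (lc′ *_) (sym (fromℕ-* (k !) (k C (k ∸ ℓ)))))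
    (trans (/-*-cancel (suc ℓ ℕ.* (k ∸ ℓ)) (k ! ℕ.* (k C (k ∸ ℓ)))
        {{ℕP.m*n≢0 (k !) (k C (k ∸ ℓ)) {{k ℕP.!≢0}}}})
      (trans (fromℕ-* (suc ℓ) (k ∸ ℓ)) (ℚP.*-comm (fromℕ (suc ℓ)) (fromℕ (k ∸ ℓ)))))

  lc-pos : 0ℚ < lc
  lc-pos = subst (0ℚ <_) (trans (cong (_* inv X) (sym lc*X))
      (trans (ℚP.*-assoc lc X (inv X)) (trans (cong (lc *_) (*-inv (pos⇒≢0 X-pos))) (ℚP.*-identityʳ lc))))
    (*-pos Cₖ-pos (inv-pos X-pos))

  -- The two leading coefficients multiply to 1/k!, the leading coefficient of n C k.
  lc*lc′ : lc * lc′ ≡ invfact k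
  lc*lc′ = *-cancelˡ (fromℕ (k !) * Cₖ) (pos⇒≢0 (*-pos (fromℕ-pos (ℕP.1≤n! k)) Cₖ-pos)) (begin
    fromℕ (k !) * Cₖ * (lc * lc′)        ≡⟨ rotate (fromℕ (k !) * Cₖ) lc lc′ ⟩
    lc * (lc′ * (fromℕ (k !) * Cₖ))      ≡⟨ cong (lc *_) lc′*k!*C ⟩
    lc * X                               ≡⟨ lc*X ⟩
    Cₖ                                   ≡⟨ sym (trans (cong (Cₖ *_) (!*invfact k)) (ℚP.*-identityʳ Cₖ)) ⟩
    Cₖ * (fromℕ (k !) * invfact k)       ≡⟨ regroup Cₖ (fromℕ (k !)) (invfact k) ⟩
    fromℕ (k !) * Cₖ * invfact k         ∎)
    where
    open ≡-Reasoning
    rotate : ∀ a b c → a * (b * c) ≡ b * (c * a)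
    rotate = solve-∀ ℚ-ring
    regroup : ∀ a b c → a * (b * c) ≡ b * a * c
    regroup = solve-∀ ℚ-ring

  q~ : q ~ fromℕ (suc ℓ) * invfact (k ∸ suc ℓ) ·n^ (k ∸ suc ℓ)
  q~ = ~-cong (ev-map (λ n 2k≤n → denominator≡ 2k≤n ℓ<k) (ev-≥ (k ℕ.+ k))) den~

  num~ : num ~ binom k ℓ * invfact (k ∸ ℓ) ·n^ (k ∸ ℓ)
  num~ = ~-cong (ev-map (λ n 2k≤n → numerator≡ 2k≤n ℓ<k) (ev-≥ (k ℕ.+ k))) (spectrum-low z≤n)

  -- Read off from q t = q + num: `q` is one order below `num`, so only `num` contributes to the
  -- leading coefficient of the right side.
  t~ : t ~ lc ·n^ 1
  t~ = ~-quotient (ev-map (λ n ((q>0 , _) , _) → expand n q>0) optimal) q~ den-limit-pos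
    (~-limit limit (~-+ (~-raise (ℕP.m<m+n (k ∸ suc ℓ) (s≤s z≤n)) q~)
      (subst (num ~ binom k ℓ * invfact (k ∸ ℓ) ·n^_) (trans k-ℓ≡ (ℕP.+-comm 1 (k ∸ suc ℓ))) num~)))
    where
    expand : ∀ n → 0ℚ < q n → q n * t n ≡ q n + num n
    expand n q>0 = trans (distribute (q n) (num n) (inv (q n)))
        (trans (cong (λ z → q n + num n * z) (*-inv (pos⇒≢0 q>0))) (unit (q n) (num n)))
      where
      distribute : ∀ a b c → a * (1ℚ + b * c) ≡ a + b * (a * c)
      distribute = solve-∀ ℚ-ring
      unit : ∀ a b → a + b * 1ℚ ≡ a + b
      unit = solve-∀ ℚ-ring
    p = k ∸ suc ℓ
    limit : 0ℚ + binom k ℓ * invfact (k ∸ ℓ) ≡ fromℕ (suc ℓ) * invfact p * lc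
    limit = begin
      0ℚ + binom k ℓ * invfact (k ∸ ℓ)
        ≡⟨ ℚP.+-identityˡ (binom k ℓ * invfact (k ∸ ℓ)) ⟩
      binom k ℓ * invfact (k ∸ ℓ)
        ≡⟨ cong₂ (λ u v → u * invfact v) (trans (binom-sym-∸ (ℕP.<⇒≤ ℓ<k))
            (trans (binom≡fromℕ k (k ∸ ℓ)) (sym lc*X))) k-ℓ≡ ⟩
      lc * X * (inv (fromℕ (suc p)) * invfact p)
        ≡⟨ cong (λ z → lc * (fromℕ z * fromℕ (suc ℓ)) * (inv (fromℕ (suc p)) * invfact p)) k-ℓ≡ ⟩
      lc * (fromℕ (suc p) * fromℕ (suc ℓ)) * (inv (fromℕ (suc p)) * invfact p)
        ≡⟨ regroup lc (fromℕ (suc p)) (fromℕ (suc ℓ)) (inv (fromℕ (suc p))) (invfact p) ⟩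
      (fromℕ (suc p) * inv (fromℕ (suc p))) * (fromℕ (suc ℓ) * invfact p * lc)
        ≡⟨ trans (cong (_* (fromℕ (suc ℓ) * invfact p * lc)) (*-inv (fromℕ≢0 {suc p} (s≤s z≤n))))
            (ℚP.*-identityˡ (fromℕ (suc ℓ) * invfact p * lc)) ⟩
      fromℕ (suc ℓ) * invfact p * lc ∎
      where
      open ≡-Reasoning
      regroup : ∀ l a b i f → l * (a * b) * (i * f) ≡ (a * i) * (b * f * l)
      regroup = solve-∀ ℚ-ring

  t*t′ : ∀ {n} → 0ℚ < t n → t n * t′ n ≡ fromℕ (n C k)
  t*t′ {n} t>0 = trans (lemma (t n) (fromℕ (n C k)) (inv (t n)))
      (trans (cong (fromℕ (n C k) *_) (*-inv (pos⇒≢0 t>0))) (ℚP.*-identityʳ (fromℕ (n C k))))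
    where
    lemma : ∀ a b c → a * (b * c) ≡ b * (a * c)
    lemma = solve-∀ ℚ-ring

  t′~ : t′ ~ lc′ ·n^ (k ∸ 1)
  t′~ = ~-quotient (ev-map (λ n ((_ , t>0) , _) → t*t′ t>0) optimal) t~ lc-pos
    (~-limit (sym lc*lc′) (subst ((λ n → fromℕ (n C k)) ~ invfact k ·n^_) k≡
      (~-cong (ev-const λ n → binom≡fromℕ n k) (binom~ 0 k))))

  pow-fromℕ : ∀ {n} → 0 ℕ.< n → ∀ d → pow (ρ n) d * fromℕ (n ℕ.^ d) ≡ 1ℚ
  pow-fromℕ 0<n zero    = refl
  pow-fromℕ {n} 0<n (suc d) = trans (cong (ρ n * pow (ρ n) d *_) (fromℕ-* n (n ℕ.^ d)))
    (trans (regroup (ρ n) (pow (ρ n) d) (fromℕ n) (fromℕ (n ℕ.^ d)))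
        (trans (cong₂ _*_ (n*ρ 0<n) (pow-fromℕ 0<n d)) (ℚP.*-identityˡ 1ℚ)))
    where
    regroup : ∀ a b c d → a * b * (c * d) ≡ (c * a) * (b * d)
    regroup = solve-∀ ℚ-ring

  -- Multiplying the normalised error by n^d. The bound is left as n^d times `ρ n`, which also
  -- covers `d = 0`.
  remainder : ∀ {f c d} → f ~ c ·n^ d →
    Σ[ M ∈ ℚ ] Eventually (λ n → ∣ f n - c * fromℕ (n ℕ.^ d) ∣ ≤ M * (fromℕ (n ℕ.^ d) * ρ n))
  remainder {f} {c} {d} (asymp (within M 0≤M close)) = M , ev-map₂ bound (ev-≥ 1) close
    where
    bound : ∀ n → 1 ℕ.≤ n → ∣ f n * pow (ρ n) d - c ∣ ≤ M * ρ n → ∣ f n - c * fromℕ (n ℕ.^ d) ∣ ≤ M *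
        (fromℕ (n ℕ.^ d) * ρ n)
    bound n 1≤n h = begin
      ∣ f n - c * nᵈ ∣                       ≡⟨ cong ∣_∣ scale ⟩
      ∣ (f n * pow (ρ n) d - c) * nᵈ ∣       ≡⟨ ℚP.∣p*q∣≡∣p∣*∣q∣ (f n * pow (ρ n) d - c) nᵈ ⟩
      ∣ f n * pow (ρ n) d - c ∣ * ∣ nᵈ ∣     ≡⟨ cong (∣ f n * pow (ρ n) d - c ∣ *_)
          (ℚP.0≤p⇒∣p∣≡p (fromℕ-nonNeg (n ℕ.^ d))) ⟩
      ∣ f n * pow (ρ n) d - c ∣ * nᵈ         ≤⟨ *-monoʳ (fromℕ-nonNeg (n ℕ.^ d)) h ⟩
      M * ρ n * nᵈ                           ≡⟨ regroup M (ρ n) nᵈ ⟩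
      M * (nᵈ * ρ n)                         ∎
      where
      open ℚP.≤-Reasoning
      nᵈ = fromℕ (n ℕ.^ d)
      regroup : ∀ a b c → a * b * c ≡ a * (c * b)
      regroup = solve-∀ ℚ-ring
      distribute : ∀ f r c x → f * (r * x) - c * x ≡ (f * r - c) * x
      distribute = solve-∀ ℚ-ring
      scale : f n - c * nᵈ ≡ (f n * pow (ρ n) d - c) * nᵈ
      scale = trans (cong (_- c * nᵈ) (sym
          (trans (cong (f n *_) (pow-fromℕ 1≤n d)) (ℚP.*-identityʳ (f n)))))
        (distribute (f n) (pow (ρ n) d) c nᵈ)

  ^ᶻ-1 : ∀ n → n ^ᶻ (ℤ.+ k ℤ.- ℤ.+ 1) ≡ fromℕ (n ℕ.^ (k ∸ 1))
  ^ᶻ-1 n = trans (cong (λ x → n ^ᶻ (ℤ.+ x ℤ.- ℤ.+ 1)) k≡) (lemma (k ∸ 1))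
    where
    lemma : ∀ m → n ^ᶻ (ℤ.+ suc m ℤ.- ℤ.+ 1) ≡ fromℕ (n ℕ.^ m)
    lemma m = refl

  ^ᶻ-2 : ∀ {n} → 0 ℕ.< n → n ^ᶻ (ℤ.+ k ℤ.- ℤ.+ 2) ≡ fromℕ (n ℕ.^ (k ∸ 1)) * ρ n
  ^ᶻ-2 {suc n} 0<n = trans (cong (λ x → suc n ^ᶻ (ℤ.+ x ℤ.- ℤ.+ 2)) k≡) (lemma (k ∸ 1))
    where
    lemma : ∀ m → suc n ^ᶻ (ℤ.+ suc m ℤ.- ℤ.+ 2) ≡ fromℕ (suc n ℕ.^ m) * ρ (suc n)
    -- The case `k = 1`, where the exponent k - 2 is -1 and the power is a genuine reciprocal.
    lemma zero = trans (*-cancelˡ (fromℕ (suc n ℕ.^ 1)) (fromℕ≢0 (ℕP.m^n>0 (suc n) 1))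
        (trans (ℚP.*-comm (fromℕ (suc n ℕ.^ 1)) (suc n ^ᶻ ℤ.-[1+ 0 ]))
          (trans (/-*-cancel 1 (suc n ℕ.^ 1) {{ℕP.m^n≢0 (suc n) 1}})
            (sym (trans (cong (λ z → fromℕ z * ρ (suc n)) (ℕP.*-identityʳ (suc n))) (n*ρ 0<n))))))
      (sym (ℚP.*-identityˡ (ρ (suc n))))
    lemma (suc m) = sym (trans (cong (_* ρ (suc n)) (fromℕ-* (suc n) (suc n ℕ.^ m)))
      (trans (regroup (fromℕ (suc n)) (fromℕ (suc n ℕ.^ m)) (ρ (suc n)))
        (trans (cong (fromℕ (suc n ℕ.^ m) *_) (n*ρ 0<n)) (ℚP.*-identityʳ (fromℕ (suc n ℕ.^ m))))))
      where
      regroup : ∀ a b c → a * b * c ≡ b * (a * c)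
      regroup = solve-∀ ℚ-ring

  rewrite-bound : ∀ {f : ℕ → ℚ} {c : ℚ} {u v u′ v′ : ℕ → ℚ} → (∀ n → 0 ℕ.< n → u n ≡ u′ n) →
      (∀ n → 0 ℕ.< n → v n ≡ v′ n) →
    Σ[ M ∈ ℚ ] Eventually (λ n → ∣ f n - c * u n ∣ ≤ M * v n) →
    Σ[ M ∈ ℚ ] Eventually (λ n → ∣ f n - c * u′ n ∣ ≤ M * v′ n)
  rewrite-bound {f} {c} e e′ (M , h) = M , ev-map₂
    (λ n 0<n → subst₂ (λ x y → ∣ f n - c * x ∣ ≤ M * y) (e n 0<n) (e′ n 0<n)) (ev-≥ 1) h

  bound-t : Σ[ M ∈ ℚ ] Eventually (λ n → ∣ t n - lc * fromℕ n ∣ ≤ M * ∣ 1ℚ ∣)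
  bound-t = rewrite-bound {t} {lc} {λ n → fromℕ (n ℕ.^ 1)} {λ n → fromℕ (n ℕ.^ 1) * ρ n} {fromℕ}
      {λ _ → ∣ 1ℚ ∣}
    (λ n _ → power n) (λ n 0<n → trans (cong (_* ρ n) (power n)) (n*ρ 0<n)) (remainder t~)
    where
    power : ∀ n → fromℕ (n ℕ.^ 1) ≡ fromℕ n
    power n = cong fromℕ (ℕP.*-identityʳ n)

  bound-t′ : Σ[ M ∈ ℚ ] Eventually (λ n → ∣ t′ n - lc′ * n ^ᶻ (ℤ.+ k ℤ.- ℤ.+ 1) ∣ ≤ M * ∣ n ^ᶻ
      (ℤ.+ k ℤ.- ℤ.+ 2) ∣)
  bound-t′ = rewrite-bound {t′} {lc′} {λ n → fromℕ (n ℕ.^ (k ∸ 1))} {λ n → fromℕ (n ℕ.^ (k ∸ 1)) * ρ n}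
      {λ n → n ^ᶻ (ℤ.+ k ℤ.- ℤ.+ 1)} {λ n → ∣ n ^ᶻ (ℤ.+ k ℤ.- ℤ.+ 2) ∣}
    (λ n _ → sym (^ᶻ-1 n))
    (λ n 0<n → trans (sym (ℚP.0≤p⇒∣p∣≡p (*-nonNeg (fromℕ-nonNeg (n ℕ.^ (k ∸ 1))) (ρ-nonNeg n))))
        (cong ∣_∣ (sym (^ᶻ-2 0<n))))
    (remainder t′~)

  t-formula : ∀ {n} → 0ℚ < q n → Σ[ nz ∈ ℚ.NonZero (q n) ] t n ≡ 1ℚ + (num n ℚ.÷ q n) {{nz}}
  t-formula {n} q>0 = nz , cong (λ z → 1ℚ + num n * z) (*-cancelˡ (q n) (pos⇒≢0 q>0)
      (trans (*-inv (pos⇒≢0 q>0)) (sym (ℚP.*-inverseʳ (q n) {{nz}}))))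
    where
    nz : ℚ.NonZero (q n)
    nz = ℚ.≢-nonZero (pos⇒≢0 q>0)

-- From rational sequences to statements about real numbers.

open import Defs
open import Data.Fin.Subset using (⁅_⁆; ∁)
open import Data.Integer.Base using (+_)
open import Data.Nat.Combinatorics using (_C_)
open import Data.Rational.Base using (NonZero)
open Asymptotics using (ev-map)
open SemidefiniteDuality using (≡⇒≈)

constant-≤ : ∀ {p q} → p ℚ.≤ q → ∀ {x y : ℝ} → (∀ i → seq x i ≡ p) → (∀ i → seq y i ≡ q) → x ≤ y
constant-≤ {p} {q} p≤q x≡ y≡ ε 0<ε = 0 , λ i _ → ℚP.≤-trans (ℚP.≤-reflexive (x≡ i))
  (ℚP.≤-trans p≤q (ℚP.≤-trans (ℚP.≤-reflexive (sym (ℚP.+-identityʳ q)))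
      (ℚP.≤-trans (ℚP.+-monoʳ-≤ q (ℚP.<⇒≤ 0<ε)) (ℚP.≤-reflexive (cong (ℚ._+ ε) (sym (y≡ i)))))))

=O-rational : ∀ (f g h : ℕ → ℚ.ℚ) → Σ[ M ∈ ℚ.ℚ ] (Eventually λ n → ℚ.∣ f n ℚ.- g n ∣ ℚ.≤ M ℚ.* ℚ.∣ h n ∣) →
  (λ n → fromℚ (f n) - fromℚ (g n)) =O (λ n → fromℚ (h n))
=O-rational f g h (M , b) = fromℚ M , ev-map (λ n p → constant-≤ p
  {abs (fromℚ (f n) - fromℚ (g n))} {fromℚ M * abs (fromℚ (h n))} (λ _ → refl) (λ _ → refl)) b

-- The constant `r` is positive and serves as its own bound for apartness from 0.
÷-rational : ∀ {p q r} → 0ℚ ℚ.< r → r ℚ.* p ≡ q → fromℚ p ≈ fromℚ q ÷ fromℚ r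
÷-rational {p} {q} {r} 0<r e =
  (r , 0<r , 0 , λ _ _ → ℚP.≤-reflexive
      (trans (sym (ℚP.0≤p⇒∣p∣≡p (ℚP.<⇒≤ 0<r))) (cong ℚ.∣_∣ (sym (ℚP.+-identityʳ r))))) ,
  ≡⇒≈ {fromℚ p * fromℚ r} {fromℚ q} (λ _ → trans (ℚP.*-comm p r) e)

theorem4 : (k ℓ : ℕ) (ℓ<k : ℓ ℕ.< k) →
    let L  = ⁅ fromℕ< ℓ<k ⁆
        L′ = ∁ L
    in
    Σ[ ϑ ∈ (ℕ → ℝ) ] Σ[ ϑ′ ∈ (ℕ → ℝ) ]
      ( (Eventually λ n → IsLovászNumber (GeneralizedJohnson n k L) (ϑ n))
      × (Eventually λ n → IsLovászNumber (GeneralizedJohnson n k L′) (ϑ′ n))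
      × (Eventually λ n →
          Σ[ nz ∈ NonZero (formulaDenominator n k ℓ ℚ./ 1) ]
            ϑ n ≈ fromℚ (1ℚ ℚ.+ (fromℕ (formulaNumerator n k ℓ) ℚ.÷ (formulaDenominator n k ℓ ℚ./ 1)) {{nz}}))
      × ((λ n → ϑ n - fromℚ (leadingCoefficient k ℓ ℓ<k ℚ.* fromℕ n)) =O (λ _ → 1ℝ))
      × (Eventually λ n → ϑ′ n ≈ fromℚ (fromℕ (n C k)) ÷ ϑ n)
      × ((λ n → ϑ′ n - fromℚ (leadingCoefficient′ k ℓ ℚ.* n ^ᶻ (+ k ℤ.- + 1)))
          =O (λ n → fromℚ (n ^ᶻ (+ k ℤ.- + 2))))
      )
theorem4 k ℓ ℓ<k =
  (λ n → fromℚ (t n)) , (λ n → fromℚ (t′ n)) ,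
  ev-map (λ n (_ , l , _) → l) optimal ,
  ev-map (λ n (_ , _ , l) → l) optimal ,
  ev-map (λ n ((q>0 , _) , _) → formula n q>0) optimal ,
  =O-rational t (λ n → leadingCoefficient k ℓ ℓ<k ℚ.* fromℕ n) (λ _ → 1ℚ) bound-t ,
  ev-map (λ n ((_ , t>0) , _) → ÷-rational t>0 (t*t′ t>0)) optimal ,
  =O-rational t′ (λ n → leadingCoefficient′ k ℓ ℚ.* n ^ᶻ (+ k ℤ.- + 1)) (λ n → n ^ᶻ (+ k ℤ.- + 2)) bound-t′
  where
  open Theta k ℓ ℓ<k
  formula : ∀ n → 0ℚ ℚ.< q n → Σ[ nz ∈ NonZero (q n) ]
    fromℚ (t n) ≈ fromℚ (1ℚ ℚ.+ (fromℕ (formulaNumerator n k ℓ) ℚ.÷ q n) {{nz}})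
  formula n q>0 = let nz , e = t-formula {n} q>0 in
    nz , ≡⇒≈ {fromℚ (t n)} {fromℚ (1ℚ ℚ.+ (fromℕ (formulaNumerator n k ℓ) ℚ.÷ q n) {{nz}})} (λ _ → e)
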